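{- $\mathrm{nfc}(\mathcal{UHIT}_{\delta=6})^{\max} = \mathrm{nfc}(\mathcal{MU}_{\delta=6})^{\max} = \mathrm{minvdeg}(\mathcal{UHIT}_{\delta=6}) = \mathrm{minvdeg}(\mathcal{MU}_{\delta=6}) = 8 = \mathrm{N}(6) - 1$. Here $\mathrm{nfc}(\mathcal{D})^{\max}$ denotes the maximum (supremum) of $\mathrm{nfc}(F)$ over $F \in \mathcal{D}$.
   Context: Literals come with a fixed-point-free involution $x \mapsto \overline{x}$; variables are positive literals. A clause is a finite set $C$ of literals with $C \cap \overline{C} = \emptyset$; a clause-set is a finite set of clauses. $\mathrm{var}(F)$, $n(F) = |\mathrm{var}(F)|$, $c(F) = |F|$, $\delta(F) = c(F) - n(F)$. $F$ is satisfiable iff some assignment of truth values to variables makes a literal of every clause true. $\mathcal{MU}$ is the class of minimally unsatisfiable clause-sets ($F$ unsatisfiable, $F \setminus \{C\}$ satisfiable for all $C \in F$). $F$ is hitting if for all distinct $C, D \in F$ we have $C \cap \overline{D} \ne \emptyset$; $\mathcal{UHIT}$ is the class of unsatisfiable hitting clause-sets. $\mathcal{C}_{\delta = k} = \{F \in \mathcal{C} : \delta(F) = k\}$. A clause $C \in F$ is full if $\mathrm{var}(C) = \mathrm{var}(F)$; $\mathrm{nfc}(F)$ is the number of full clauses of $F$. $\mathrm{ld}_F(x)$ is the number of clauses of $F$ containing $x$, $\mathrm{vdeg}_F(v) = \mathrm{ld}_F(v)+\mathrm{ld}_F(\overline{v})$, $\mathrm{minvdeg}(F) = \min_{v \in \mathrm{var}(F)}\mathrm{vdeg}_F(v)$;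 for a class $\mathcal{D}$, $\mathrm{minvdeg}(\mathcal{D})$ is the supremum of $\mathrm{minvdeg}(F)$ over $F \in \mathcal{D}$ with $n(F) > 0$. $\mathrm{N}(1) = 2$, $\mathrm{N}(k) = \max_{i \in \{2,\dots,k\}} \min(2i, \mathrm{N}(k-i+1)+i)$ for $k \ge 2$ (so $\mathrm{N}(6) = 9$). -}

module Defs where

open import Data.Bool.Base using (Bool; true; not)
open import Data.Integer.Base using (ℤ; _⊖_)
open import Data.List.Base
  using (List; []; _∷_; map; concatMap; length; filter; deduplicate; foldr; zipWith;
         applyUpTo; applyDownFrom)
open import Data.List.Membership.Propositional using (_∈_; _∉_)
open import Data.List.Relation.Binary.Subset.Propositional using (_⊆_)
import Data.List.Membership.DecPropositional as DecMembership
import Data.List.Relation.Binary.Subset.DecPropositional as DecSubset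
open import Data.List.Relation.Unary.All using (All)
open import Data.List.Relation.Unary.AllPairs using (AllPairs)
import Data.List.Relation.Unary.AllPairs.Properties as AllPairs
open import Data.List.Relation.Unary.Any using (Any)
open import Data.List.Properties using (map-applyUpTo)
open import Data.Nat.Base using (ℕ; zero; suc; _+_; _*_; _∸_; _⊓_; _⊔_; _≤_; _<_)
open import Data.Nat.Properties as ℕ using ()
open import Data.Product.Base using (∃-syntax; _×_; _,_)
open import Relation.Binary.Definitions using (Decidable; DecidableEquality)
open import Relation.Binary.PropositionalEquality
  using (_≡_; refl; sym; trans; cong; cong₂)
open import Relation.Nullary.Decidable using (map′; ¬?; _×-dec_; no)
open import Relation.Nullary.Negation using (¬_)

-- Finite sets are represented by lists; this is equality of the represented sets.

infix 4 _≐_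

_≐_ : {A : Set} → List A → List A → Set
xs ≐ ys = xs ⊆ ys × ys ⊆ xs

-- The variables are the natural numbers.

Variable : Set
Variable = ℕ

data Literal : Set where
  pos neg : Variable → Literal

var : Literal → Variable
var (pos v) = v
var (neg v) = v

comp : Literal → Literal
comp (pos v) = neg v
comp (neg v) = pos v

_≟ˡ_ : DecidableEquality Literal
pos v ≟ˡ pos w = map′ (cong pos) (cong var) (v ℕ.≟ w)
pos v ≟ˡ neg w = no λ ()
neg v ≟ˡ pos w = no λ ()
neg v ≟ˡ neg w = map′ (cong neg) (cong var) (v ℕ.≟ w)

open DecMembership _≟ˡ_ using (_∈?_)
open DecSubset _≟ˡ_ using () renaming (_⊆?_ to _⊆ˡ?_)
open DecSubset ℕ._≟_ using () renaming (_⊆?_ to _⊆ᵛ?_)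

record Clause : Set where
  field
    literals  : List Literal
    clashFree : ∀ {x} → x ∈ literals → comp x ∉ literals

open Clause public

infix 4 _≈_ _≈?_

_≈_ : Clause → Clause → Set
C ≈ D = literals C ≐ literals D

_≈?_ : Decidable _≈_
C ≈? D = (literals C ⊆ˡ? literals D) ×-dec (literals D ⊆ˡ? literals C)

varᶜ : Clause → List Variable
varᶜ C = map var (literals C)

-- Each element of a clause-set is listed exactly once, so that cardinalities
-- are lengths of lists.

record ClauseSet : Set where
  field
    clauses  : List Clause
    distinct : AllPairs (λ C D → ¬ C ≈ D) clauses

open ClauseSet public

infixl 6 _∖_

_∖_ : ClauseSet → Clause → ClauseSet
F ∖ C = record
  { clauses  = filter (λ D → ¬? (C ≈? D)) (clauses F)
  ; distinct = AllPairs.filter⁺ (λ D → ¬? (C ≈? D)) (distinct F)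
  }

varˢ : ClauseSet → List Variable
varˢ F = deduplicate ℕ._≟_ (concatMap varᶜ (clauses F))

n c : ClauseSet → ℕ
n F = length (varˢ F)
c F = length (clauses F)

δ : ClauseSet → ℤ
δ F = c F ⊖ n F

Assignment : Set
Assignment = Variable → Bool

eval : Assignment → Literal → Bool
eval φ (pos v) = φ v
eval φ (neg v) = not (φ v)

Satisfiable : ClauseSet → Set
Satisfiable F = ∃[ φ ] All (λ C → Any (λ x → eval φ x ≡ true) (literals C)) (clauses F)

Class : Set₁
Class = ClauseSet → Set

MU : Class
MU F = ¬ Satisfiable F × (∀ {C} → C ∈ clauses F → Satisfiable (F ∖ C))

Hitting : Class
Hitting F = ∀ {C D} → C ∈ clauses F → D ∈ clauses F → ¬ C ≈ D →
            ∃[ x ] (x ∈ literals C × comp x ∈ literals D)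

UHIT : Class
UHIT F = ¬ Satisfiable F × Hitting F

_[δ=_] : Class → ℤ → Class
(𝒞 [δ= k ]) F = 𝒞 F × δ F ≡ k

Full : ClauseSet → Clause → Set
Full F C = varᶜ C ≐ varˢ F

full? : Decidable Full
full? F C = (varᶜ C ⊆ᵛ? varˢ F) ×-dec (varˢ F ⊆ᵛ? varᶜ C)

nfc : ClauseSet → ℕ
nfc F = length (filter (full? F) (clauses F))

ld : ClauseSet → Literal → ℕ
ld F x = length (filter (λ C → x ∈? literals C) (clauses F))

vdeg : ClauseSet → Variable → ℕ
vdeg F v = ld F (pos v) + ld F (neg v)

-- The value 0 on the empty list is a dummy: minvdeg F is only used if 0 < n F.

minimum : List ℕ → ℕ
minimum []       = 0
minimum (m ∷ ms) = foldr _⊓_ m ms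

minvdeg : ClauseSet → ℕ
minvdeg F = minimum (map (vdeg F) (varˢ F))

WithVariables : Class → Class
WithVariables 𝒟 F = 𝒟 F × 0 < n F

IsUpperBound : (ClauseSet → ℕ) → Class → ℕ → Set
IsUpperBound f 𝒟 u = ∀ F → 𝒟 F → f F ≤ u

IsMaximum : (ClauseSet → ℕ) → Class → ℕ → Set
IsMaximum f 𝒟 m = IsUpperBound f 𝒟 m × ∃[ F ] (𝒟 F × f F ≡ m)

IsSupremum : (ClauseSet → ℕ) → Class → ℕ → Set
IsSupremum f 𝒟 s = IsUpperBound f 𝒟 s × (∀ u → IsUpperBound f 𝒟 u → s ≤ u)

nfc[_]max≡_ : Class → ℕ → Set
nfc[ 𝒟 ]max≡ m = IsMaximum nfc 𝒟 m

minvdeg[_]≡_ : Class → ℕ → Set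
minvdeg[ 𝒟 ]≡ s = IsSupremum minvdeg (WithVariables 𝒟) s

maximum : List ℕ → ℕ
maximum = foldr _⊔_ 0

-- nonMersenne k lists N k , … , N 1.  In the list for 1 + k, the index i = 2 , 3 , …
-- is paired with N k , N (k - 1) , …, that is, with N ((1 + k) - i + 1).
-- N 0 is a dummy value.

nonMersenne : ℕ → List ℕ
nonMersenne 0             = []
nonMersenne 1             = 2 ∷ []
nonMersenne (suc (suc k)) =
  let prev = nonMersenne (suc k) in
  maximum (zipWith (λ i m → (2 * i) ⊓ (m + i)) (applyUpTo (2 +_) (suc k)) prev) ∷ prev

N : ℕ → ℕ
N k with nonMersenne k
... | []    = 0
... | m ∷ _ = m

private
  nonMersenne-spec : ∀ k → nonMersenne k ≡ applyDownFrom (λ j → N (suc j)) k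
  nonMersenne-spec 0             = refl
  nonMersenne-spec 1             = refl
  nonMersenne-spec (suc (suc k)) = cong (N (suc (suc k)) ∷_) (nonMersenne-spec (suc k))

  zipWith-up-down : ∀ (f : ℕ → ℕ → ℕ) (g h : ℕ → ℕ) k →
    zipWith f (applyUpTo g k) (applyDownFrom h k) ≡ applyUpTo (λ j → f (g j) (h (k ∸ suc j))) k
  zipWith-up-down f g h zero    = refl
  zipWith-up-down f g h (suc k) =
    cong (f (g 0) (h k) ∷_) (zipWith-up-down f (λ j → g (suc j)) h k)

-- The defining recursion of N, for argument k + 2.

N-rec : ∀ k → N (2 + k) ≡
  maximum (map (λ i → (2 * i) ⊓ (N (suc (2 + k ∸ i)) + i)) (applyUpTo (2 +_) (suc k)))
N-rec k = cong maximum (trans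
  (cong (zipWith _ (applyUpTo (2 +_) (suc k))) (nonMersenne-spec (suc k)))
  (trans (zipWith-up-down _ (2 +_) (λ j → N (suc j)) (suc k))
         (sym (map-applyUpTo (2 +_) _ (suc k)))))

{-# OPTIONS --safe #-}

-- The upper bound rests on two facts about a clause-set without nontrivial autarky (a lean one):
-- every nonempty set S of variables is touched by more than |S| clauses (Hall, Tarsi), and if V is
-- minimal with at most |V| + k touching clauses, then setting any literal to true keeps leanness,
-- so no literal on V occurs more than k times.  If all degrees are at least 9 and the deficiency
-- is 6, such a V has k = 6, every v ∈ V has a 5-side (a literal occurring exactly 5 times), and
-- satisfying the 5-side leaves on a set Q(v) of variables a critical clause-set of deficiency 2,
-- in which every literal occurs twice; each variable of Q(v) occurs in the whole 5-side of v.
--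
-- For u ∈ Q(v), the sets Q(u) and Q(v) cannot be disjoint: either an autarky can be pieced
-- together, or Q(u) would embed into a clause-set of deficiency 1, which is a tree of resolutions
-- and hence too simple.  So they meet, and submodularity gives Q(u) ∪ Q(v) = V.  Counting then
-- yields Q(v) = V ─ {v} for all v and |V| = 3, with 9 clauses that are full on V.  Two of these
-- agree on V; by minimal unsatisfiability the clauses not touching V have two models, which again
-- contradicts the tree structure in deficiency 1.
--
-- As a full clause contains every variable, nfc is at most minvdeg.  The value 8 is attained by
-- a hitting clause-set with 8 full and 2 binary clauses on 4 variables.

module Submission where

open import Defs
open import Data.Bool.Base using (Bool; true; false; not; _∧_; _∨_; if_then_else_)
open import Data.Bool.Properties using (not-involutive)
open import Data.Empty using (⊥; ⊥-elim)
open import Data.Fin.Base using (Fin; zero; suc)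
open import Data.Fin.Properties using (_≟_)
open import Data.List.Base using ([]; _∷_)
open import Data.Maybe.Base using (Maybe; just; nothing; is-just)
open import Data.Nat.Base using (ℕ; zero; suc; _+_; _*_; _∸_; _^_; _⊓_; _≤_; _<_; z≤n; s≤s)
open import Data.Nat.Properties as ℕ
  using (≤-trans; ≤-reflexive; ≤-refl; ≤-antisym; _≤?_; _<?_; ≰⇒>; ≮⇒≥; m≤m+n; m≤n+m; n≤1+n; +-suc;
         +-cancelˡ-≡; +-cancelʳ-≤; +-monoʳ-≤; +-mono-≤; m⊓n≤m; m⊓n≤n; m∸n+n≡m)
open import Data.Nat.Tactic.RingSolver using (solve)
open import Data.Product.Base using (∃-syntax; _×_; _,_; proj₁; proj₂)
open import Data.Sum.Base using (_⊎_; inj₁; inj₂; swap)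
open import Relation.Binary.PropositionalEquality using (_≡_; _≢_; refl; sym; trans; cong; subst)
open import Relation.Nullary.Decidable
  using (Dec; does; yes; no; dec-true; dec-false; toWitness; True; ¬?; _⊎-dec_)
open import Relation.Nullary.Negation using (¬_)

-- The degree 9 to be excluded equals `N 6`, so this is an equality case. One sign occurs at least
-- five times; satisfying a literal that occurs exactly five times turns deficiency 6 into 6 + 1 - 5
-- = 2 and leaves degrees at least 9 - 5 = 4, the most that deficiency 2 permits. Every count on a
-- 5-side and on its `Q(v)` is therefore tight, and this is the source of all rigidity. Leanness
-- alone cannot finish the proof: the eight sign patterns on three variables, one of them repeated,
-- form a critical family of deficiency 6 with all degrees 9. Repeated rows on `V` are legitimate
-- because the clauses may differ outside `V`, so the last step has to leave `V` and use minimality.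
-- What remains outside a critical part has deficiency at most 0 and is satisfiable. Contracting the
-- critical part to one clause restores unsatisfiability at deficiency exactly 1, where the
-- structure is known; this device serves both for disjoint `Q(u)`, `Q(v)` and for the two agreeing
-- clauses.

-- Linear arithmetic: hypotheses are added up with _⊕_ to L ≤ R; s is the slack left in the conclusion.

lin : ∀ {L R} s {a b} → L ≤ R → (a + R) + s ≡ b + L → a ≤ b
lin {L} {R} s {a} {b} h e =
  +-cancelʳ-≤ R a b (≤-trans (m≤m+n (a + R) s) (≤-trans (≤-reflexive e) (+-monoʳ-≤ b h)))

infixr 5 _⊕_
_⊕_ : ∀ {a b c d} → a ≤ b → c ≤ d → a + c ≤ b + d
_⊕_ = +-mono-≤

eq≤ : ∀ {a b : ℕ} → a ≡ b → a ≤ b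
eq≤ = ≤-reflexive

eq≥ : ∀ {a b : ℕ} → a ≡ b → b ≤ a
eq≥ e = ≤-reflexive (sym e)

-- Subsets of Fin n

Sub : ℕ → Set
Sub n = Fin n → Bool

infix 4 _∈_ _∉_ _⊆_
infixl 6 _∩_ _∪_ _─_

-- A record instead of an equation, so that element and set can be read off from the type of a
-- proof.
record _∈_ {n} (i : Fin n) (A : Sub n) : Set where
  constructor mem
  field holds : A i ≡ true

record _∉_ {n} (i : Fin n) (A : Sub n) : Set where
  constructor non
  field fails : A i ≡ false

open _∈_ public
open _∉_ public

∈∉ : ∀ {n} {i : Fin n} {A : Sub n} → i ∈ A → i ∉ A → ⊥
∈∉ (mem p) (non q) with trans (sym p) q
... | ()

∈? : ∀ {n} (A : Sub n) i → i ∈ A ⊎ i ∉ A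
∈? A i with A i in e
... | true  = inj₁ (mem e)
... | false = inj₂ (non e)

¬∈ : ∀ {n} {i : Fin n} {A : Sub n} → (i ∈ A → ⊥) → i ∉ A
¬∈ {i = i} {A} h with ∈? A i
... | inj₁ p = ⊥-elim (h p)
... | inj₂ q = q

¬∉ : ∀ {n} {i : Fin n} {A : Sub n} → (i ∉ A → ⊥) → i ∈ A
¬∉ {i = i} {A} h with ∈? A i
... | inj₁ p = p
... | inj₂ q = ⊥-elim (h q)

_⊆_ : ∀ {n} → Sub n → Sub n → Set
A ⊆ B = ∀ {i} → i ∈ A → i ∈ B

∅ : ∀ {n} → Sub n
∅ i = false

opaque
  _∩_ _∪_ _─_ : ∀ {n} → Sub n → Sub n → Sub n
  (A ∩ B) i = A i ∧ B i
  (A ∪ B) i = A i ∨ B i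
  (A ─ B) i = A i ∧ not (B i)

  ⁅_⁆ : ∀ {n} → Fin n → Sub n
  ⁅ i ⁆ j = does (i ≟ j)

module _ {n} {A B : Sub n} {i : Fin n} where

  opaque
    unfolding _∩_ _∪_ _─_

    ∩⁺ : i ∈ A → i ∈ B → i ∈ A ∩ B
    ∩⁺ (mem p) (mem q) = mem (and p q)
      where
      and : ∀ {a b} → a ≡ true → b ≡ true → a ∧ b ≡ true
      and refl refl = refl

    ∩⁻ : i ∈ A ∩ B → i ∈ A × i ∈ B
    ∩⁻ (mem p) with A i in a | B i in b
    ∩⁻ (mem p) | true | true = mem a , mem b

    ─⁺ : i ∈ A → i ∉ B → i ∈ A ─ B
    ─⁺ (mem p) (non q) = mem (and p q)
      where
      and : ∀ {a b} → a ≡ true → b ≡ false → a ∧ not b ≡ true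
      and refl refl = refl

    ─⁻ : i ∈ A ─ B → i ∈ A × i ∉ B
    ─⁻ (mem p) with A i in a | B i in b
    ─⁻ (mem p) | true | false = mem a , non b

    ∪⁺ˡ : i ∈ A → i ∈ A ∪ B
    ∪⁺ˡ (mem p) = mem (or p)
      where
      or : ∀ {a b} → a ≡ true → a ∨ b ≡ true
      or refl = refl

    ∪⁺ʳ : i ∈ B → i ∈ A ∪ B
    ∪⁺ʳ (mem p) = mem (or (A i) p)
      where
      or : ∀ a {b} → b ≡ true → a ∨ b ≡ true
      or true  _ = refl
      or false p = p

    ∪⁻ : i ∈ A ∪ B → i ∈ A ⊎ i ∈ B
    ∪⁻ (mem p) with A i in a
    ... | true  = inj₁ (mem a)
    ... | false = inj₂ (mem p)

opaque
  unfolding ⁅_⁆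

  self∈ : ∀ {n} (i : Fin n) → i ∈ ⁅ i ⁆
  self∈ i = mem (dec-true (i ≟ i) refl)

  ∈⁅⁆⁻ : ∀ {n} {i j : Fin n} → j ∈ ⁅ i ⁆ → i ≡ j
  ∈⁅⁆⁻ {i = i} {j} (mem h) with i ≟ j
  ... | yes e = e
  ∈⁅⁆⁻ (mem ()) | no _

  ∉⁅⁆⁺ : ∀ {n} {i j : Fin n} → i ≢ j → j ∉ ⁅ i ⁆
  ∉⁅⁆⁺ {i = i} {j} h = non (dec-false (i ≟ j) h)

  ∉⁅⁆⁻ : ∀ {n} {i j : Fin n} → j ∉ ⁅ i ⁆ → i ≢ j
  ∉⁅⁆⁻ {i = i} h refl = ∈∉ (self∈ i) h

any : ∀ {n} → Sub n → Bool
any {zero}  A = false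
any {suc n} A = A zero ∨ any (λ i → A (suc i))

any⁺ : ∀ {n} (A : Sub n) i → A i ≡ true → any A ≡ true
any⁺ A zero    h rewrite h = refl
any⁺ A (suc i) h with A zero
... | true  = refl
... | false = any⁺ (λ i → A (suc i)) i h

any⁻ : ∀ {n} (A : Sub n) → any A ≡ true → ∃[ i ] A i ≡ true
any⁻ {suc n} A h with A zero in e
... | true  = zero , e
... | false with any⁻ (λ i → A (suc i)) h
...   | i , p = suc i , p

-- Cardinalities of finite sets

nat : Bool → ℕ
nat true  = 1
nat false = 0

opaque
  # : ∀ {n} → Sub n → ℕ
  # {zero}  A = 0
  # {suc n} A = nat (A zero) + # (λ i → A (suc i))

opaque
  unfolding #

  #-2-2 : ∀ {n} (A B C D : Sub n) →
    (∀ i → nat (A i) + nat (B i) ≤ nat (C i) + nat (D i)) → # A + # B ≤ # C + # D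
  #-2-2 {zero}  A B C D h = z≤n
  #-2-2 {suc n} A B C D h =
    arith (nat (A zero)) _ (nat (B zero)) _ (nat (C zero)) _ (nat (D zero)) _
      (h zero) (#-2-2 (λ i → A (suc i)) (λ i → B (suc i)) (λ i → C (suc i)) (λ i → D (suc i)) (λ i → h (suc i)))
    where
    arith : ∀ a a′ b b′ c c′ d d′ → a + b ≤ c + d → a′ + b′ ≤ c′ + d′ →
            (a + a′) + (b + b′) ≤ (c + c′) + (d + d′)
    arith a a′ b b′ c c′ d d′ p q =
      lin 0 (p ⊕ q) (solve (a ∷ a′ ∷ b ∷ b′ ∷ c ∷ c′ ∷ d ∷ d′ ∷ []))

  #∅ : ∀ n → # (∅ {n}) ≡ 0
  #∅ zero    = refl
  #∅ (suc n) = #∅ n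

#-submod : ∀ {n} (A B C D : Sub n) → (∀ {i} → i ∈ A → i ∈ C ⊎ i ∈ D) → (∀ {i} → i ∈ B → i ∈ C ⊎ i ∈ D) →
  (∀ {i} → i ∈ A → i ∈ B → i ∈ C × i ∈ D) → # A + # B ≤ # C + # D
#-submod A B C D f g h = #-2-2 A B C D pt
  where
  one : ∀ {i} → i ∈ C ⊎ i ∈ D → 1 ≤ nat (C i) + nat (D i)
  one (inj₁ (mem p)) rewrite p = s≤s z≤n
  one {i} (inj₂ (mem p)) rewrite p = m≤n+m 1 (nat (C i))
  pt : ∀ i → nat (A i) + nat (B i) ≤ nat (C i) + nat (D i)
  pt i with A i in a | B i in b
  ... | false | false = z≤n
  ... | true  | false = one (f (mem a))
  ... | false | true  = one (g (mem b))
  ... | true  | true  with h (mem a) (mem b)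
  ...   | mem p , mem q rewrite p | q = ≤-refl

#-mono : ∀ {n} {A B : Sub n} → A ⊆ B → # A ≤ # B
#-mono {n} {A} {B} h = +-cancelʳ-≤ _ _ _ (#-submod A ∅ B ∅ (λ p → inj₁ (h p)) (λ ()) (λ { _ (mem ()) }))

#-cover : ∀ {n} {A C D : Sub n} → (∀ {i} → i ∈ A → i ∈ C ⊎ i ∈ D) → # A ≤ # C + # D
#-cover {n} {A} {C} {D} h =
  ≤-trans (m≤m+n _ _) (#-submod A ∅ C D h (λ { (mem ()) }) (λ { _ (mem ()) }))

#-disj : ∀ {n} {A B C : Sub n} → A ⊆ C → B ⊆ C → (∀ {i} → i ∈ A → i ∈ B → ⊥) → # A + # B ≤ # C
#-disj {n} {A} {B} {C} f g h = arith (# A) (# B) (# C) (# (∅ {n})) (#∅ n)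
  (#-submod A B C ∅ (λ p → inj₁ (f p)) (λ p → inj₁ (g p)) (λ p q → ⊥-elim (h p q)))
  where
  arith : ∀ a b c e → e ≡ 0 → a + b ≤ c + e → a + b ≤ c
  arith a b c e refl p = lin 0 p (solve (a ∷ b ∷ c ∷ []))

#-split : ∀ {n} (A B : Sub n) → # (A ∩ B) + # (A ─ B) ≡ # A
#-split A B = ≤-antisym
  (#-disj (λ p → proj₁ (∩⁻ {A = A} p)) (λ p → proj₁ (─⁻ {A = A} p))
     (λ p q → ∈∉ (proj₂ (∩⁻ {A = A} p)) (proj₂ (─⁻ {A = A} q))))
  (#-cover cover)
  where
  cover : ∀ {i} → i ∈ A → i ∈ A ∩ B ⊎ i ∈ A ─ B
  cover {i} p with ∈? B i
  ... | inj₁ q = inj₁ (∩⁺ p q)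
  ... | inj₂ q = inj₂ (─⁺ p q)

opaque
  unfolding #

  pick : ∀ {n} (A : Sub n) → 1 ≤ # A → ∃[ i ] i ∈ A
  pick {suc n} A h with A zero in e
  ... | true  = zero , mem e
  ... | false with pick (λ i → A (suc i)) h
  ...   | i , mem p = suc i , mem p

  #⁺ : ∀ {n} {A : Sub n} {i} → i ∈ A → 1 ≤ # A
  #⁺ {A = A} {zero}  (mem h) rewrite h = s≤s z≤n
  #⁺ {A = A} {suc i} (mem h) = ≤-trans (#⁺ {A = λ i → A (suc i)} {i} (mem h)) (m≤n+m _ (nat (A zero)))

opaque
  unfolding # ⁅_⁆

  #⁅⁆ : ∀ {n} (i : Fin n) → # ⁅ i ⁆ ≡ 1
  #⁅⁆ i = ≤-antisym (≤1 i) (#⁺ (self∈ i))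
    where
    shift : ∀ {n} (i : Fin n) {j} → j ∈ (λ j → ⁅ suc i ⁆ (suc j)) → j ∈ ⁅ i ⁆
    shift i {j} (mem h) with i ≟ j in e
    ... | yes _ = mem (cong does e)
    shift i {j} (mem ()) | no _
    ≤1 : ∀ {n} (i : Fin n) → # ⁅ i ⁆ ≤ 1
    ≤1 {suc n} zero    = s≤s (≤-trans (#-mono {n} {λ j → ⁅ zero {n} ⁆ (suc j)} {∅} λ { (mem ()) }) (≤-reflexive (#∅ n)))
    ≤1 {suc n} (suc i) = ≤-trans (#-mono (shift i)) (≤1 i)

#-remove : ∀ {n} (A : Sub n) {i} → i ∈ A → # A ≡ suc (# (A ─ ⁅ i ⁆))
#-remove A {i} p = trans (sym (#-split A ⁅ i ⁆)) (cong (_+ # (A ─ ⁅ i ⁆)) (≤-antisym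
  (≤-trans (#-mono (λ q → proj₂ (∩⁻ {A = A} q))) (≤-reflexive (#⁅⁆ i)))
  (#⁺ (∩⁺ p (self∈ i)))))

#≥2 : ∀ {n} {A : Sub n} {i j} → i ∈ A → j ∈ A → i ≢ j → 2 ≤ # A
#≥2 {A = A} {i} {j} p q i≢j = subst (2 ≤_) (sym (#-remove A p)) (s≤s (#⁺ (─⁺ q (∉⁅⁆⁺ i≢j))))

#≥3 : ∀ {n} {A : Sub n} {i j k} → i ∈ A → j ∈ A → k ∈ A → i ≢ j → i ≢ k → j ≢ k → 3 ≤ # A
#≥3 {A = A} {i} {j} {k} p q r i≢j i≢k j≢k =
  subst (3 ≤_) (sym (#-remove A p)) (s≤s (#≥2 (─⁺ q (∉⁅⁆⁺ i≢j)) (─⁺ r (∉⁅⁆⁺ i≢k)) j≢k))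

#≤1 : ∀ {n} {A : Sub n} {i j} → # A ≤ 1 → i ∈ A → j ∈ A → i ≡ j
#≤1 {i = i} {j} h p q with i ≟ j
... | yes e = e
... | no ne with ≤-trans (#≥2 p q ne) h
...   | s≤s ()

#≤0 : ∀ {n} {A : Sub n} {i} → # A ≤ 0 → i ∈ A → ⊥
#≤0 h p with ≤-trans (#⁺ p) h
... | ()

pick2 : ∀ {n} (A : Sub n) → 2 ≤ # A → ∃[ i ] ∃[ j ] i ∈ A × j ∈ A × i ≢ j
pick2 A h with pick A (≤-trans (s≤s z≤n) h)
... | i , p with pick (A ─ ⁅ i ⁆) (pred≤ (subst (2 ≤_) (#-remove A p) h))
  where
  pred≤ : ∀ {m} → 2 ≤ suc m → 1 ≤ m
  pred≤ (s≤s q) = q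
...   | j , q = i , j , p , proj₁ (─⁻ {A = A} q) , ∉⁅⁆⁻ (proj₂ (─⁻ {A = A} q))

#-full : ∀ {n} {A B : Sub n} → A ⊆ B → # B ≤ # A → B ⊆ A
#-full {A = A} {B} f h {i} p = ¬∉ λ q → #≤0 (arith (# A) (# B) (# (B ∩ A)) (# (B ─ A)) (#-split B A)
                 (#-mono (λ r → ∩⁺ (f r) r)) h) (─⁺ p q)
  where
  arith : ∀ a b x y → x + y ≡ b → a ≤ x → b ≤ a → y ≤ 0
  arith a b x y e p q = lin 0 (eq≤ e ⊕ p ⊕ q) (solve (a ∷ b ∷ x ∷ y ∷ []))

-- Clause-sets as matrices, autarkies, and Hall's theorem

-- A clause-set is a matrix M of literals: M i j is the sign with which the j-th variable
-- occurs in the i-th clause.  I is always a set of rows (clauses), V and S are sets of columns.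
-- Only absurdity is ever derived from these notions, so that existence statements are given in
-- the form (∀ x → P x → ⊥) → ⊥ and no search over sets of variables is needed.

Matrix : ℕ → ℕ → Set
Matrix c n = Fin c → Fin n → Maybe Bool

Nonempty : ∀ {n} → Sub n → Set
Nonempty A = ∃[ i ] i ∈ A

is : Bool → Maybe Bool → Bool
is true  (just true)  = true
is false (just false) = true
is _     _            = false

is⁺ : ∀ b → is b (just b) ≡ true
is⁺ true  = refl
is⁺ false = refl

is⁻ : ∀ b m → is b m ≡ true → m ≡ just b
is⁻ true  (just true)  _ = refl
is⁻ false (just false) _ = refl
is⁻ true  (just false) ()
is⁻ true  nothing ()
is⁻ false nothing ()

just-injective : ∀ {a b : Bool} → just a ≡ just b → a ≡ b
just-injective refl = refl

glue : ∀ {n} → Sub n → (Fin n → Bool) → (Fin n → Bool) → Fin n → Bool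
glue A a b j = if A j then a j else b j

glue∈ : ∀ {n} {A : Sub n} {a b} {j} → j ∈ A → glue A a b j ≡ a j
glue∈ (mem p) rewrite p = refl

glue∉ : ∀ {n} {A : Sub n} {a b} {j} → j ∉ A → glue A a b j ≡ b j
glue∉ (non p) rewrite p = refl

module _ {c n} (M : Matrix c n) where

  opaque
    has : Fin n → Bool → Sub c
    has v b i = is b (M i v)

    occ : Fin n → Sub c
    occ v i = is-just (M i v)

    tch : Sub n → Sub c
    tch S i = any (λ j → S j ∧ is-just (M i j))

  record Sat (a : Fin n → Bool) (S : Sub n) (i : Fin c) : Set where
    constructor via
    field
      column : Fin n
      inside : column ∈ S
      agrees : M i column ≡ just (a column)

  -- Literals outside `V` are erased, so a row that misses `V` is an empty clause and makes this
  -- trivially true. Hence the accompanying hypotheses that all rows are touched.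
  Unsat : Sub c → Sub n → Set
  Unsat I V = ∀ a → (∀ {i} → i ∈ I → Sat a V i) → ⊥

  -- There is no nontrivial autarky.

  Lean : Sub c → Sub n → Set
  Lean I V = ∀ {S} a → S ⊆ V → Nonempty S → (∀ {i} → i ∈ I → i ∈ tch S → Sat a S i) → ⊥

module _ {c n} {M : Matrix c n} where

  opaque
    unfolding has occ

    has⁺ : ∀ {i v b} → M i v ≡ just b → i ∈ has M v b
    has⁺ {b = b} e = mem (trans (cong (is b) e) (is⁺ b))

    has⁻ : ∀ {i v b} → i ∈ has M v b → M i v ≡ just b
    has⁻ {b = b} (mem h) = is⁻ b _ h

    occ⁺ : ∀ {i v b} → M i v ≡ just b → i ∈ occ M v
    occ⁺ e = mem (cong is-just e)

    occ⁻ : ∀ {i v} → i ∈ occ M v → ∃[ b ] M i v ≡ just b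
    occ⁻ {i} {v} (mem h) with M i v
    ... | just b = b , refl

  has⇒occ : ∀ {i v b} → i ∈ has M v b → i ∈ occ M v
  has⇒occ h = occ⁺ (has⁻ h)

  occ⇒has : ∀ {i v b} → i ∈ occ M v → i ∉ has M v b → i ∈ has M v (not b)
  occ⇒has {b = b} o h with occ⁻ o
  occ⇒has {b = true}  o h | true  , e = ⊥-elim (∈∉ (has⁺ e) h)
  occ⇒has {b = true}  o h | false , e = has⁺ e
  occ⇒has {b = false} o h | true  , e = has⁺ e
  occ⇒has {b = false} o h | false , e = ⊥-elim (∈∉ (has⁺ e) h)

  has-clash : ∀ {i v b} → i ∈ has M v b → i ∈ has M v (not b) → ⊥
  has-clash {b = true}  p q with trans (sym (has⁻ p)) (has⁻ q)
  ... | ()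
  has-clash {b = false} p q with trans (sym (has⁻ p)) (has⁻ q)
  ... | ()

  opaque
    unfolding tch occ

    tch⁺ : ∀ {S i j} → j ∈ S → i ∈ occ M j → i ∈ tch M S
    tch⁺ {S} {i} {j} (mem p) (mem q) = mem (any⁺ _ j (and p q))
      where
      and : ∀ {a b} → a ≡ true → b ≡ true → a ∧ b ≡ true
      and refl refl = refl

    tch⁻ : ∀ {S i} → i ∈ tch M S → ∃[ j ] j ∈ S × i ∈ occ M j
    tch⁻ {S} {i} (mem h) with any⁻ (λ j → S j ∧ is-just (M i j)) h
    ... | j , p = j , mem (proj₁ (and p)) , mem (proj₂ (and p))
      where
      and : ∀ {a b} → a ∧ b ≡ true → a ≡ true × b ≡ true
      and {true} {true} _ = refl , refl

  ∉tch⁻ : ∀ {S i j} → i ∉ tch M S → j ∈ S → i ∉ occ M j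
  ∉tch⁻ h p = ¬∈ λ q → ∈∉ (tch⁺ p q) h

  tch-mono : ∀ {S S′} → S ⊆ S′ → tch M S ⊆ tch M S′
  tch-mono f p with tch⁻ p
  ... | j , q , r = tch⁺ (f q) r

  ∉tch-mono : ∀ {S S′ i} → S ⊆ S′ → i ∉ tch M S′ → i ∉ tch M S
  ∉tch-mono f p = ¬∈ λ q → ∈∉ (tch-mono f q) p

  Sat⇒tch : ∀ {a S i} → Sat M a S i → i ∈ tch M S
  Sat⇒tch (via j p e) = tch⁺ p (occ⁺ e)

  Sat-mono : ∀ {a S S′ i} → S ⊆ S′ → Sat M a S i → Sat M a S′ i
  Sat-mono f (via j p e) = via j (f p) e

  Sat-cong : ∀ {a a′ S i} → (∀ {j} → j ∈ S → a′ j ≡ a j) → Sat M a S i → Sat M a′ S i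
  Sat-cong f (via j p e) = via j p (trans e (cong just (sym (f p))))

  Sat-glueˡ : ∀ {A a b i} → Sat M a A i → Sat M (glue A a b) A i
  Sat-glueˡ {a = a} {b} = Sat-cong (glue∈ {a = a} {b})

  Sat-glueʳ : ∀ {A B a b i} → (∀ {j} → j ∈ B → j ∉ A) → Sat M b B i → Sat M (glue A a b) B i
  Sat-glueʳ {a = a} {b} f = Sat-cong (λ p → glue∉ {a = a} {b} (f p))

  untouched : ∀ {V A i} → i ∈ tch M V → i ∉ tch M (V ─ A) → i ∈ tch M (V ∩ A)
  untouched {V} {A} p q with tch⁻ p
  ... | j , r , s with ∈? A j
  ...   | inj₁ u = tch⁺ (∩⁺ r u) s
  ...   | inj₂ u = ⊥-elim (∈∉ (tch⁺ (─⁺ r u) s) q)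

  -- Hall's marriage theorem, clauses being matched to variables that satisfy them.

  hall : ∀ m {I V} → # V ≤ m → (∀ {i} → i ∈ I → i ∈ tch M V) →
    (∀ {V₁} → V₁ ⊆ V → Nonempty V₁ → # (I ─ tch M (V ─ V₁)) ≤ # V₁) → Unsat M I V → ⊥
  hall zero {I} {V} h t k u = u (λ _ → true) λ p → ⊥-elim (#≤0 h (proj₁ (proj₂ (tch⁻ (t p)))))
  hall (suc m) {I} {V} h t k u with # I in eq
  ... | zero  = u (λ _ → true) λ p → ⊥-elim (#≤0 (eq≤ eq) p)
  ... | suc _ with pick I (subst (1 ≤_) (sym eq) (s≤s z≤n))
  ...   | i₀ , i₀∈I with tch⁻ (t i₀∈I)
  ...     | v , v∈V , o with occ⁻ o
  ...       | b , e = hall m {I′} {V′} (size (# V) (# V′) h (#-remove V v∈V)) touched counts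
                        λ a s → u (glue ⁅ v ⁆ (λ _ → b) a) (sat a s)
    where
    I′ = I ─ has M v b
    V′ = V ─ ⁅ v ⁆
    size : ∀ x y → x ≤ suc m → x ≡ suc y → y ≤ m
    size x y (s≤s p) refl = p
    smaller : ∀ {A j} → A ⊆ V → j ∈ V → j ∉ A → # A ≤ m
    smaller {A} {j} A⊆V p q = arith (# A) (# V) (# ⁅ j ⁆) (#⁅⁆ j)
      (#-disj A⊆V (λ r → subst (_∈ V) (∈⁅⁆⁻ r) p) (λ r s → ∈∉ (subst (_∈ A) (sym (∈⁅⁆⁻ s)) r) q)) h
      where
      arith : ∀ a x y → y ≡ 1 → a + y ≤ x → x ≤ suc m → a ≤ m
      arith a x y refl p q = lin 0 (p ⊕ q) (solve (a ∷ x ∷ m ∷ []))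
    -- If a proper `V₁` were tight, the rows living inside `V₁` and the rows meeting `V ─ V₁` could
    -- be satisfied separately by recursion. The unit of slack obtained otherwise pays in `counts`
    -- for the variable `v` that is used up.
    slack : ∀ {V₁ j} → V₁ ⊆ V → Nonempty V₁ → j ∈ V → j ∉ V₁ → # (I ─ tch M (V ─ V₁)) < # V₁
    slack {V₁} {j} V₁⊆V (j₁ , j₁∈V₁) p q with suc (# (I ─ tch M (V ─ V₁))) ≤? # V₁
    ... | yes r = r
    ... | no ¬r = ⊥-elim (hall m {I₁} {V₁} (smaller V₁⊆V p q)
                     (λ r → tch-mono (λ s → proj₂ (∩⁻ {A = V} s)) (untouched (t (proj₁ (─⁻ {A = I} r))) (proj₂ (─⁻ {A = I} r))))
                     counts₁ λ a₁ s₁ →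
                   hall m {I₃} {V₃} (smaller {V₃} {j₁} (λ r → proj₁ (─⁻ {A = V} r)) (V₁⊆V j₁∈V₁) (¬∈ λ r → ∈∉ j₁∈V₁ (proj₂ (─⁻ {A = V} r))))
                     (λ r → proj₂ (∩⁻ {A = I} r))
                     counts₃ λ a₃ s₃ → u (glue V₁ a₁ a₃) (sat₂ s₁ s₃))
      where
      I₁ = I ─ tch M (V ─ V₁)
      V₃ = V ─ V₁
      I₃ = I ∩ tch M V₃
      counts₁ : ∀ {V₂} → V₂ ⊆ V₁ → Nonempty V₂ → # (I₁ ─ tch M (V₁ ─ V₂)) ≤ # V₂
      counts₁ {V₂} f ne = ≤-trans (#-mono incl) (k (λ r → V₁⊆V (f r)) ne)
        where
        incl : I₁ ─ tch M (V₁ ─ V₂) ⊆ I ─ tch M (V ─ V₂)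
        incl {i} r with ─⁻ {A = I₁} r
        ... | s , w with ─⁻ {A = I} s
        ...   | s′ , w′ = ─⁺ s′ (¬∈ λ x → absurd (tch⁻ x))
          where
          absurd : ∃[ j ] j ∈ V ─ V₂ × i ∈ occ M j → ⊥
          absurd (j , y , z) with ─⁻ {A = V} y | ∈? V₁ j
          ... | y₁ , y₂ | inj₁ q₁ = ∈∉ (tch⁺ (─⁺ q₁ y₂) z) w
          ... | y₁ , y₂ | inj₂ q₁ = ∈∉ (tch⁺ (─⁺ y₁ q₁) z) w′
      counts₃ : ∀ {V₂} → V₂ ⊆ V₃ → Nonempty V₂ → # (I₃ ─ tch M (V₃ ─ V₂)) ≤ # V₂
      counts₃ {V₂} f (j₂ , j₂∈) = arith (# (I₃ ─ tch M (V₃ ─ V₂))) (# I₁) (# (I ─ tch M (V ─ (V₁ ∪ V₂)))) (# (V₁ ∪ V₂)) (# V₁) (# V₂)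
          (#-disj incl₃ incl₁ (λ r s → ∈∉ (proj₂ (∩⁻ {A = I} (proj₁ (─⁻ {A = I₃} r)))) (proj₂ (─⁻ {A = I} s))))
          (k union (j₂ , ∪⁺ʳ j₂∈)) (#-cover (∪⁻ {A = V₁})) (≰⇒> ¬r)
        where
        arith : ∀ x y z w v₁ v₂ → x + y ≤ z → z ≤ w → w ≤ v₁ + v₂ → suc v₁ ≤ suc y → x ≤ v₂
        arith x y z w v₁ v₂ p q r s = lin 0 (p ⊕ q ⊕ r ⊕ s) (solve (x ∷ y ∷ z ∷ w ∷ v₁ ∷ v₂ ∷ []))
        union : V₁ ∪ V₂ ⊆ V
        union r with ∪⁻ {A = V₁} r
        ... | inj₁ s = V₁⊆V s
        ... | inj₂ s = proj₁ (─⁻ {A = V} (f s))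
        incl₁ : I₁ ⊆ I ─ tch M (V ─ (V₁ ∪ V₂))
        incl₁ r with ─⁻ {A = I} r
        ... | s , w = ─⁺ s (∉tch-mono (λ x → let y , z = ─⁻ {A = V} x in ─⁺ y (¬∈ λ q₁ → ∈∉ (∪⁺ˡ q₁) z)) w)
        incl₃ : I₃ ─ tch M (V₃ ─ V₂) ⊆ I ─ tch M (V ─ (V₁ ∪ V₂))
        incl₃ r with ─⁻ {A = I₃} r
        ... | s , w with ∩⁻ {A = I} s
        ...   | s′ , _ = ─⁺ s′ (∉tch-mono (λ x → let y , z = ─⁻ {A = V} x in
                           ─⁺ (─⁺ y (¬∈ λ q₁ → ∈∉ (∪⁺ˡ q₁) z)) (¬∈ λ q₁ → ∈∉ (∪⁺ʳ {A = V₁} q₁) z)) w)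
      sat₂ : ∀ {a₁ a₃} → (∀ {i} → i ∈ I₁ → Sat M a₁ V₁ i) → (∀ {i} → i ∈ I₃ → Sat M a₃ V₃ i) →
             ∀ {i} → i ∈ I → Sat M (glue V₁ a₁ a₃) V i
      sat₂ s₁ s₃ {i} r with ∈? (tch M V₃) i
      ... | inj₁ w = Sat-mono (λ x → proj₁ (─⁻ {A = V} x)) (Sat-glueʳ (λ x → proj₂ (─⁻ {A = V} x)) (s₃ (∩⁺ r w)))
      ... | inj₂ w = Sat-mono V₁⊆V (Sat-glueˡ (s₁ (─⁺ r w)))
    #I≤#V : # I ≤ # V
    #I≤#V = ≤-trans (#-mono {A = I} {I ─ tch M (V ─ V)} λ r → ─⁺ r (¬∈ λ s → let _ , x , _ = tch⁻ s ; y , z = ─⁻ {A = V} x in ∈∉ y z)) (k (λ r → r) (v , v∈V))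
    #I′<#I : # I′ < # I
    #I′<#I = ≤-trans (s≤s (#-mono {B = I ─ ⁅ i₀ ⁆} λ r → let x , y = ─⁻ {A = I} r in ─⁺ x (∉⁅⁆⁺ {i = i₀} λ { refl → ∈∉ (has⁺ e) y })))
               (eq≥ (#-remove I i₀∈I))
    counts : ∀ {V₁} → V₁ ⊆ V′ → Nonempty V₁ → # (I′ ─ tch M (V′ ─ V₁)) ≤ # V₁
    counts {V₁} f (j₁ , j₁∈) with # (V ─ (V₁ ∪ ⁅ v ⁆)) in w
    ... | zero = arith (# (I′ ─ tch M (V′ ─ V₁))) (# I′) (# I) (# V) (# V₁) (# (V ─ (V₁ ∪ ⁅ v ⁆))) (# (V₁ ∪ ⁅ v ⁆)) (# ⁅ v ⁆)
                   (#-mono (λ x → proj₁ (─⁻ {A = I′} x))) #I′<#I #I≤#V (#-cover {C = V₁ ∪ ⁅ v ⁆} {V ─ (V₁ ∪ ⁅ v ⁆)} cover)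
                   w (#-cover (∪⁻ {A = V₁})) (#⁅⁆ v)
      where
      cover : ∀ {i} → i ∈ V → i ∈ V₁ ∪ ⁅ v ⁆ ⊎ i ∈ V ─ (V₁ ∪ ⁅ v ⁆)
      cover {i} x with ∈? (V₁ ∪ ⁅ v ⁆) i
      ... | inj₁ y = inj₁ y
      ... | inj₂ y = inj₂ (─⁺ x y)
      arith : ∀ x i′ i v v₁ d s y → x ≤ i′ → suc i′ ≤ i → i ≤ v → v ≤ s + d → d ≡ 0 → s ≤ v₁ + y → y ≡ 1 → x ≤ v₁
      arith x i′ i v v₁ _ s _ p q r o refl t refl = lin 0 (p ⊕ q ⊕ r ⊕ o ⊕ t) (solve (x ∷ i′ ∷ i ∷ v ∷ v₁ ∷ s ∷ []))
    ... | suc _ with pick (V ─ (V₁ ∪ ⁅ v ⁆)) (subst (1 ≤_) (sym w) (s≤s z≤n))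
    ...   | j , j∈ = arith (# (I′ ─ tch M (V′ ─ V₁))) (# (I ─ tch M (V ─ (V₁ ∪ ⁅ v ⁆)))) (# (V₁ ∪ ⁅ v ⁆)) (# V₁) (# ⁅ v ⁆)
              (#-mono incl) (slack union (j₁ , ∪⁺ˡ j₁∈) (proj₁ (─⁻ {A = V} j∈)) (proj₂ (─⁻ {A = V} j∈))) (#-cover (∪⁻ {A = V₁})) (#⁅⁆ v)
      where
      arith : ∀ x y z v₁ o → x ≤ y → suc y ≤ z → z ≤ v₁ + o → o ≡ 1 → x ≤ v₁
      arith x y z v₁ _ p q r refl = lin 0 (p ⊕ q ⊕ r) (solve (x ∷ y ∷ z ∷ v₁ ∷ []))
      union : V₁ ∪ ⁅ v ⁆ ⊆ V
      union r with ∪⁻ {A = V₁} r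
      ... | inj₁ s = proj₁ (─⁻ {A = V} (f s))
      ... | inj₂ s = subst (_∈ V) (∈⁅⁆⁻ s) v∈V
      incl : I′ ─ tch M (V′ ─ V₁) ⊆ I ─ tch M (V ─ (V₁ ∪ ⁅ v ⁆))
      incl r with ─⁻ {A = I′} r
      ... | s , x = ─⁺ (proj₁ (─⁻ {A = I} s)) (∉tch-mono (λ y → let p , q = ─⁻ {A = V} y in
                      ─⁺ (─⁺ p (¬∈ λ o → ∈∉ (∪⁺ʳ {A = V₁} o) q)) (¬∈ λ o → ∈∉ (∪⁺ˡ o) q)) x)
    touched : ∀ {i} → i ∈ I′ → i ∈ tch M V′
    touched {i} r with ─⁻ {A = I} r
    ... | s , x = ¬∉ λ y → absurd y
      where
      absurd : i ∉ tch M V′ → ⊥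
      absurd y with # V′ in w
      ... | zero  = #≤0 (arith (# I) (# I′) (# V) (# V′) #I′<#I #I≤#V (#-remove V v∈V) w) r
        where
        arith : ∀ x x′ z z′ → suc x′ ≤ x → x ≤ z → z ≡ suc z′ → z′ ≡ 0 → x′ ≤ 0
        arith x x′ z z′ p q refl refl = lin 0 (p ⊕ q) (solve (x ∷ x′ ∷ []))
      ... | suc _ with pick V′ (subst (1 ≤_) (sym w) (s≤s z≤n))
      ...   | j , j∈ = #≤0 (arith _ _ (slack {⁅ v ⁆} {j} (λ q → subst (_∈ V) (∈⁅⁆⁻ q) v∈V) (v , self∈ v) (proj₁ (─⁻ {A = V} j∈)) (proj₂ (─⁻ {A = V} j∈))) (#⁅⁆ v)) (─⁺ s y)
        where
        arith : ∀ x y → suc x ≤ y → y ≡ 1 → x ≤ 0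
        arith x y (s≤s p) refl = p
    sat : ∀ a → (∀ {i} → i ∈ I′ → Sat M a V′ i) → ∀ {i} → i ∈ I → Sat M (glue ⁅ v ⁆ (λ _ → b) a) V i
    sat a s {i} r with ∈? (has M v b) i
    ... | inj₁ x = via v v∈V (trans (has⁻ x) (cong just (sym (glue∈ {A = ⁅ v ⁆} {λ _ → b} {a} (self∈ v)))))
    ... | inj₂ x = Sat-mono (λ y → proj₁ (─⁻ {A = V} y)) (Sat-glueʳ (λ y → proj₂ (─⁻ {A = V} y)) (s (─⁺ r x)))

nonempty? : ∀ {n} (A : Sub n) → # A ≤ 0 ⊎ Nonempty A
nonempty? A with # A in e
... | zero  = inj₁ z≤n
... | suc _ = inj₂ (pick A (subst (1 ≤_) (sym e) (s≤s z≤n)))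

⁅⁆⊆ : ∀ {n} {A : Sub n} {v} → v ∈ A → ⁅ v ⁆ ⊆ A
⁅⁆⊆ {A = A} p q = subst (_∈ A) (∈⁅⁆⁻ q) p

module _ {c n} {M : Matrix c n} where

  Lean-mono : ∀ {I I′ V V′} → V′ ⊆ V → (∀ {i} → i ∈ I → i ∈ tch M V′ → i ∈ I′) → Lean M I V → Lean M I′ V′
  Lean-mono f g l {S} a S⊆ ne s = l a (λ p → f (S⊆ p)) ne λ p q → s (g p (tch-mono S⊆ q)) q

  tch-─ : ∀ {V A i} → i ∈ tch M V → i ∉ tch M A → i ∈ tch M (V ─ A)
  tch-─ p q with tch⁻ p
  ... | j , r , s = tch⁺ (─⁺ r (¬∈ λ u → ∈∉ (tch⁺ u s) q)) s

  tch⁅⁆⁻ : ∀ {v i} → i ∈ tch M ⁅ v ⁆ → i ∈ occ M v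
  tch⁅⁆⁻ {v} {i} p with tch⁻ p
  ... | j , q , r = subst (λ j → i ∈ occ M j) (sym (∈⁅⁆⁻ q)) r

  lean⇒unsat : ∀ {I V} → Lean M I V → Nonempty V → Unsat M I V
  lean⇒unsat l ne a s = l a (λ p → p) ne (λ p _ → s p)

  lean-literal : ∀ {I V v} b → Lean M I V → v ∈ V → 1 ≤ # (I ∩ has M v b)
  lean-literal {I} {V} {v} b l p with nonempty? (I ∩ has M v b)
  ... | inj₂ (i , q) = #⁺ q
  ... | inj₁ z = ⊥-elim (l (λ _ → not b) (⁅⁆⊆ p) (v , self∈ v)
                   λ {i} q r → via v (self∈ v) (has⁻ (occ⇒has (tch⁅⁆⁻ r) (¬∈ λ s → #≤0 z (∩⁺ q s)))))

  #-literals : ∀ I v b → # (I ∩ has M v b) + # (I ∩ has M v (not b)) ≡ # (I ∩ occ M v)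
  #-literals I v b = ≤-antisym
    (#-disj (λ p → let q , r = ∩⁻ {A = I} p in ∩⁺ q (has⇒occ r)) (λ p → let q , r = ∩⁻ {A = I} p in ∩⁺ q (has⇒occ r))
       λ p q → has-clash (proj₂ (∩⁻ {A = I} p)) (proj₂ (∩⁻ {A = I} q)))
    (#-cover cover)
    where
    cover : ∀ {i} → i ∈ I ∩ occ M v → i ∈ I ∩ has M v b ⊎ i ∈ I ∩ has M v (not b)
    cover {i} p with ∩⁻ {A = I} p | ∈? (has M v b) i
    ... | q , r | inj₁ s = inj₁ (∩⁺ q s)
    ... | q , r | inj₂ s = inj₂ (∩⁺ q (occ⇒has r s))

  -- Were there at most |V| touching clauses, Hall's condition would hold: by induction `V ─ V₁`
  -- meets so many clauses that at most |V₁| are left to `V₁`. The resulting assignment is an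
  -- autarky on `V`.
  tarsi : ∀ m {I V} → # V ≤ m → Lean M I V → Nonempty V → suc (# V) ≤ # (I ∩ tch M V)
  tarsi zero    h l (v , p) = ⊥-elim (#≤0 h p)
  tarsi (suc m) {I} {V} h l ne with suc (# V) ≤? # (I ∩ tch M V)
  ... | yes r = r
  ... | no ¬r = ⊥-elim (hall (# V) {I ∩ tch M V} {V} ≤-refl (λ p → proj₂ (∩⁻ {A = I} p)) counts
                  λ a s → l a (λ p → p) ne λ p q → s (∩⁺ p q))
    where
    counts : ∀ {V₁} → V₁ ⊆ V → Nonempty V₁ → # ((I ∩ tch M V) ─ tch M (V ─ V₁)) ≤ # V₁
    counts {V₁} f (v , p) with nonempty? (V ─ V₁)
    ... | inj₁ z = arith (# ((I ∩ tch M V) ─ tch M (V ─ V₁))) (# (I ∩ tch M V)) (# V) (# (V ∩ V₁)) (# V₁) (# (V ─ V₁))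
                     (#-mono (λ q → proj₁ (─⁻ {A = I ∩ tch M V} q))) (≰⇒> ¬r) (#-split V V₁) (#-mono (λ q → proj₂ (∩⁻ {A = V} q))) z
      where
      arith : ∀ x i v w v₁ d → x ≤ i → suc i ≤ suc v → w + d ≡ v → w ≤ v₁ → d ≤ 0 → x ≤ v₁
      arith x i v w v₁ d p q r s t = lin 0 (p ⊕ q ⊕ eq≥ r ⊕ s ⊕ t) (solve (x ∷ i ∷ v ∷ w ∷ v₁ ∷ d ∷ []))
    ... | inj₂ ne₂ = arith (# ((I ∩ tch M V) ─ tch M (V ─ V₁))) (# (I ∩ tch M V)) (# V) (# (V ∩ V₁)) (# V₁) (# (V ─ V₁)) (# (I ∩ tch M (V ─ V₁)))
                       (#-disj (λ q → proj₁ (─⁻ {A = I ∩ tch M V} q))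
                          (λ q → let r , s = ∩⁻ {A = I} q in ∩⁺ r (tch-mono (λ t → proj₁ (─⁻ {A = V} t)) s))
                          (λ q r → ∈∉ (proj₂ (∩⁻ {A = I} r)) (proj₂ (─⁻ {A = I ∩ tch M V} q))))
                       (≰⇒> ¬r) (#-split V V₁) (#-mono (λ q → proj₂ (∩⁻ {A = V} q)))
                       (tarsi m {I} {V ─ V₁} (smaller (# V) (# (V ─ V₁)) (# (V ∩ V₁)) (#-split V V₁) (#⁺ (∩⁺ (f p) p)) h)
                          (Lean-mono (λ q → proj₁ (─⁻ {A = V} q)) (λ q _ → q) l) ne₂)
      where
      smaller : ∀ x y z → z + y ≡ x → 1 ≤ z → x ≤ suc m → y ≤ m
      smaller x y z p q r = lin 0 (eq≤ p ⊕ q ⊕ r) (solve (x ∷ y ∷ z ∷ m ∷ []))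
      arith : ∀ x i v w v₁ d t → x + t ≤ i → suc i ≤ suc v → w + d ≡ v → w ≤ v₁ → suc d ≤ t → x ≤ v₁
      arith x i v w v₁ d t p q r s o = lin 1 (p ⊕ q ⊕ eq≥ r ⊕ s ⊕ o) (solve (x ∷ i ∷ v ∷ w ∷ v₁ ∷ d ∷ t ∷ []))

  -- If I had a nontrivial autarky on I′, Hall's theorem would apply to the remaining clauses.

  leanFrom : ∀ {I I′ V} → Unsat M I′ V → (∀ {i} → i ∈ I′ → i ∈ tch M V) → I′ ⊆ I →
    (∀ {V₂} → V₂ ⊆ V → Nonempty V₂ → Nonempty (V ─ V₂) → # I ≤ # (I ∩ tch M V₂) + # (V ─ V₂)) → Lean M I′ V
  leanFrom {I} {I′} {V} u t I′⊆I k {S} a S⊆V (v , v∈S) s =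
    hall (# (V ─ S)) {I′ ─ tch M S} {V ─ S} ≤-refl
      (λ p → let q , r = ─⁻ {A = I′} p in tch-─ (t q) r) counts λ a′ s′ → u (glue S a a′) (sat a′ s′)
    where
    sat : ∀ a′ → (∀ {i} → i ∈ I′ ─ tch M S → Sat M a′ (V ─ S) i) → ∀ {i} → i ∈ I′ → Sat M (glue S a a′) V i
    sat a′ s′ {i} p with ∈? (tch M S) i
    ... | inj₁ q = Sat-mono S⊆V (Sat-glueˡ (s p q))
    ... | inj₂ q = Sat-mono (λ r → proj₁ (─⁻ {A = V} r)) (Sat-glueʳ (λ r → proj₂ (─⁻ {A = V} r)) (s′ (─⁺ p q)))
    counts : ∀ {V₁} → V₁ ⊆ V ─ S → Nonempty V₁ → # ((I′ ─ tch M S) ─ tch M ((V ─ S) ─ V₁)) ≤ # V₁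
    counts {V₁} f (w , w∈V₁) = arith (# ((I′ ─ tch M S) ─ tch M ((V ─ S) ─ V₁))) (# (I ∩ tch M (V ─ V₁))) (# I) (# (V ─ (V ─ V₁))) (# V₁)
        (#-disj (λ p → I′⊆I (proj₁ (─⁻ {A = I′} (proj₁ (─⁻ {A = I′ ─ tch M S} p))))) (λ p → proj₁ (∩⁻ {A = I} p)) disjoint)
        (k {V ─ V₁} (λ p → proj₁ (─⁻ {A = V} p)) (v , ─⁺ (S⊆V v∈S) (¬∈ λ p → ∈∉ v∈S (proj₂ (─⁻ {A = V} (f p)))))
           (w , ─⁺ (proj₁ (─⁻ {A = V} (f w∈V₁))) (¬∈ λ p → ∈∉ w∈V₁ (proj₂ (─⁻ {A = V} p)))))
        (#-mono λ p → let q , r = ─⁻ {A = V} p in ¬∉ λ o → ∈∉ (─⁺ q o) r)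
      where
      arith : ∀ x y z d v₁ → x + y ≤ z → z ≤ y + d → d ≤ v₁ → x ≤ v₁
      arith x y z d v₁ p q r = lin 0 (p ⊕ q ⊕ r) (solve (x ∷ y ∷ z ∷ d ∷ v₁ ∷ []))
      disjoint : ∀ {i} → i ∈ (I′ ─ tch M S) ─ tch M ((V ─ S) ─ V₁) → i ∈ I ∩ tch M (V ─ V₁) → ⊥
      disjoint {i} p q with ─⁻ {A = I′ ─ tch M S} p | tch⁻ (proj₂ (∩⁻ {A = I} q))
      ... | p₁ , p₂ | j , j∈ , o with ─⁻ {A = I′} p₁ | ─⁻ {A = V} j∈
      ...   | p₃ , p₄ | j∈V , j∉ = ∈∉ (tch⁺ (─⁺ (─⁺ j∈V (¬∈ λ r → ∈∉ (tch⁺ r o) p₄)) j∉) o) p₂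

-- Critical sets of variables

-- A set `V` that is minimal among those with at most |V| + `k` touching clauses; `proper` is this
-- minimality in numerical form.
record Critical {c n} (M : Matrix c n) (k : ℕ) (I : Sub c) (V : Sub n) : Set where
  field
    ne      : Nonempty V
    lean    : Lean M I V
    touched : ∀ {i} → i ∈ I → i ∈ tch M V
    card    : # I ≡ k + # V
    proper  : ∀ {S} → S ⊆ V → Nonempty S → Nonempty (V ─ S) → suc k + # S ≤ # (I ∩ tch M S)

module _ {c n} {M : Matrix c n} where

  -- Descent on `k` + |V|: if the surplus is smaller, lower `k`; if `proper` fails for some subset,
  -- pass to it. Tarsi's bound stops the descent before `k` reaches 0.
  critical : ∀ m {I V k} → k + # V ≤ m → Lean M I V → Nonempty V → # (I ∩ tch M V) ≤ k + # V →
    (∀ {k′ Q} → 1 ≤ k′ → k′ ≤ k → Q ⊆ V → Critical M k′ (I ∩ tch M Q) Q → ⊥) → ⊥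
  critical m {I} {V} {zero} h l ne t κ = arith (# V) (tarsi (# V) {I} {V} ≤-refl l ne) t
    where
    arith : ∀ v {x} → suc v ≤ x → x ≤ v → ⊥
    arith v p q with ≤-trans p q
    ... | r = absurd v r
      where
      absurd : ∀ v → suc v ≤ v → ⊥
      absurd (suc v) (s≤s r) = absurd v r
  critical zero {k = suc k} ()
  critical (suc m) {I} {V} {suc k} (s≤s h) l ne t κ with # (I ∩ tch M V) ≤? k + # V
  ... | yes r = critical m {I} {V} {k} h l ne r λ p q → κ p (≤-trans q (n≤1+n k))
  ... | no ¬r = κ (s≤s z≤n) ≤-refl (λ p → p) record
    { ne = ne
    ; lean = Lean-mono (λ p → p) ∩⁺ l
    ; touched = λ p → proj₂ (∩⁻ {A = I} p)
    ; card = ≤-antisym t (≰⇒> ¬r)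
    ; proper = proper
    }
    where
    proper : ∀ {S} → S ⊆ V → Nonempty S → Nonempty (V ─ S) → suc (suc k) + # S ≤ # ((I ∩ tch M V) ∩ tch M S)
    proper {S} f ne₁ (j , j∈) with suc (suc k) + # S ≤? # ((I ∩ tch M V) ∩ tch M S)
    ... | yes r₁ = r₁
    ... | no ¬r₁ = ⊥-elim (critical m {I} {S} {suc k}
                     (arith₁ (# V) (# S) (# ⁅ j ⁆) h
                        (#-disj f (⁅⁆⊆ (proj₁ (─⁻ {A = V} j∈))) (λ p q → ∈∉ (subst (_∈ S) (sym (∈⁅⁆⁻ q)) p) (proj₂ (─⁻ {A = V} j∈))))
                        (#⁅⁆ j))
                     (Lean-mono f (λ p _ → p) l) ne₁
                     (arith₂ (# S) (# (I ∩ tch M S)) (# ((I ∩ tch M V) ∩ tch M S))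
                        (#-mono λ p → let q , r = ∩⁻ {A = I} p in ∩⁺ (∩⁺ q (tch-mono f r)) r) (≰⇒> ¬r₁))
                     λ p q Q⊆S → κ p q (λ r → f (Q⊆S r)))
      where
      arith₁ : ∀ v s o → k + v ≤ m → s + o ≤ v → o ≡ 1 → suc k + s ≤ m
      arith₁ v s _ p q refl = lin 0 (p ⊕ q) (solve (v ∷ s ∷ k ∷ m ∷ []))
      arith₂ : ∀ s x y → x ≤ y → suc y ≤ suc (suc k) + s → x ≤ suc k + s
      arith₂ s x y p q = lin 0 (p ⊕ q) (solve (s ∷ x ∷ y ∷ k ∷ []))

  module Split {k I V} (C : Critical M k I V) where
    open Critical C

    module _ {v} (v∈V : v ∈ V) where

      -- By `proper`, the other variables alone meet `k` + |V| clauses, and there are no more.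
      rest-touched : Nonempty (V ─ ⁅ v ⁆) → ∀ {i} → i ∈ I → i ∈ tch M (V ─ ⁅ v ⁆)
      rest-touched ne′ p = proj₂ (∩⁻ {A = I} (#-full {A = I ∩ tch M (V ─ ⁅ v ⁆)} {I} (λ q → proj₁ (∩⁻ {A = I} q))
        (arith (# I) (# V) (# (V ─ ⁅ v ⁆)) (# (I ∩ tch M (V ─ ⁅ v ⁆))) card (#-remove V v∈V)
           (proper (λ q → proj₁ (─⁻ {A = V} q)) ne′ (v , ─⁺ v∈V (¬∈ λ q → ∈∉ (self∈ v) (proj₂ (─⁻ {A = V} q)))))) p))
        where
        arith : ∀ i v v′ t → i ≡ k + v → v ≡ suc v′ → suc k + v′ ≤ t → i ≤ t
        arith i v v′ t refl refl p = lin 0 p (solve (k ∷ v′ ∷ t ∷ []))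

      -- The extra unit of surplus of proper subsets compensates for the lost variable `v`, which is
      -- exactly the counting hypothesis of `leanFrom`.
      rest-lean : ∀ b → Nonempty (V ─ ⁅ v ⁆) → Lean M (I ─ has M v b) (V ─ ⁅ v ⁆)
      rest-lean b ne′ = leanFrom {I = I} unsat (λ p → rest-touched ne′ (proj₁ (─⁻ {A = I} p))) (λ p → proj₁ (─⁻ {A = I} p)) counts
        where
        unsat : Unsat M (I ─ has M v b) (V ─ ⁅ v ⁆)
        unsat a s = lean⇒unsat lean ne (glue ⁅ v ⁆ (λ _ → b) a) sat
          where
          sat : ∀ {i} → i ∈ I → Sat M (glue ⁅ v ⁆ (λ _ → b) a) V i
          sat {i} r with ∈? (has M v b) i
          ... | inj₁ x = via v v∈V (trans (has⁻ x) (cong just (sym (glue∈ {A = ⁅ v ⁆} {λ _ → b} {a} (self∈ v)))))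
          ... | inj₂ x = Sat-mono (λ y → proj₁ (─⁻ {A = V} y)) (Sat-glueʳ (λ y → proj₂ (─⁻ {A = V} y)) (s (─⁺ r x)))
        counts : ∀ {V₂} → V₂ ⊆ V ─ ⁅ v ⁆ → Nonempty V₂ → Nonempty ((V ─ ⁅ v ⁆) ─ V₂) → # I ≤ # (I ∩ tch M V₂) + # ((V ─ ⁅ v ⁆) ─ V₂)
        counts {V₂} f ne₂ (j , _) = arith (# I) (# V) (# (V ─ ⁅ v ⁆)) (# ((V ─ ⁅ v ⁆) ∩ V₂)) (# V₂) (# (I ∩ tch M V₂)) (# ((V ─ ⁅ v ⁆) ─ V₂)) card (#-remove V v∈V)
          (#-split (V ─ ⁅ v ⁆) V₂) (#-mono (λ p → proj₂ (∩⁻ {A = V ─ ⁅ v ⁆} p)))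
          (proper (λ p → proj₁ (─⁻ {A = V} (f p))) ne₂ (v , ─⁺ v∈V (¬∈ λ p → ∈∉ (self∈ v) (proj₂ (─⁻ {A = V} (f p))))))
          where
          arith : ∀ i v v′ s v₂ t d → i ≡ k + v → v ≡ suc v′ → s + d ≡ v′ → s ≤ v₂ → suc k + v₂ ≤ t → i ≤ t + d
          arith i v _ s v₂ t d refl refl refl p q = lin 0 (p ⊕ q) (solve (k ∷ s ∷ v₂ ∷ t ∷ d ∷ []))

      rest-card : ∀ b → # (I ∩ has M v b) + # (I ─ has M v b) ≡ suc k + # (V ─ ⁅ v ⁆)
      rest-card b = trans (#-split I (has M v b)) (trans card (trans (cong (λ x → k + x) (#-remove V v∈V)) (+-suc k _)))

      -- What is left after satisfying the literal is lean, so Tarsi's bound limits how many clauses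
      -- can have disappeared.
      literal≤ : ∀ b → Nonempty (V ─ ⁅ v ⁆) → # (I ∩ has M v b) ≤ k
      literal≤ b ne′ = arith (# (I ∩ has M v b)) (# (I ─ has M v b)) (# (V ─ ⁅ v ⁆)) (# ((I ─ has M v b) ∩ tch M (V ─ ⁅ v ⁆))) (rest-card b)
        (tarsi (# (V ─ ⁅ v ⁆)) {I ─ has M v b} {V ─ ⁅ v ⁆} ≤-refl (rest-lean b ne′) ne′) (#-mono λ p → proj₁ (∩⁻ {A = I ─ has M v b} p))
        where
        arith : ∀ x y v t → x + y ≡ suc k + v → suc v ≤ t → t ≤ y → x ≤ k
        arith x y v t p q r = lin 0 (eq≤ p ⊕ q ⊕ r) (solve (x ∷ y ∷ v ∷ t ∷ k ∷ []))

      degree-single : # (V ─ ⁅ v ⁆) ≤ 0 → # (I ∩ occ M v) ≤ suc k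
      degree-single z = arith (# (I ∩ occ M v)) (# I) (# V) (# (V ─ ⁅ v ⁆)) (#-mono λ p → proj₁ (∩⁻ {A = I} p)) card (#-remove V v∈V) z
        where
        arith : ∀ x i v v′ → x ≤ i → i ≡ k + v → v ≡ suc v′ → v′ ≤ 0 → x ≤ suc k
        arith x i v v′ p refl refl q = lin 0 (p ⊕ q) (solve (x ∷ k ∷ v′ ∷ []))

  degree-tch : ∀ {I Q w} → w ∈ Q → # (I ∩ occ M w) ≤ # ((I ∩ tch M Q) ∩ occ M w)
  degree-tch {I} p = #-mono λ q → let r , s = ∩⁻ {A = I} q in ∩⁺ (∩⁺ r (tch⁺ p s)) s

  -- With `k = 1` each sign of a variable occurs at most once; if there is only one variable, there
  -- are only two clauses.
  critical-1 : ∀ {I V} → Critical M 1 I V → (∀ {w} → w ∈ V → 3 ≤ # (I ∩ occ M w)) → ⊥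
  critical-1 {I} {V} C d with Critical.ne C
  ... | v , p with nonempty? (V ─ ⁅ v ⁆)
  ...   | inj₁ z   = absurd (≤-trans (d p) (Split.degree-single C p z))
    where
    absurd : 3 ≤ 2 → ⊥
    absurd (s≤s (s≤s ()))
  ...   | inj₂ ne′ = arith (# (I ∩ has M v true)) (# (I ∩ has M v false)) (# (I ∩ occ M v)) (d p) (#-literals I v true)
                       (Split.literal≤ C p true ne′) (Split.literal≤ C p false ne′)
    where
    arith : ∀ x y z → 3 ≤ z → x + y ≡ z → x ≤ 1 → y ≤ 1 → ⊥
    arith x y z p refl q r with lin {_} {_} 0 {1} {0} (p ⊕ q ⊕ r) (solve (x ∷ y ∷ []))
    ... | ()

  lean-1 : ∀ {I V} → Lean M I V → Nonempty V → # (I ∩ tch M V) ≤ 1 + # V → (∀ {w} → w ∈ V → 3 ≤ # (I ∩ occ M w)) → ⊥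
  lean-1 {I} {V} l ne t d = critical (1 + # V) {I} {V} {1} ≤-refl l ne t λ p q Q⊆V C → go p q Q⊆V C
    where
    go : ∀ {k′ Q} → 1 ≤ k′ → k′ ≤ 1 → Q ⊆ V → Critical M k′ (I ∩ tch M Q) Q → ⊥
    go {suc zero} {Q} p q Q⊆V C = critical-1 C λ r → ≤-trans (d (Q⊆V r)) (degree-tch {I} r)
    go {suc (suc _)} p (s≤s ()) Q⊆V C

-- Critical clause-sets of deficiency 2

same? : ∀ a b → a ≡ b ⊎ a ≡ not b
same? true  true  = inj₁ refl
same? true  false = inj₂ refl
same? false true  = inj₂ refl
same? false false = inj₁ refl

absurd≤ : ∀ {n} → suc n ≤ n → ⊥
absurd≤ {suc n} (s≤s p) = absurd≤ p

module _ {c n} {M : Matrix c n} where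

  -- An assignment that satisfied a literal of the exceptional clause as well would be a model of
  -- everything.
  falsified : ∀ {I V a i} → Unsat M I V → (∀ {i′} → i′ ∈ I → i′ ≢ i → Sat M a V i′) →
              ∀ {j s} → j ∈ V → i ∈ has M j s → a j ≡ not s
  falsified {I} {V} {a} {i} u h {j} {s} p q with same? (a j) s
  ... | inj₂ e = e
  ... | inj₁ e = ⊥-elim (u a sat)
    where
    sat : ∀ {i′} → i′ ∈ I → Sat M a V i′
    sat {i′} r with i′ ≟ i
    ... | yes refl = via j p (trans (has⁻ q) (cong just (sym e)))
    ... | no ne    = h r ne

  module Critical₂ {I V} (C : Critical M 2 I V) (deg≥4 : ∀ {w} → w ∈ V → 4 ≤ # (I ∩ occ M w)) where
    open Critical C

    others : ∀ {v} → v ∈ V → Nonempty (V ─ ⁅ v ⁆)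
    others {v} p with nonempty? (V ─ ⁅ v ⁆)
    ... | inj₁ z = ⊥-elim (absurd≤ (≤-trans (deg≥4 p) (Split.degree-single C p z)))
    ... | inj₂ q = q

    literal≡2 : ∀ {v} b → v ∈ V → # (I ∩ has M v b) ≡ 2
    literal≡2 {v} b p = ≤-antisym (Split.literal≤ C p b (others p))
        (arith (# (I ∩ has M v b)) (# (I ∩ has M v (not b))) _ (Split.literal≤ C p (not b) (others p)) (#-literals I v b) (deg≥4 p))
      where
      arith : ∀ x y z → y ≤ 2 → x + y ≡ z → 4 ≤ z → 2 ≤ x
      arith x y z p refl q = lin 0 (p ⊕ q) (solve (x ∷ y ∷ []))

    degree≡4 : ∀ {v} → v ∈ V → # (I ∩ occ M v) ≡ 4
    degree≡4 {v} p = trans (sym (#-literals I v true)) (arith (literal≡2 true p) (literal≡2 false p))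
      where
      arith : ∀ {x y} → x ≡ 2 → y ≡ 2 → x + y ≡ 4
      arith refl refl = refl

    -- Removing the two clauses with a given literal of u leaves deficiency 1, hence a variable w
    -- of degree 2, which must occur in both removed clauses, with different signs.

    clashing-pair : ∀ {u} b → u ∈ V →
      (∀ {A₁ A₂ w} → A₁ ∈ I → A₁ ∈ has M u b → A₂ ∈ I → A₂ ∈ has M u b → w ∈ V → w ≢ u →
         A₁ ∈ has M w true → A₂ ∈ has M w false → ⊥) → ⊥
    clashing-pair {u} b p κ = lean-1 {I = I′} lean′ (others p)
        (arith (# (I′ ∩ tch M (V ─ ⁅ u ⁆))) (# I′) (# (V ─ ⁅ u ⁆)) (# (I ∩ has M u b))
           (#-mono λ q → proj₁ (∩⁻ {A = I′} q)) (Split.rest-card C p b) (literal≡2 b p))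
        deg≥3
      where
      I′ = I ─ has M u b
      lean′ = Split.rest-lean C p b (others p)
      arith : ∀ x y z w → x ≤ y → w + y ≡ 3 + z → w ≡ 2 → x ≤ 1 + z
      arith x y z w p q refl = lin 0 (p ⊕ eq≤ q) (solve (x ∷ y ∷ z ∷ []))
      deg≥3 : ∀ {w} → w ∈ V ─ ⁅ u ⁆ → 3 ≤ # (I′ ∩ occ M w)
      deg≥3 {w} q with 3 ≤? # (I′ ∩ occ M w) | ─⁻ {A = V} q
      ... | yes r | _ = r
      ... | no ¬r | w∈V , w∉u = ⊥-elim (found (shared true) (shared false))
        where
        shared : ∀ s → ∃[ i ] i ∈ (I ∩ has M w s) ∩ has M u b
        shared s = pick _ (count (# ((I ∩ has M w s) ∩ has M u b)) (# ((I ∩ has M w s) ─ has M u b)) (# (I′ ∩ has M w s)) (# (I′ ∩ has M w (not s))) _ _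
                     (#-split (I ∩ has M w s) (has M u b)) (literal≡2 s w∈V)
                     (#-mono λ x → let y , z = ─⁻ {A = I ∩ has M w s} x ; o , l = ∩⁻ {A = I} y in ∩⁺ (─⁺ o z) l)
                     (lean-literal (not s) lean′ q) (#-literals I′ w s) (≰⇒> ¬r))
          where
          count : ∀ x y y′ z t d → x + y ≡ t → t ≡ 2 → y ≤ y′ → 1 ≤ z → y′ + z ≡ d → suc d ≤ 3 → 1 ≤ x
          count x y y′ z _ _ p refl q r refl o = lin 0 (eq≥ p ⊕ q ⊕ r ⊕ o) (solve (x ∷ y ∷ y′ ∷ z ∷ []))
        found : (∃[ i ] i ∈ (I ∩ has M w true) ∩ has M u b) → (∃[ i ] i ∈ (I ∩ has M w false) ∩ has M u b) → ⊥
        found (i , x) (i′ , x′) with ∩⁻ {A = I ∩ has M w true} x | ∩⁻ {A = I ∩ has M w false} x′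
        ... | y , hu | y′ , hu′ with ∩⁻ {A = I} y | ∩⁻ {A = I} y′
        ...   | i∈ , hw | i′∈ , hw′ = κ i∈ hu i′∈ hu′ w∈V (λ e → ∉⁅⁆⁻ w∉u (sym e)) hw hw′

    -- If the other clauses were unsatisfiable, criticality would make them lean, of deficiency 1;
    -- but omitting one clause lowers the degrees only to 3, against `lean-1`.
    satisfy-others : ∀ {i} → i ∈ I →
      (∀ a → (∀ {i′} → i′ ∈ I → i′ ≢ i → Sat M a V i′) → (∀ {j s} → j ∈ V → i ∈ has M j s → a j ≡ not s) → ⊥) → ⊥
    satisfy-others {i} p κ = lean-1 {I = I′}
        (leanFrom {I = I} unsat (λ q → touched (proj₁ (─⁻ {A = I} q))) (λ q → proj₁ (─⁻ {A = I} q)) counts)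
        ne (arith (# (I′ ∩ tch M V)) (# I′) (# I) (# V) (#-mono λ q → proj₁ (∩⁻ {A = I′} q)) (#-remove I p) card) deg≥3
      where
      I′ = I ─ ⁅ i ⁆
      unsat : Unsat M I′ V
      unsat a s = κ a h (falsified (lean⇒unsat lean ne) h)
        where
        h : ∀ {i′} → i′ ∈ I → i′ ≢ i → Sat M a V i′
        h q ne = s (─⁺ q (∉⁅⁆⁺ λ e → ne (sym e)))
      counts : ∀ {V₂} → V₂ ⊆ V → Nonempty V₂ → Nonempty (V ─ V₂) → # I ≤ # (I ∩ tch M V₂) + # (V ─ V₂)
      counts {V₂} f ne₂ ne₃ = count (# I) (# V) (# (V ∩ V₂)) (# V₂) (# (V ─ V₂)) _ card (#-split V V₂) (#-mono λ q → proj₂ (∩⁻ {A = V} q)) (proper f ne₂ ne₃)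
        where
        count : ∀ i v x v₂ d t → i ≡ 2 + v → x + d ≡ v → x ≤ v₂ → 3 + v₂ ≤ t → i ≤ t + d
        count i _ x v₂ d t refl refl p q = lin 1 (p ⊕ q) (solve (x ∷ v₂ ∷ d ∷ t ∷ []))
      arith : ∀ x y z v → x ≤ y → z ≡ suc y → z ≡ 2 + v → x ≤ 1 + v
      arith x y z v p refl q = lin 0 (p ⊕ eq≤ q) (solve (x ∷ y ∷ v ∷ []))
      deg≥3 : ∀ {w} → w ∈ V → 3 ≤ # (I′ ∩ occ M w)
      deg≥3 {w} q = count _ _ _ (deg≥4 q) (#-cover cover) (#⁅⁆ i)
        where
        cover : ∀ {i′} → i′ ∈ I ∩ occ M w → i′ ∈ I′ ∩ occ M w ⊎ i′ ∈ ⁅ i ⁆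
        cover {i′} r with ∈? ⁅ i ⁆ i′ | ∩⁻ {A = I} r
        ... | inj₁ e | _     = inj₂ e
        ... | inj₂ e | x , y = inj₁ (∩⁺ (─⁺ x e) y)
        count : ∀ x y o → 4 ≤ x → x ≤ y + o → o ≡ 1 → 3 ≤ y
        count x y _ p q refl = lin 0 (p ⊕ q) (solve (x ∷ y ∷ []))

-- Deficiency 1: trees of resolutions

record Pivot {c n} (M : Matrix c n) (I : Sub c) (Z : Sub n) : Set where
  field
    z   : Fin n
    C D : Fin c
    z∈Z  : z ∈ Z
    C∈I  : C ∈ I
    D∈I  : D ∈ I
    C∋z  : C ∈ has M z true
    D∋z̄  : D ∈ has M z false
    only : ∀ b → # (I ∩ has M z b) ≤ 1

module _ {c n} {M : Matrix c n} where

  -- Any variable of a critical part of deficiency 1 serves: leanness provides an occurrence of each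
  -- sign, criticality forbids a second one.
  pivot : ∀ {I Z} → Lean M I Z → Nonempty Z → # I ≤ 1 + # Z → (Pivot M I Z → ⊥) → ⊥
  pivot {I} {Z} l ne h κ =
    critical (1 + # Z) {I} {Z} {1} ≤-refl l ne (≤-trans (#-mono λ p → proj₁ (∩⁻ {A = I} p)) h) found
    where
    found : ∀ {k′ Q} → 1 ≤ k′ → k′ ≤ 1 → Q ⊆ Z → Critical M k′ (I ∩ tch M Q) Q → ⊥
    found {suc (suc _)} p (s≤s ()) Q⊆Z K
    found {suc zero} {Q} p q Q⊆Z K with Critical.ne K
    ... | z , z∈Q with pick _ (lean-literal true l (Q⊆Z z∈Q)) | pick _ (lean-literal false l (Q⊆Z z∈Q))
    ...   | C , C∈ | D , D∈ = κ record
      { z = z ; C = C ; D = D ; z∈Z = Q⊆Z z∈Q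
      ; C∈I = proj₁ (∩⁻ {A = I} C∈) ; D∈I = proj₁ (∩⁻ {A = I} D∈)
      ; C∋z = proj₂ (∩⁻ {A = I} C∈) ; D∋z̄ = proj₂ (∩⁻ {A = I} D∈)
      ; only = λ b → ≤-trans (#-mono λ r → let x , y = ∩⁻ {A = I} r in ∩⁺ (∩⁺ x (tch⁺ z∈Q (has⇒occ y))) y) (only b)
      }
      where
      only : ∀ b → # ((I ∩ tch M Q) ∩ has M z b) ≤ 1
      only b with nonempty? (Q ─ ⁅ z ⁆)
      ... | inj₂ ne′ = Split.literal≤ K z∈Q b ne′
      ... | inj₁ e   = arith (# ((I ∩ tch M Q) ∩ has M z b)) _ _ (lean-literal (not b) (Critical.lean K) z∈Q) (#-literals (I ∩ tch M Q) z b) (Split.degree-single K z∈Q e)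
        where
        arith : ∀ x y t → 1 ≤ y → x + y ≡ t → t ≤ 2 → x ≤ 1
        arith x y _ p refl q = lin 0 (p ⊕ q) (solve (x ∷ y ∷ []))

-- The first argument wins a conflict. For two parents of a resolution `no-second-clash` excludes
-- conflicts away from `z`, so no literal of `D` gets lost there.
merge : Maybe Bool → Maybe Bool → Maybe Bool
merge (just b) _ = just b
merge nothing  m = m

merge⁻ : ∀ p q {b} → merge p q ≡ just b → p ≡ just b ⊎ q ≡ just b
merge⁻ (just _) q e = inj₁ e
merge⁻ nothing  q e = inj₂ e

module Resolve {c n} {M : Matrix c n} {I Z} (l : Lean M I Z) (h : # I ≤ 1 + # Z) (P : Pivot M I Z) where
  open Pivot P public

  -- The resolvent overwrites row `C`, while `I′` and `Z′` drop row `D` and column `z`; this avoids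
  -- any reindexing.
  M′ : Matrix c n
  M′ i j = if ⁅ C ⁆ i then merge (M C j) (M D j) else M i j
  I′ = I ─ ⁅ D ⁆
  Z′ = Z ─ ⁅ z ⁆

  C≢D : C ≢ D
  C≢D e = has-clash C∋z (subst (_∈ has M z false) (sym e) D∋z̄)

  at-z : ∀ {i} → i ∈ I → i ∈ occ M z → i ≡ C ⊎ i ≡ D
  at-z {i} p q with ∈? (has M z true) i
  ... | inj₁ r = inj₁ (#≤1 (only true) (∩⁺ p r) (∩⁺ C∈I C∋z))
  ... | inj₂ r = inj₂ (#≤1 (only false) (∩⁺ p (occ⇒has q r)) (∩⁺ D∈I D∋z̄))

  away : ∀ {i j} → i ∈ I → i ≢ C → i ≢ D → i ∈ occ M j → j ≢ z
  away p i≢C i≢D q refl with at-z p q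
  ... | inj₁ e = i≢C e
  ... | inj₂ e = i≢D e

  Z′⁺ : ∀ {j} → j ∈ Z → j ≢ z → j ∈ Z′
  Z′⁺ p q = ─⁺ p (∉⁅⁆⁺ λ e → q (sym e))

  Z′⊆Z : Z′ ⊆ Z
  Z′⊆Z p = proj₁ (─⁻ {A = Z} p)

  z∉Z′ : ∀ {j} → j ∈ Z′ → j ≢ z
  z∉Z′ p e = ∉⁅⁆⁻ (proj₂ (─⁻ {A = Z} p)) (sym e)

  row-C : ∀ j → M′ C j ≡ merge (M C j) (M D j)
  row-C j rewrite holds (self∈ C) = refl

  row : ∀ {i} j → i ≢ C → M′ i j ≡ M i j
  row {i} j ne rewrite fails (∉⁅⁆⁺ {i = C} {i} (λ e → ne (sym e))) = refl

  C⇒ : ∀ {j b} → M C j ≡ just b → M′ C j ≡ just b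
  C⇒ {j} e = trans (row-C j) (trans (cong (λ m → merge m (M D j)) e) refl)

  card′ : # I′ ≤ 1 + # Z′
  card′ = arith (# I) (# I′) (# Z) (# Z′) h (#-remove I D∈I) (#-remove Z z∈Z)
    where
    arith : ∀ x y z w → x ≤ 1 + z → x ≡ suc y → z ≡ suc w → y ≤ 1 + w
    arith _ y _ w (s≤s p) refl refl = p

  -- If C and D also clashed at y, then I without C and D would be unsatisfiable without z.

  no-second-clash : ∀ {y s} → y ∈ Z → y ≢ z → C ∈ has M y s → D ∈ has M y (not s) → ⊥
  no-second-clash {y} {s} y∈Z y≢z C∋y D∋y = hall (# Z′) {T} {Z′} ≤-refl touched counts unsat
    where
    T = ((I ∩ tch M Z) ─ ⁅ C ⁆) ─ ⁅ D ⁆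
    T⁻ : ∀ {i} → i ∈ T → i ∈ I × i ∈ tch M Z × i ≢ C × i ≢ D
    T⁻ p with ─⁻ {A = (I ∩ tch M Z) ─ ⁅ C ⁆} p
    ... | q , d with ─⁻ {A = I ∩ tch M Z} q
    ...   | r , e with ∩⁻ {A = I} r
    ...     | x , y = x , y , (λ f → ∉⁅⁆⁻ e (sym f)) , (λ f → ∉⁅⁆⁻ d (sym f))
    touched : ∀ {i} → i ∈ T → i ∈ tch M Z′
    touched p with T⁻ p
    ... | i∈I , t , i≢C , i≢D with tch⁻ t
    ...   | j , j∈Z , o = tch⁺ (Z′⁺ j∈Z (away i∈I i≢C i≢D o)) o
    counts : ∀ {V₁} → V₁ ⊆ Z′ → Nonempty V₁ → # (T ─ tch M (Z′ ─ V₁)) ≤ # V₁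
    counts {V₁} f _ = arith (# (T ─ tch M (Z′ ─ V₁))) (# I) (# Z) (# S) (# V₁) (# (I ∩ tch M S))
        (#-disj (λ p → proj₁ (T⁻ (proj₁ (─⁻ {A = T} p)))) (λ p → proj₁ (∩⁻ {A = I} p)) disjoint)
        (tarsi (# S) {I} {S} ≤-refl (Lean-mono S⊆Z (λ p _ → p) l) (z , ∪⁺ʳ {A = Z′ ─ V₁} (self∈ z))) h (#-cover cover)
      where
      -- Adding `z` gains one in Tarsi's bound and costs nothing, since no row of `T` contains `z`.
      S = (Z′ ─ V₁) ∪ ⁅ z ⁆
      S⊆Z : S ⊆ Z
      S⊆Z p with ∪⁻ {A = Z′ ─ V₁} p
      ... | inj₁ q = Z′⊆Z (proj₁ (─⁻ {A = Z′} q))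
      ... | inj₂ q = ⁅⁆⊆ z∈Z q
      arith : ∀ x i z s v t → x + t ≤ i → suc s ≤ t → i ≤ 1 + z → z ≤ s + v → x ≤ v
      arith x i z s v t p q r o = lin 0 (p ⊕ q ⊕ r ⊕ o) (solve (x ∷ i ∷ z ∷ s ∷ v ∷ t ∷ []))
      disjoint : ∀ {i} → i ∈ T ─ tch M (Z′ ─ V₁) → i ∈ I ∩ tch M S → ⊥
      disjoint p q with ─⁻ {A = T} p | tch⁻ (proj₂ (∩⁻ {A = I} q))
      ... | p₁ , p₂ | j , j∈S , o with T⁻ p₁ | ∪⁻ {A = Z′ ─ V₁} j∈S
      ...   | _ | inj₁ r = ∈∉ (tch⁺ r o) p₂
      ...   | i∈I , _ , i≢C , i≢D | inj₂ r = away i∈I i≢C i≢D o (sym (∈⁅⁆⁻ r))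
      cover : ∀ {j} → j ∈ Z → j ∈ S ⊎ j ∈ V₁
      cover {j} p with ∈? V₁ j | z ≟ j
      ... | inj₁ q | _ = inj₂ q
      ... | inj₂ q | yes refl = inj₁ (∪⁺ʳ {A = Z′ ─ V₁} (self∈ z))
      ... | inj₂ q | no ne = inj₁ (∪⁺ˡ (─⁺ (Z′⁺ p (λ e → ne (sym e))) q))
    unsat : Unsat M T Z′
    unsat a s′ = choose (same? (a y) s)
      where
      finish : ∀ b → Sat M (glue ⁅ z ⁆ (λ _ → b) a) Z C → Sat M (glue ⁅ z ⁆ (λ _ → b) a) Z D → ⊥
      finish b sC sD = l (glue ⁅ z ⁆ (λ _ → b) a) (λ p → p) (z , z∈Z) sat
        where
        sat : ∀ {i} → i ∈ I → i ∈ tch M Z → Sat M (glue ⁅ z ⁆ (λ _ → b) a) Z i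
        sat {i} p t with i ≟ C | i ≟ D
        ... | yes refl | _ = sC
        ... | no _ | yes refl = sD
        ... | no i≢C | no i≢D = Sat-mono Z′⊆Z (Sat-glueʳ (λ q → proj₂ (─⁻ {A = Z} q))
              (s′ (─⁺ (─⁺ (∩⁺ p t) (∉⁅⁆⁺ λ e → i≢C (sym e))) (∉⁅⁆⁺ λ e → i≢D (sym e)))))
      z-val : ∀ {b} → just b ≡ just (glue ⁅ z ⁆ (λ _ → b) a z)
      z-val {b} = cong just (sym (glue∈ {A = ⁅ z ⁆} {λ _ → b} {a} (self∈ z)))
      y-val : ∀ {b} → just (a y) ≡ just (glue ⁅ z ⁆ (λ _ → b) a y)
      y-val {b} = cong just (sym (glue∉ {A = ⁅ z ⁆} {λ _ → b} {a} (∉⁅⁆⁺ λ e → y≢z (sym e))))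
      -- The value of `y` satisfies one of `C` and `D`, so `z` is free to satisfy the other.
      choose : a y ≡ s ⊎ a y ≡ not s → ⊥
      choose (inj₁ e) = finish false (via y y∈Z (trans (has⁻ C∋y) (trans (cong just (sym e)) y-val))) (via z z∈Z (trans (has⁻ D∋z̄) z-val))
      choose (inj₂ e) = finish true (via z z∈Z (trans (has⁻ C∋z) z-val)) (via y y∈Z (trans (has⁻ D∋y) (trans (cong just (sym e)) y-val)))

  D⇒ : ∀ {j b} → j ∈ Z′ → M D j ≡ just b → M′ C j ≡ just b
  D⇒ {j} {b} p e = trans (row-C j) (go (M C j) refl)
    where
    go : ∀ m → M C j ≡ m → merge m (M D j) ≡ just b
    go nothing  _ = e
    go (just b′) f with same? b b′
    ... | inj₁ g = cong just (sym g)
    ... | inj₂ g = ⊥-elim (no-second-clash (Z′⊆Z p) (z∉Z′ p) (has⁺ f) (has⁺ (trans e (cong just g))))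

  -- An autarky that touches the resolvent satisfies it by a literal of one parent, and `z` can be
  -- set to satisfy the other parent. One that misses the resolvent misses both parents and is an
  -- autarky already.
  lean′ : Lean M′ I′ Z′
  lean′ {S} a S⊆Z′ ne s with ∈? (tch M′ S) C
  ... | inj₂ C∉ = l a (λ p → Z′⊆Z (S⊆Z′ p)) ne sat
    where
    sat : ∀ {i} → i ∈ I → i ∈ tch M S → Sat M a S i
    sat {i} p t with i ≟ C | i ≟ D | tch⁻ t
    ... | yes refl | _ | j , q , o = ⊥-elim (∈∉ (tch⁺ q (occ⁺ (C⇒ (proj₂ (occ⁻ o))))) C∉)
    ... | no _ | yes refl | j , q , o = ⊥-elim (∈∉ (tch⁺ q (occ⁺ (D⇒ (S⊆Z′ q) (proj₂ (occ⁻ o))))) C∉)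
    ... | no i≢C | no i≢D | j , q , o with s (─⁺ p (∉⁅⁆⁺ λ e → i≢D (sym e))) (tch⁺ q (occ⁺ (trans (row j i≢C) (proj₂ (occ⁻ o)))))
    ...   | via k r e = via k r (trans (sym (row k i≢C)) e)
  ... | inj₁ C∈ with s (─⁺ C∈I (∉⁅⁆⁺ λ e → C≢D (sym e))) C∈
  ...   | via j j∈S e = choose (merge⁻ (M C j) (M D j) (trans (sym (row-C j)) e))
    where
    S₊ = S ∪ ⁅ z ⁆
    S₊⊆Z : S₊ ⊆ Z
    S₊⊆Z p with ∪⁻ {A = S} p
    ... | inj₁ q = Z′⊆Z (S⊆Z′ q)
    ... | inj₂ q = ⁅⁆⊆ z∈Z q
    S-away : ∀ {j} → j ∈ S → j ∉ ⁅ z ⁆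
    S-away p = ∉⁅⁆⁺ λ e → z∉Z′ (S⊆Z′ p) (sym e)
    finish : ∀ b → Sat M (glue ⁅ z ⁆ (λ _ → b) a) S₊ C → Sat M (glue ⁅ z ⁆ (λ _ → b) a) S₊ D → ⊥
    finish b sC sD = l (glue ⁅ z ⁆ (λ _ → b) a) S₊⊆Z (z , ∪⁺ʳ {A = S} (self∈ z)) sat
      where
      sat : ∀ {i} → i ∈ I → i ∈ tch M S₊ → Sat M (glue ⁅ z ⁆ (λ _ → b) a) S₊ i
      sat {i} p t with i ≟ C | i ≟ D
      ... | yes refl | _ = sC
      ... | no _ | yes refl = sD
      ... | no i≢C | no i≢D with tch⁻ t
      ...   | k , q , o with ∪⁻ {A = S} q
      ...     | inj₂ r = ⊥-elim (away p i≢C i≢D o (sym (∈⁅⁆⁻ r)))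
      ...     | inj₁ r with s (─⁺ p (∉⁅⁆⁺ λ e → i≢D (sym e))) (tch⁺ r (occ⁺ (trans (row k i≢C) (proj₂ (occ⁻ o)))))
      ...       | via k′ r′ e′ = Sat-mono ∪⁺ˡ (Sat-glueʳ S-away (via k′ r′ (trans (sym (row k′ i≢C)) e′)))
    z-val : ∀ {b} → just b ≡ just (glue ⁅ z ⁆ (λ _ → b) a z)
    z-val {b} = cong just (sym (glue∈ {A = ⁅ z ⁆} {λ _ → b} {a} (self∈ z)))
    choose : M C j ≡ just (a j) ⊎ M D j ≡ just (a j) → ⊥
    choose (inj₁ f) = finish false (Sat-mono ∪⁺ˡ (Sat-glueʳ S-away (via j j∈S f))) (via z (∪⁺ʳ {A = S} (self∈ z)) (trans (has⁻ D∋z̄) z-val))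
    choose (inj₂ f) = finish true (via z (∪⁺ʳ {A = S} (self∈ z)) (trans (has⁻ C∋z) z-val)) (Sat-mono ∪⁺ˡ (Sat-glueʳ S-away (via j j∈S f)))

  img : ∀ i → i ∈ I → ∃[ i′ ] i′ ∈ I′ × (∀ {j s} → j ∈ Z′ → i ∈ has M j s → i′ ∈ has M′ j s)
  img i p with i ≟ D | i ≟ C
  ... | yes refl | _ = C , ─⁺ C∈I (∉⁅⁆⁺ λ e → C≢D (sym e)) , λ q r → has⁺ (D⇒ q (has⁻ r))
  ... | no i≢D | yes refl = C , ─⁺ C∈I (∉⁅⁆⁺ λ e → C≢D (sym e)) , λ q r → has⁺ (C⇒ (has⁻ r))
  ... | no i≢D | no i≢C = i , ─⁺ p (∉⁅⁆⁺ λ e → i≢D (sym e)) , λ {j} q r → has⁺ (trans (row j i≢C) (has⁻ r))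

  size′ : ∀ {m} → # Z ≤ suc m → # Z′ ≤ m
  size′ {m} p = arith (# Z) (# Z′) p (#-remove Z z∈Z)
    where
    arith : ∀ x y → x ≤ suc m → x ≡ suc y → y ≤ m
    arith _ y (s≤s p) refl = p

-- The negation of the configuration that `clashing-pair` finds at every variable in deficiency 2.
Clash-free : ∀ {c n} → Matrix c n → Sub c → Sub n → Fin n → Set
Clash-free M I P p = ∀ {s y t E E′} → E ∈ I → E′ ∈ I → E ∈ has M p s → E′ ∈ has M p s →
                     y ∈ P → E ∈ has M y t → E′ ∈ has M y (not t) → ⊥

-- A lean clause-set of deficiency 1 is a tree of resolutions; choose the lowest element of P in it.

lowest : ∀ m {c n} {M : Matrix c n} {I Z P} → # Z ≤ m → Lean M I Z → # I ≤ 1 + # Z → P ⊆ Z → Nonempty P →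
  (∀ {p} → p ∈ P → Clash-free M I P p → ⊥) → ⊥
lowest zero h l k f (p , p∈P) κ = #≤0 h (f p∈P)
lowest (suc m) {M = M} {I} {Z} {P} h l k f ne κ = pivot l (proj₁ ne , f (proj₂ ne)) k go
  where
  go : Pivot M I Z → ⊥
  go piv with ∈? P (Pivot.z piv)
  -- A pivot occurs once with each sign, so the two rows coincide.
  ... | inj₁ z∈P = κ z∈P λ {s} {y} {t} {E} {E′} p q x x′ _ y y′ →
                     has-clash y (subst (_∈ has M _ (not t)) (#≤1 (only s) (∩⁺ q x′) (∩⁺ p x)) y′)
    where open Resolve l k piv
  -- Literals on `Z′` survive resolution, so a clash in `M` persists in the resolved matrix.
  ... | inj₂ z∉P = lowest m (size′ h) lean′ card′ f′ ne
                     λ p∈P κ′ → κ p∈P λ {s} {y} {t} {E} {E′} e e′ x x′ y∈P w w′ →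
                       let F , F∈ , g = img E e ; F′ , F′∈ , g′ = img E′ e′ in
                       κ′ F∈ F′∈ (g (f′ p∈P) x) (g′ (f′ p∈P) x′) y∈P (g (f′ y∈P) w) (g′ (f′ y∈P) w′)
    where
    open Resolve l k piv
    f′ : P ⊆ Z′
    f′ p = Z′⁺ (f p) λ { refl → ∈∉ p z∉P }

-- Y is the set of variables of a subtree off the path to α.

two-models : ∀ m {c n} {M : Matrix c n} {I Z α φ₁ φ₂ j} → # Z ≤ m → Lean M I Z → # I ≤ 1 + # Z → α ∈ I →
  (∀ {i} → i ∈ I → i ≢ α → Sat M φ₁ Z i) → (∀ {i} → i ∈ I → i ≢ α → Sat M φ₂ Z i) → j ∈ Z → φ₁ j ≢ φ₂ j →
  (∀ {Y} → Y ⊆ Z → Nonempty Y → α ∉ tch M Y → # (I ∩ tch M Y) ≤ 1 + # Y → ⊥) → ⊥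
two-models zero h l k α∈I s₁ s₂ j∈Z _ κ = #≤0 h j∈Z
two-models (suc m) {M = M} {I} {Z} {α} {φ₁} {φ₂} {j} h l k α∈I s₁ s₂ j∈Z φ₁≢φ₂ κ = pivot l (j , j∈Z) k go
  where
  go : Pivot M I Z → ⊥
  go piv = by-α (∈? (occ M z) α)
    where
    open Resolve l k piv
    at-α : α ≡ C ⊎ α ≡ D → ⊥
    at-α e = two-models m {M = M′} {I′} {Z′} {C} {φ₁} {φ₂} {j} (size′ h) lean′ card′ (─⁺ C∈I (∉⁅⁆⁺ λ e → C≢D (sym e)))
                 (sat s₁) (sat s₂) (Z′⁺ j∈Z j≢z) φ₁≢φ₂ found
      where
      α∋z : ∃[ s ] α ∈ has M z s
      α∋z = by e
        where
        by : α ≡ C ⊎ α ≡ D → ∃[ s ] α ∈ has M z s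
        by (inj₁ refl) = true , C∋z
        by (inj₂ refl) = false , D∋z̄
      -- Both models falsify `α`, which contains `z`; hence they agree at `z`.
      j≢z : j ≢ z
      j≢z refl = φ₁≢φ₂ (trans (falsified (lean⇒unsat l (j , j∈Z)) s₁ j∈Z (proj₂ α∋z))
                         (sym (falsified (lean⇒unsat l (j , j∈Z)) s₂ j∈Z (proj₂ α∋z))))
      sat : ∀ {φ} → (∀ {i} → i ∈ I → i ≢ α → Sat M φ Z i) → ∀ {i} → i ∈ I′ → i ≢ C → Sat M′ φ Z′ i
      sat s p i≢C with ─⁻ {A = I} p
      ... | i∈I , i∉D with s i∈I (ne e)
        where
        ne : α ≡ C ⊎ α ≡ D → _ ≢ α
        ne (inj₁ refl) e = i≢C e
        ne (inj₂ refl) e = ∉⁅⁆⁻ i∉D (sym e)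
      ...   | via k x y = via k (Z′⁺ x (away i∈I i≢C (λ e → ∉⁅⁆⁻ i∉D (sym e)) (occ⁺ y))) (trans (row k i≢C) y)
      found : ∀ {Y} → Y ⊆ Z′ → Nonempty Y → C ∉ tch M′ Y → # (I′ ∩ tch M′ Y) ≤ 1 + # Y → ⊥
      found {Y} f ne C∉ q = κ (λ p → Z′⊆Z (f p)) ne (α∉ e) (≤-trans (#-mono incl) q)
        where
        C∉′ : C ∉ tch M Y
        C∉′ = ¬∈ λ p → let k , x , y = tch⁻ p in ∈∉ (tch⁺ x (occ⁺ (C⇒ (proj₂ (occ⁻ y))))) C∉
        D∉′ : D ∉ tch M Y
        D∉′ = ¬∈ λ p → let k , x , y = tch⁻ p in ∈∉ (tch⁺ x (occ⁺ (D⇒ (f x) (proj₂ (occ⁻ y))))) C∉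
        α∉ : α ≡ C ⊎ α ≡ D → α ∉ tch M Y
        α∉ (inj₁ refl) = C∉′
        α∉ (inj₂ refl) = D∉′
        incl : I ∩ tch M Y ⊆ I′ ∩ tch M′ Y
        incl {i} p with ∩⁻ {A = I} p
        ... | x , t with i ≟ C | i ≟ D | tch⁻ t
        ...   | yes refl | _ | _ = ⊥-elim (∈∉ t C∉′)
        ...   | no _ | yes refl | _ = ⊥-elim (∈∉ t D∉′)
        ...   | no i≢C | no i≢D | k , y , o = ∩⁺ (─⁺ x (∉⁅⁆⁺ λ e → i≢D (sym e))) (tch⁺ y (occ⁺ (trans (row k i≢C) (proj₂ (occ⁻ o)))))
    by-α : α ∈ occ M z ⊎ α ∉ occ M z → ⊥
    by-α (inj₁ p) = at-α (at-z α∈I p)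
    by-α (inj₂ p) = κ {⁅ z ⁆} (⁅⁆⊆ z∈Z) (z , self∈ z) (¬∈ λ q → ∈∉ (tch⁅⁆⁻ q) p)
        (arith (# (I ∩ tch M ⁅ z ⁆)) (# (I ∩ occ M z)) (# (I ∩ has M z true)) (# (I ∩ has M z false)) (# ⁅ z ⁆)
           (#-mono λ q → let x , y = ∩⁻ {A = I} q in ∩⁺ x (tch⁅⁆⁻ y)) (#-literals I z true) (only true) (only false) (#⁅⁆ z))
      where
      arith : ∀ x y t f o → x ≤ y → t + f ≡ y → t ≤ 1 → f ≤ 1 → o ≡ 1 → x ≤ 1 + o
      arith x _ t f _ p refl q r refl = lin 0 (p ⊕ q ⊕ r) (solve (x ∷ t ∷ f ∷ []))

-- Contracting a set of variables to a single clause

-- α is the union of the restrictions to Z = V ─ Q of the clauses in K, stored in row i₀.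

record Contraction {c n} (M : Matrix c n) (I : Sub c) (V Q : Sub n) (K : Sub c) (i₀ : Fin c) : Set where
  R = I ─ tch M Q
  Z = V ─ Q
  T = R ∪ ⁅ i₀ ⁆
  field
    M′   : Matrix c n
    row  : ∀ {i} → i ∈ R → ∀ j → M′ i j ≡ M i j
    α⁺   : ∀ {i j s} → i ∈ K → j ∈ Z → i ∈ has M j s → i₀ ∈ has M′ j s
    α⁻   : ∀ {Y} → i₀ ∉ tch M′ Y → Y ⊆ Z → ∀ {i} → i ∈ K → i ∉ tch M Y
    lean : Lean M′ T Z
    #T   : # T ≤ 1 + # Z

-- If all clauses touched by Q but an arbitrary one in K can be satisfied on Q, then every model of
-- R falsifies these restrictions.

module Contract {c n} {M : Matrix c n} {I V Q} (K : Sub c) {i₀}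
  (unsat : Unsat M I V) (touched : ∀ {i} → i ∈ I → i ∈ tch M V) (Q⊆V : Q ⊆ V)
  (K-tch : K ⊆ tch M Q)
  (others : ∀ {i} → i ∈ K → (∀ a → (∀ {i′} → i′ ∈ I → i′ ∈ tch M Q → i′ ≢ i → Sat M a Q i′) → ⊥) → ⊥)
  (neZ : Nonempty (V ─ Q)) (card : # (I ─ tch M Q) ≤ # (V ─ Q))
  (hall₀ : ∀ {Y} → Y ⊆ V ─ Q → Nonempty Y → # Y ≤ # ((I ─ tch M Q) ∩ tch M Y))
  (hall₁ : ∀ {Y} → Y ⊆ V ─ Q → Nonempty Y → (∀ {i} → i ∈ K → i ∉ tch M Y) → 1 + # Y ≤ # ((I ─ tch M Q) ∩ tch M Y))
  (i₀∈K : i₀ ∈ K)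
  where

  Z = V ─ Q
  R = I ─ tch M Q
  T = R ∪ ⁅ i₀ ⁆

  Z⊆V : Z ⊆ V
  Z⊆V p = proj₁ (─⁻ {A = V} p)

  R-tch : ∀ {i} → i ∈ R → i ∈ tch M Z
  R-tch p = let q , r = ─⁻ {A = I} p in tch-─ (touched q) r

  i₀∉R : ∀ {i} → i ∈ R → i ≢ i₀
  i₀∉R p refl = ∈∉ (K-tch i₀∈K) (proj₂ (─⁻ {A = I} p))

  tail-falsified : ∀ {φ} → (∀ {i} → i ∈ R → Sat M φ Z i) → ∀ {i j s} → i ∈ K → j ∈ Z → i ∈ has M j s → φ j ≡ not s
  tail-falsified {φ} h {i} {j} {s} i∈K j∈Z i∋j with same? (φ j) s
  ... | inj₂ e = e
  ... | inj₁ e = ⊥-elim (others i∈K λ a ha → unsat (glue Q a φ) (sat a ha))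
    where
    off : ∀ {j} → j ∈ Z → j ∉ Q
    off p = proj₂ (─⁻ {A = V} p)
    sat : ∀ a → (∀ {i′} → i′ ∈ I → i′ ∈ tch M Q → i′ ≢ i → Sat M a Q i′) → ∀ {i′} → i′ ∈ I → Sat M (glue Q a φ) V i′
    sat a ha {i′} p with i′ ≟ i | ∈? (tch M Q) i′
    ... | yes refl | _ = Sat-mono Z⊆V (Sat-glueʳ off (via j j∈Z (trans (has⁻ i∋j) (cong just (sym e)))))
    ... | no ne | inj₁ t = Sat-mono Q⊆V (Sat-glueˡ (ha p t ne))
    ... | no ne | inj₂ t = Sat-mono Z⊆V (Sat-glueʳ off (h (─⁺ p t)))

  -- By `hall₀` the set `Z ─ V₁` uses up at least as many rows as it has variables. As |R| ≤ |Z|,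
  -- this leaves at most |V₁| rows inside `V₁`.
  R-satisfiable : (∀ φ → (∀ {i} → i ∈ R → Sat M φ Z i) → ⊥) → ⊥
  R-satisfiable = hall (# Z) {R} {Z} ≤-refl R-tch counts
    where
    counts : ∀ {V₁} → V₁ ⊆ Z → Nonempty V₁ → # (R ─ tch M (Z ─ V₁)) ≤ # V₁
    counts {V₁} f ne with nonempty? (Z ─ V₁)
    ... | inj₁ e = arith (# (R ─ tch M (Z ─ V₁))) (# R) (# Z) (# (Z ∩ V₁)) (# (Z ─ V₁)) (# V₁)
                     (#-mono λ p → proj₁ (─⁻ {A = R} p)) card (#-split Z V₁) (#-mono λ p → proj₂ (∩⁻ {A = Z} p)) e
      where
      arith : ∀ x r z w d v → x ≤ r → r ≤ z → w + d ≡ z → w ≤ v → d ≤ 0 → x ≤ v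
      arith x r _ w d v p q refl s t = lin 0 (p ⊕ q ⊕ s ⊕ t) (solve (x ∷ r ∷ w ∷ d ∷ v ∷ []))
    ... | inj₂ ne₂ = arith (# (R ─ tch M (Z ─ V₁))) (# R) (# Z) (# (Z ∩ V₁)) (# (Z ─ V₁)) (# V₁) (# (R ∩ tch M (Z ─ V₁)))
                     (#-split R (tch M (Z ─ V₁))) card (#-split Z V₁) (#-mono λ p → proj₂ (∩⁻ {A = Z} p)) (hall₀ (λ p → proj₁ (─⁻ {A = Z} p)) ne₂)
      where
      arith : ∀ x r z w d v t → t + x ≡ r → r ≤ z → w + d ≡ z → w ≤ v → d ≤ t → x ≤ v
      arith x _ _ w d v t refl q refl s p = lin 0 (q ⊕ s ⊕ p) (solve (x ∷ t ∷ w ∷ d ∷ v ∷ []))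

  module _ (φ : Fin n → Bool) (φ⊨R : ∀ {i} → i ∈ R → Sat M φ Z i) where

    -- Each restriction is falsified by `φ`, which therefore dictates all signs; the union has no
    -- internal clash.
    α : Fin n → Maybe Bool
    α j = if any (K ∩ occ M j) then just (not (φ j)) else nothing

    M′ : Matrix c n
    M′ i j = if ⁅ i₀ ⁆ i then α j else M i j

    row-α : ∀ j → M′ i₀ j ≡ α j
    row-α j rewrite holds (self∈ i₀) = refl

    row-R : ∀ {i} → i ∈ R → ∀ j → M′ i j ≡ M i j
    row-R {i} p j rewrite fails (∉⁅⁆⁺ {i = i₀} {i} (λ e → i₀∉R p (sym e))) = refl

    α⁺ : ∀ {i j s} → i ∈ K → j ∈ Z → i ∈ has M j s → i₀ ∈ has M′ j s
    α⁺ {i} {j} {s} i∈K j∈Z q = has⁺ (trans (row-α j) (eq (any⁺ (K ∩ occ M j) i (holds (∩⁺ i∈K (has⇒occ q))))))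
      where
      eq : any (K ∩ occ M j) ≡ true → α j ≡ just s
      eq e rewrite e = cong just (trans (cong not (tail-falsified φ⊨R i∈K j∈Z q)) (not-involutive s))

    α⁻ : ∀ {j s} → M′ i₀ j ≡ just s → s ≡ not (φ j) × ∃[ i ] i ∈ K × i ∈ occ M j
    α⁻ {j} {s} e with trans (sym (row-α j)) e
    ... | f with any (K ∩ occ M j) in g
    α⁻ {j} {s} e | refl | true with any⁻ (K ∩ occ M j) g
    ... | i , h = refl , i , ∩⁻ {A = K} (mem h)

    α-untouched : ∀ {Y} → i₀ ∉ tch M′ Y → Y ⊆ Z → ∀ {i} → i ∈ K → i ∉ tch M Y
    α-untouched {Y} p f {i} i∈K = ¬∈ λ q → let j , r , o = tch⁻ q in ∈∉ (tch⁺ r (occ⁺ (has⁻ (α⁺ i∈K (f r) (has⁺ (proj₂ (occ⁻ o))))))) p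

    T⁻ : ∀ {i} → i ∈ T → i ∈ R ⊎ i ≡ i₀
    T⁻ p with ∪⁻ {A = R} p
    ... | inj₁ q = inj₁ q
    ... | inj₂ q = inj₂ (sym (∈⁅⁆⁻ q))

    i₀∈T : i₀ ∈ T
    i₀∈T = ∪⁺ʳ {A = R} (self∈ i₀)

    row-tch : ∀ {i Y} → i ∈ R → i ∈ tch M Y → i ∈ tch M′ Y
    row-tch p q = let j , r , o = tch⁻ q in tch⁺ r (occ⁺ (trans (row-R p j) (proj₂ (occ⁻ o))))

    row-sat : ∀ {i a Y} → i ∈ R → Sat M′ a Y i → Sat M a Y i
    row-sat p (via j q e) = via j q (trans (sym (row-R p j)) e)

    #T : # T ≤ 1 + # Z
    #T = arith (# T) (# R) (# ⁅ i₀ ⁆) (# Z) (#-cover (∪⁻ {A = R})) (#⁅⁆ i₀) card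
      where
      arith : ∀ t r o z → t ≤ r + o → o ≡ 1 → r ≤ z → t ≤ 1 + z
      arith t r _ z p refl q = lin 0 (p ⊕ q) (solve (t ∷ r ∷ z ∷ []))

    -- Every model of `R` falsifies row `i₀`, whence unsatisfiability. For the count, a set `Y` that
    -- meets row `i₀` gains this row over `hall₀`, and a set that misses it gets the extra clause
    -- from `hall₁`.
    contract-lean : Lean M′ T Z
    contract-lean = leanFrom {I = T} unsat′ touched′ (λ p → p) counts
      where
      unsat′ : Unsat M′ T Z
      unsat′ a s with s i₀∈T
      ... | via j j∈Z e with α⁻ e
      ...   | f , i , i∈K , o with occ⁻ o
      ...     | s′ , e′ = clash (a j) (φ j) s′ f (tail-falsified φ⊨R i∈K j∈Z (has⁺ e′))
                          (tail-falsified (λ p → row-sat p (s (∪⁺ˡ p))) i∈K j∈Z (has⁺ e′))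
        where
        clash : ∀ x y z → x ≡ not y → y ≡ not z → x ≡ not z → ⊥
        clash true  true  _     () _ _
        clash true  false true  _ _ ()
        clash true  false false _ () _
        clash false false _     () _ _
        clash false true  true  _ () _
        clash false true  false _ _ ()
      touched′ : ∀ {i} → i ∈ T → i ∈ tch M′ Z
      touched′ p with T⁻ p
      ... | inj₁ q = row-tch q (R-tch q)
      ... | inj₂ refl = ¬∉ λ r → absurd≤ (≤-trans (hall₁ (λ q → q) neZ (α-untouched r (λ q → q)))
                          (≤-trans (#-mono λ q → proj₁ (∩⁻ {A = R} q)) card))
      counts : ∀ {Y} → Y ⊆ Z → Nonempty Y → Nonempty (Z ─ Y) → # T ≤ # (T ∩ tch M′ Y) + # (Z ─ Y)
      counts {Y} f ne _ = arith (# T) (# Z) (# (Z ∩ Y)) (# (Z ─ Y)) (# Y) (# (T ∩ tch M′ Y)) #T (#-split Z Y) (#-mono λ p → proj₂ (∩⁻ {A = Z} p)) enough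
        where
        arith : ∀ t z w d y x → t ≤ 1 + z → w + d ≡ z → w ≤ y → 1 + y ≤ x → t ≤ x + d
        arith t _ w d y x p refl q r = lin 0 (p ⊕ q ⊕ r) (solve (t ∷ w ∷ d ∷ y ∷ x ∷ []))
        incl : R ∩ tch M Y ⊆ T ∩ tch M′ Y
        incl p = let q , r = ∩⁻ {A = R} p in ∩⁺ (∪⁺ˡ q) (row-tch q r)
        enough : 1 + # Y ≤ # (T ∩ tch M′ Y)
        enough with ∈? (tch M′ Y) i₀
        ... | inj₂ p = ≤-trans (hall₁ f ne (α-untouched p f)) (#-mono incl)
        ... | inj₁ p = count (# Y) (# (R ∩ tch M Y)) (# ⁅ i₀ ⁆) (# (T ∩ tch M′ Y)) (hall₀ f ne) (#⁅⁆ i₀)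
                         (#-disj incl (⁅⁆⊆ (∩⁺ i₀∈T p)) λ q r → i₀∉R (proj₁ (∩⁻ {A = R} q)) (sym (∈⁅⁆⁻ r)))
          where
          count : ∀ y x o t → y ≤ x → o ≡ 1 → x + o ≤ t → 1 + y ≤ t
          count y x _ t p refl q = lin 0 (p ⊕ q) (solve (y ∷ x ∷ t ∷ []))

  contract : (Contraction M I V Q K i₀ → ⊥) → ⊥
  contract κ = R-satisfiable λ φ φ⊨R → κ record
    { M′ = M′ φ φ⊨R ; row = row-R φ φ⊨R ; α⁺ = α⁺ φ φ⊨R ; α⁻ = α-untouched φ φ⊨R
    ; lean = contract-lean φ φ⊨R ; #T = #T φ φ⊨R }

-- Degrees at least 9, and the cores left by a 5-side

module _ {c n} {M : Matrix c n} where

  degree-cover : ∀ {I v b w} → # (I ∩ occ M w) ≤ # (I ∩ has M v b) + # ((I ─ has M v b) ∩ occ M w)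
  degree-cover {I} {v} {b} {w} = #-cover λ {i} p → let q , r = ∩⁻ {A = I} p in go q r (∈? (has M v b) i)
    where
    go : ∀ {i} → i ∈ I → i ∈ occ M w → i ∈ has M v b ⊎ i ∉ has M v b → i ∈ I ∩ has M v b ⊎ i ∈ (I ─ has M v b) ∩ occ M w
    go p q (inj₁ r) = inj₁ (∩⁺ p r)
    go p q (inj₂ r) = inj₂ (∩⁺ (─⁺ p r) q)

  -- Removing the clauses with a literal that occurs k times leaves deficiency 1.

  no-full-literal : ∀ {k I V v} → Critical M k I V → v ∈ V → ∀ b → k ≤ 6 → k ≤ # (I ∩ has M v b) →
    (∀ {w} → w ∈ V → 9 ≤ # (I ∩ occ M w)) → Nonempty (V ─ ⁅ v ⁆) → ⊥
  no-full-literal {k} {I} {V} {v} C p b k≤6 h d ne′ = lean-1 {I = I ─ has M v b} (Split.rest-lean C p b ne′) ne′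
      (arith (# (I ∩ has M v b)) (# (I ─ has M v b)) (# (V ─ ⁅ v ⁆)) _ (Split.rest-card C p b) h (#-mono λ q → proj₁ (∩⁻ {A = I ─ has M v b} q)))
      -- Every other variable keeps at least 9 - 6 = 3 occurrences.
      λ {w} q → count (# (I ∩ occ M w)) (# (I ∩ has M v b)) _ (d (proj₁ (─⁻ {A = V} q))) (degree-cover {I} {v} {b} {w}) (Split.literal≤ C p b ne′) k≤6
    where
    arith : ∀ x y z t → x + y ≡ suc k + z → k ≤ x → t ≤ y → t ≤ 1 + z
    arith x y z t p q r = lin 0 (eq≤ p ⊕ q ⊕ r) (solve (x ∷ y ∷ z ∷ t ∷ k ∷ []))
    count : ∀ x l y → 9 ≤ x → x ≤ l + y → l ≤ k → k ≤ 6 → 3 ≤ y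
    count x l y p q r s = lin 0 (p ⊕ q ⊕ r ⊕ s) (solve (x ∷ l ∷ y ∷ k ∷ []))

  two-variables : ∀ {k I V v} → Critical M k I V → k ≤ 6 → v ∈ V → (∀ {w} → w ∈ V → 9 ≤ # (I ∩ occ M w)) → Nonempty (V ─ ⁅ v ⁆)
  two-variables {k} {I} {V} {v} C k≤6 p d with nonempty? (V ─ ⁅ v ⁆)
  ... | inj₂ ne = ne
  ... | inj₁ e  = ⊥-elim (arith (≤-trans (d p) (≤-trans (Split.degree-single C p e) (s≤s k≤6))))
    where
    arith : 9 ≤ 7 → ⊥
    arith (s≤s (s≤s (s≤s (s≤s (s≤s (s≤s (s≤s ())))))))

  -- Of nine occurrences one sign has at least five, hence at least `k`, and `no-full-literal`
  -- applies.
  critical-5 : ∀ {k I V} → Critical M k I V → k ≤ 5 → (∀ {w} → w ∈ V → 9 ≤ # (I ∩ occ M w)) → ⊥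
  critical-5 {k} {I} {V} C k≤5 d with Critical.ne C
  ... | v , p with k ≤? # (I ∩ has M v true)
  ...   | yes q = no-full-literal C p true (≤-trans k≤5 (n≤1+n 5)) q d (two-variables C (≤-trans k≤5 (n≤1+n 5)) p d)
  ...   | no ¬q = no-full-literal C p false (≤-trans k≤5 (n≤1+n 5))
                    (arith (# (I ∩ has M v true)) (# (I ∩ has M v false)) _ (≰⇒> ¬q) (#-literals I v true) (d p)) d (two-variables C (≤-trans k≤5 (n≤1+n 5)) p d)
    where
    arith : ∀ x y t → suc x ≤ k → x + y ≡ t → 9 ≤ t → k ≤ y
    arith x y _ p refl q = lin 0 (p ⊕ q ⊕ k≤5 ⊕ k≤5) (solve (x ∷ y ∷ k ∷ []))

-- The 5-side of v are its occurrences with sign b; without them a critical clause-set of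
-- deficiency 2 remains on Q, all of whose variables occur in every clause of the 5-side.

record Core {c n} (M : Matrix c n) (I : Sub c) (V : Sub n) (v : Fin n) : Set where
  field
    b      : Bool
    v∈V    : v ∈ V
    five   : # (I ∩ has M v b) ≡ 5
    Q      : Sub n
    Q⊆V    : Q ⊆ V
    v∉Q    : v ∉ Q
    crit   : Critical M 2 ((I ─ has M v b) ∩ tch M Q) Q

module Six {c n} {M : Matrix c n} {I V} (G : Critical M 6 I V) (deg≥9 : ∀ {w} → w ∈ V → 9 ≤ # (I ∩ occ M w)) where
  open Critical G public

  others : ∀ {v} → v ∈ V → Nonempty (V ─ ⁅ v ⁆)
  others p = two-variables G ≤-refl p deg≥9

  -- Six occurrences are excluded by `no-full-literal`. Removing exactly five clauses leaves surplus
  -- 7 - 5 = 2, and surplus 1 is impossible since all degrees are still at least 9 - 5.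
  core-side : ∀ {v} → v ∈ V → (Core M I V v → ⊥) → ∀ b → 5 ≤ # (I ∩ has M v b) → ⊥
  core-side {v} p κ b q with 6 ≤? # (I ∩ has M v b)
  ... | yes r = no-full-literal G p b ≤-refl r deg≥9 (others p)
  ... | no ¬r = critical (2 + # (V ─ ⁅ v ⁆)) {I ─ has M v b} {V ─ ⁅ v ⁆} {2} ≤-refl (Split.rest-lean G p b (others p)) (others p)
                  (arith (# (I ∩ has M v b)) (# (I ─ has M v b)) _ _ (Split.rest-card G p b) q (#-mono λ s → proj₁ (∩⁻ {A = I ─ has M v b} s))) found
    where
    arith : ∀ x y z t → x + y ≡ 7 + z → 5 ≤ x → t ≤ y → t ≤ 2 + z
    arith x y z t p q r = lin 0 (eq≤ p ⊕ q ⊕ r) (solve (x ∷ y ∷ z ∷ t ∷ []))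
    found : ∀ {k′ Q} → 1 ≤ k′ → k′ ≤ 2 → Q ⊆ V ─ ⁅ v ⁆ → Critical M k′ ((I ─ has M v b) ∩ tch M Q) Q → ⊥
    found {suc zero} {Q} _ _ f K = critical-1 K λ {w} s → count (# (I ∩ occ M w)) (# (I ∩ has M v b)) _ _ (deg≥9 (proj₁ (─⁻ {A = V} (f s)))) (degree-cover {I = I} {v} {b} {w})
                                     (≰⇒> ¬r) (degree-tch {I = I ─ has M v b} s)
      where
      count : ∀ x l y z → 9 ≤ x → x ≤ l + y → suc l ≤ 6 → y ≤ z → 3 ≤ z
      count x l y z p q r s = lin 1 (p ⊕ q ⊕ r ⊕ s) (solve (x ∷ l ∷ y ∷ z ∷ []))
    found {suc (suc zero)} {Q} _ _ f K = κ record
      { b = b ; v∈V = p ; five = ≤-antisym (pred (≰⇒> ¬r)) q ; Q = Q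
      ; Q⊆V = λ s → proj₁ (─⁻ {A = V} (f s))
      ; v∉Q = ¬∈ λ s → ∉⁅⁆⁻ (proj₂ (─⁻ {A = V} (f s))) refl
      ; crit = K }
      where
      pred : ∀ {x y} → suc x ≤ suc y → x ≤ y
      pred (s≤s x) = x
    found {suc (suc (suc _))} _ (s≤s (s≤s ()))

  core : ∀ {v} → v ∈ V → (Core M I V v → ⊥) → ⊥
  core {v} p κ with 5 ≤? # (I ∩ has M v true)
  ... | yes q = core-side p κ true q
  ... | no ¬q = core-side p κ false (arith (# (I ∩ has M v true)) (# (I ∩ has M v false)) _ (≰⇒> ¬q) (#-literals I v true) (deg≥9 p))
    where
    arith : ∀ x y t → suc x ≤ 5 → x + y ≡ t → 9 ≤ t → 5 ≤ y
    arith x y _ p refl q = lin 0 (p ⊕ q) (solve (x ∷ y ∷ []))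

  module OfCore {v} (K : Core M I V v) where
    open Core K public

    K₂ = (I ─ has M v b) ∩ tch M Q

    K₂⁻ : ∀ {i} → i ∈ K₂ → i ∈ I × i ∉ has M v b × i ∈ tch M Q
    K₂⁻ p with ∩⁻ {A = I ─ has M v b} p
    ... | q , r with ─⁻ {A = I} q
    ...   | s , t = s , t , r

    K₂⁺ : ∀ {i} → i ∈ I → i ∉ has M v b → i ∈ tch M Q → i ∈ K₂
    K₂⁺ p q r = ∩⁺ (─⁺ p q) r

    ∈Q⇒≢ : ∀ {q} → q ∈ Q → q ≢ v
    ∈Q⇒≢ p refl = ∈∉ p v∉Q

    degK≥4 : ∀ {q} → q ∈ Q → 4 ≤ # (K₂ ∩ occ M q)
    degK≥4 {q} p = arith (# (I ∩ occ M q)) (# (I ∩ has M v b)) _ _ (deg≥9 (Q⊆V p)) (degree-cover {I = I} {v} {b} {q}) five (degree-tch {I = I ─ has M v b} p)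
      where
      arith : ∀ x l y z → 9 ≤ x → x ≤ l + y → l ≡ 5 → y ≤ z → 4 ≤ z
      arith x _ y z p q refl r = lin 0 (p ⊕ q ⊕ r) (solve (x ∷ y ∷ z ∷ []))

    open Critical₂ crit degK≥4 public
      using (literal≡2; degree≡4; clashing-pair; satisfy-others) renaming (others to others-Q)

    degree-split : ∀ {q} → q ∈ Q → # (I ∩ occ M q) ≤ # ((I ∩ has M v b) ∩ occ M q) + # (K₂ ∩ occ M q)
    degree-split {q} p = #-cover cover
      where
      cover : ∀ {i} → i ∈ I ∩ occ M q → i ∈ (I ∩ has M v b) ∩ occ M q ⊎ i ∈ K₂ ∩ occ M q
      cover {i} r with ∩⁻ {A = I} r | ∈? (has M v b) i
      ... | s , t | inj₁ u = inj₁ (∩⁺ (∩⁺ s u) t)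
      ... | s , t | inj₂ u = inj₂ (∩⁺ (K₂⁺ s u (tch⁺ p t)) t)

    -- Only four of the nine or more occurrences of `q` are in `K₂`; the rest must exhaust the
    -- 5-side.
    five-full : ∀ {q i} → q ∈ Q → i ∈ I → i ∈ has M v b → i ∈ occ M q
    five-full {q} p r s = proj₂ (∩⁻ {A = I ∩ has M v b} (#-full {A = (I ∩ has M v b) ∩ occ M q} {I ∩ has M v b} (λ t → proj₁ (∩⁻ {A = I ∩ has M v b} t))
        (arith (# (I ∩ occ M q)) _ _ _ (deg≥9 (Q⊆V p)) (degree-split p) (degree≡4 p) five) (∩⁺ r s)))
      where
      arith : ∀ x y z f → 9 ≤ x → x ≤ y + z → z ≡ 4 → f ≡ 5 → f ≤ y
      arith x y _ _ p q refl refl = lin 0 (p ⊕ q) (solve (x ∷ y ∷ []))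

    degree≤9 : ∀ {q} → q ∈ Q → # (I ∩ occ M q) ≤ 9
    degree≤9 {q} p = arith (# (I ∩ occ M q)) _ _ _ (degree-split p) (#-mono λ r → proj₁ (∩⁻ {A = I ∩ has M v b} r)) (degree≡4 p) five
      where
      arith : ∀ x y z f → x ≤ y + z → y ≤ f → z ≡ 4 → f ≡ 5 → x ≤ 9
      arith x y _ _ p q refl refl = lin 0 (p ⊕ q) (solve (x ∷ y ∷ []))

    five-tch : ∀ {S i} → S ⊆ Q → Nonempty S → i ∈ I → i ∈ has M v b → i ∈ tch M S
    five-tch f (q , q∈S) p r = tch⁺ q∈S (five-full (f q∈S) p r)

    top : # (I ∩ tch M Q) ≤ 7 + # Q
    top = arith (# (I ∩ tch M Q)) _ _ (# Q) (#-cover cover) five (Critical.card crit)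
      where
      cover : ∀ {i} → i ∈ I ∩ tch M Q → i ∈ I ∩ has M v b ⊎ i ∈ K₂
      cover {i} r with ∩⁻ {A = I} r | ∈? (has M v b) i
      ... | s , t | inj₁ u = inj₁ (∩⁺ s u)
      ... | s , t | inj₂ u = inj₂ (K₂⁺ s u t)
      arith : ∀ x f k q → x ≤ f + k → f ≡ 5 → k ≡ 2 + q → x ≤ 7 + q
      arith x _ _ q p refl refl = lin 0 p (solve (x ∷ q ∷ []))

    -- The 5-side touches every nonempty subset of `Q` and so adds 5 to the surplus 3 of a proper
    -- subset within `K₂`. The gap between this 8 and the 7 of `top` drives the submodularity
    -- argument.
    near : ∀ {S} → S ⊆ Q → Nonempty S → Nonempty (Q ─ S) → 8 + # S ≤ # (I ∩ tch M S)
    near {S} f ne ne′ = arith _ _ (# S) _ (#-disj {A = I ∩ has M v b} {K₂ ∩ tch M S} {I ∩ tch M S}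
        (λ p → let q , r = ∩⁻ {A = I} p in ∩⁺ q (five-tch f ne q r)) (λ p → let q , r = ∩⁻ {A = K₂} p in ∩⁺ (proj₁ (K₂⁻ q)) r)
        (λ p q → ∈∉ (proj₂ (∩⁻ {A = I} p)) (proj₁ (proj₂ (K₂⁻ (proj₁ (∩⁻ {A = K₂} q))))))) five (Critical.proper crit f ne ne′)
      where
      arith : ∀ f k s t → f + k ≤ t → f ≡ 5 → 3 + s ≤ k → 8 + s ≤ t
      arith _ k s t p refl q = lin 0 (p ⊕ q) (solve (k ∷ s ∷ t ∷ []))

    rest-lean : Lean M (I ─ has M v b) (V ─ ⁅ v ⁆)
    rest-lean = Split.rest-lean G v∈V b (others v∈V)

    Q⊆rest : Q ⊆ V ─ ⁅ v ⁆
    Q⊆rest p = ─⁺ (Q⊆V p) (∉⁅⁆⁺ λ { refl → ∈∉ p v∉Q })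

-- Two neighbouring cores

few : ∀ {n} {T A B C D : Sub n} → (∀ {i} → i ∈ T → i ∈ A ⊎ i ∈ B) → (∀ {i} → i ∈ T → i ∈ C ⊎ i ∈ D) → # (T ∩ B) ≤ 1 →
  ((∀ {i} → i ∈ T → i ∈ A ⊎ i ∈ C) → ⊥) → ((∀ {i} → i ∈ T → i ∈ A ⊎ i ∈ D) → ⊥) → ⊥
few {T = T} {A} {B} {C} {D} ab cd p ac ad with nonempty? (T ∩ B)
... | inj₁ z = ac λ q → side q (ab q)
  where
  side : ∀ {i} → i ∈ T → i ∈ A ⊎ i ∈ B → i ∈ A ⊎ i ∈ C
  side q (inj₁ r) = inj₁ r
  side q (inj₂ r) = ⊥-elim (#≤0 z (∩⁺ q r))
... | inj₂ (i₀ , r₀) = choose (cd (proj₁ (∩⁻ {A = T} r₀)))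
  where
  side : ∀ {E i} → i₀ ∈ E → i ∈ T → i ∈ A ⊎ i ∈ B → i ∈ A ⊎ i ∈ E
  side e q (inj₁ r) = inj₁ r
  side {E} e q (inj₂ r) = inj₂ (subst (_∈ E) (#≤1 p r₀ (∩⁺ q r)) e)
  choose : i₀ ∈ C ⊎ i₀ ∈ D → ⊥
  choose (inj₁ e) = ac λ q → side e q (ab q)
  choose (inj₂ e) = ad λ q → side e q (ab q)

-- One of `A` and `B` contains all but at most one of the three elements, and that one decides
-- between `C` and `D`. Applied to four pairs of models and the clauses common to two 5-sides.
cover-three : ∀ {n} {T A B C D : Sub n} → (∀ {i} → i ∈ T → i ∈ A ⊎ i ∈ B) → (∀ {i} → i ∈ A → i ∈ B → ⊥) →
  (∀ {i} → i ∈ T → i ∈ C ⊎ i ∈ D) → # T ≤ 3 →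
  ((∀ {i} → i ∈ T → i ∈ A ⊎ i ∈ C) → ⊥) → ((∀ {i} → i ∈ T → i ∈ A ⊎ i ∈ D) → ⊥) →
  ((∀ {i} → i ∈ T → i ∈ B ⊎ i ∈ C) → ⊥) → ((∀ {i} → i ∈ T → i ∈ B ⊎ i ∈ D) → ⊥) → ⊥
cover-three {T = T} {A} {B} ab disj cd h ac ad bc bd with # (T ∩ B) ≤? 1
... | yes p = few ab cd p ac ad
... | no ¬p = few (λ q → swap (ab q)) cd (arith (# (T ∩ A)) (# (T ∩ B)) (# T)
                (#-disj (λ q → proj₁ (∩⁻ {A = T} q)) (λ q → proj₁ (∩⁻ {A = T} q)) λ q r → disj (proj₂ (∩⁻ {A = T} q)) (proj₂ (∩⁻ {A = T} r)))
                h (≰⇒> ¬p)) bc bd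
  where
  arith : ∀ x y t → x + y ≤ t → t ≤ 3 → 2 ≤ y → x ≤ 1
  arith x y t p q r = lin 0 (p ⊕ q ⊕ r) (solve (x ∷ y ∷ t ∷ []))

module Neighbours {c n} {M : Matrix c n} {I V} (G : Critical M 6 I V) (deg≥9 : ∀ {w} → w ∈ V → 9 ≤ # (I ∩ occ M w)) where
  open Six G deg≥9

  module _ {v u} (Kv : Core M I V v) (Ku : Core M I V u) (u∈Q : u ∈ Core.Q Kv) where
    private
      module A = OfCore Kv
      module B = OfCore Ku

    Q = A.Q
    P = B.Q
    H = I ─ has M v A.b

    shared≤3 : ∀ {X₄ X₅} → X₄ ∈ B.K₂ → X₄ ∈ has M v A.b → X₅ ∈ B.K₂ → X₅ ∈ has M v A.b → X₄ ≢ X₅ → # ((I ∩ has M v A.b) ∩ has M u B.b) ≤ 3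
    shared≤3 {X₄} {X₅} p q r s ne = arith (# ((I ∩ has M v A.b) ∩ has M u B.b)) (# ((I ∩ has M v A.b) ─ has M u B.b)) _
        (#-split (I ∩ has M v A.b) (has M u B.b)) A.five
        (#≥2 {A = (I ∩ has M v A.b) ─ has M u B.b} (inside p q) (inside r s) ne)
      where
      inside : ∀ {X} → X ∈ B.K₂ → X ∈ has M v A.b → X ∈ (I ∩ has M v A.b) ─ has M u B.b
      inside p q = let x , y , _ = B.K₂⁻ p in ─⁺ (∩⁺ x q) y
      arith : ∀ x y t → x + y ≡ t → t ≡ 5 → 2 ≤ y → x ≤ 3
      arith x y _ p refl q = lin 0 (eq≤ p ⊕ q) (solve (x ∷ y ∷ []))

    -- v = 0 and u = 0 satisfies all clauses on exactly one of the two 5-sides.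

    disjoint-mutual : (∀ {j} → j ∈ Q → j ∈ P → ⊥) → v ∈ P → ⊥
    disjoint-mutual disj v∈P =
      -- The two models on `Q` differ at `w`, as each falsifies the clause it omits; likewise those
      -- on `P` at `y`. The clauses on both 5-sides contain `w` and `y` and number at most three, so
      -- some pair of models satisfies them all.
      A.clashing-pair B.b u∈Q λ {A₁} {A₂} {w} A₁∈ A₁∋u A₂∈ A₂∋u w∈Q _ A₁∋w A₂∌w →
      B.clashing-pair A.b v∈P λ {X₄} {X₅} {y} X₄∈ X₄∋v X₅∈ X₅∋v y∈P _ X₄∋y X₅∌y →
      A.satisfy-others A₁∈ λ ψ₁ ψ₁-sat ψ₁-fal →
      A.satisfy-others A₂∈ λ ψ₂ ψ₂-sat ψ₂-fal →
      B.satisfy-others X₄∈ λ χ₁ χ₁-sat χ₁-fal →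
      B.satisfy-others X₅∈ λ χ₂ χ₂-sat χ₂-fal →
      let at-w = λ {i} (p : i ∈ T) → let q , r = ∩⁻ {A = I ∩ has M v A.b} p ; s , t = ∩⁻ {A = I} q in split-occ {M = M} false (A.five-full w∈Q s t)
          at-y = λ {i} (p : i ∈ T) → let q , r = ∩⁻ {A = I ∩ has M v A.b} p ; s , t = ∩⁻ {A = I} q in split-occ {M = M} false (B.five-full y∈P s r)
      in cover-three {T = T} {has M w false} {has M w true} {has M y false} {has M y true} at-w (λ p q → has-clash p q) at-y
           (shared≤3 X₄∈ X₄∋v X₅∈ X₅∋v (λ { refl → has-clash X₄∋y X₅∌y }))
           (λ f → finish A₁∋u X₄∋v ψ₁-sat (ψ₁-fal u∈Q A₁∋u) χ₁-sat (χ₁-fal v∈P X₄∋v) (λ p → value w∈Q y∈P (ψ₁-fal w∈Q A₁∋w) (χ₁-fal y∈P X₄∋y) (f p)))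
           (λ f → finish A₁∋u X₅∋v ψ₁-sat (ψ₁-fal u∈Q A₁∋u) χ₂-sat (χ₂-fal v∈P X₅∋v) (λ p → value w∈Q y∈P (ψ₁-fal w∈Q A₁∋w) (χ₂-fal y∈P X₅∌y) (f p)))
           (λ f → finish A₂∋u X₄∋v ψ₂-sat (ψ₂-fal u∈Q A₂∋u) χ₁-sat (χ₁-fal v∈P X₄∋v) (λ p → value w∈Q y∈P (ψ₂-fal w∈Q A₂∌w) (χ₁-fal y∈P X₄∋y) (f p)))
           (λ f → finish A₂∋u X₅∋v ψ₂-sat (ψ₂-fal u∈Q A₂∋u) χ₂-sat (χ₂-fal v∈P X₅∋v) (λ p → value w∈Q y∈P (ψ₂-fal w∈Q A₂∌w) (χ₂-fal y∈P X₅∌y) (f p)))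
      where
      T = (I ∩ has M v A.b) ∩ has M u B.b
      split-occ : ∀ {c n} {M : Matrix c n} b {i j} → i ∈ occ M j → i ∈ has M j b ⊎ i ∈ has M j (not b)
      split-occ {M = M} b {i} {j} p with ∈? (has M j b) i
      ... | inj₁ q = inj₁ q
      ... | inj₂ q = inj₂ (occ⇒has p q)
      value : ∀ {w y s t ψ χ i} → w ∈ Q → y ∈ P → ψ w ≡ s → χ y ≡ t → i ∈ has M w s ⊎ i ∈ has M y t → Sat M ψ Q i ⊎ Sat M χ P i
      value p q refl refl (inj₁ r) = inj₁ (via _ p (has⁻ r))
      value p q refl refl (inj₂ r) = inj₂ (via _ q (has⁻ r))
      finish : ∀ {A₀ X₀ ψ χ} → A₀ ∈ has M u B.b → X₀ ∈ has M v A.b →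
        (∀ {i} → i ∈ A.K₂ → i ≢ A₀ → Sat M ψ Q i) → ψ u ≡ not B.b →
        (∀ {i} → i ∈ B.K₂ → i ≢ X₀ → Sat M χ P i) → χ v ≡ not A.b →
        (∀ {i} → i ∈ T → Sat M ψ Q i ⊎ Sat M χ P i) → ⊥
      finish {A₀} {X₀} {ψ} {χ} A₀∋u X₀∋v ψ-sat ψu χ-sat χv three =
        lean (glue Q ψ χ) (λ p → union (∪⁻ {A = Q} p)) (u , ∪⁺ˡ u∈Q) λ {i} p t → sat p (tch⁻ t) (∈? (has M v A.b) i) (∈? (has M u B.b) i)
        where
        union : ∀ {j} → j ∈ Q ⊎ j ∈ P → j ∈ V
        union (inj₁ p) = A.Q⊆V p
        union (inj₂ p) = B.Q⊆V p
        byψ : ∀ {i} → Sat M ψ Q i → Sat M (glue Q ψ χ) (Q ∪ P) i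
        byψ s = Sat-mono ∪⁺ˡ (Sat-glueˡ s)
        byχ : ∀ {i} → Sat M χ P i → Sat M (glue Q ψ χ) (Q ∪ P) i
        byχ s = Sat-mono (∪⁺ʳ {A = Q}) (Sat-glueʳ (λ p → ¬∈ λ q → disj q p) s)
        sat : ∀ {i} → i ∈ I → ∃[ j ] j ∈ Q ∪ P × i ∈ occ M j → i ∈ has M v A.b ⊎ i ∉ has M v A.b → i ∈ has M u B.b ⊎ i ∉ has M u B.b →
              Sat M (glue Q ψ χ) (Q ∪ P) i
        sat p _ (inj₁ q) (inj₁ r) with three (∩⁺ (∩⁺ p q) r)
        ... | inj₁ s = byψ s
        ... | inj₂ s = byχ s
        sat p _ (inj₁ q) (inj₂ r) = byψ (via u u∈Q (trans (has⁻ (occ⇒has (A.five-full u∈Q p q) r)) (cong just (sym ψu))))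
        sat p _ (inj₂ q) (inj₁ r) = byχ (via v v∈P (trans (has⁻ (occ⇒has (B.five-full v∈P p r) q)) (cong just (sym χv))))
        sat p (j , j∈ , o) (inj₂ q) (inj₂ r) with ∪⁻ {A = Q} j∈
        ... | inj₁ s = byψ (ψ-sat (A.K₂⁺ p q (tch⁺ s o)) λ { refl → ∈∉ A₀∋u r })
        ... | inj₂ s = byχ (χ-sat (B.K₂⁺ p r (tch⁺ s o)) λ { refl → ∈∉ X₀∋v q })

    H-card : # H ≡ 2 + # (V ─ ⁅ v ⁆)
    H-card = arith (# (I ∩ has M v A.b)) (# H) _ (Split.rest-card G A.v∈V A.b) A.five
      where
      arith : ∀ x y z → x + y ≡ 7 + z → x ≡ 5 → y ≡ 2 + z
      arith _ y z p refl = +-cancelˡ-≡ 5 y (2 + z) p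

    H-tch : ∀ {S} → # (I ∩ tch M S) ≤ 5 + # (H ∩ tch M S)
    H-tch {S} = subst (λ f → # (I ∩ tch M S) ≤ f + # (H ∩ tch M S)) A.five (#-cover λ {i} p → let q , r = ∩⁻ {A = I} p in go q r (∈? (has M v A.b) i))
      where
      go : ∀ {i} → i ∈ I → i ∈ tch M S → i ∈ has M v A.b ⊎ i ∉ has M v A.b → i ∈ I ∩ has M v A.b ⊎ i ∈ H ∩ tch M S
      go p q (inj₁ r) = inj₁ (∩⁺ p r)
      go p q (inj₂ r) = inj₂ (∩⁺ (─⁺ p r) q)

    -- Contracting `Q` in `H` yields a tree on a set containing `P`. At a lowest `p` in `P` the
    -- clashing pairs for `Q(u)` cannot survive, so for either sign of `p` one clause of the pair
    -- lies on the 5-side of `v`, which `H` omits.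
    disjoint-apart : (∀ {j} → j ∈ Q → j ∈ P → ⊥) → v ∉ P → ⊥
    disjoint-apart disj v∉P = start (pick A.K₂ (subst (1 ≤_) (sym (Critical.card A.crit)) (s≤s z≤n)))
      where
      V′ = V ─ ⁅ v ⁆
      P⊆V′ : P ⊆ V′
      P⊆V′ p = ─⁺ (B.Q⊆V p) (∉⁅⁆⁺ λ { refl → ∈∉ p v∉P })
      P⊆Z : P ⊆ V′ ─ Q
      P⊆Z p = ─⁺ (P⊆V′ p) (¬∈ λ q → disj q p)
      K-others : ∀ {i} → i ∈ A.K₂ → (∀ a → (∀ {i′} → i′ ∈ H → i′ ∈ tch M Q → i′ ≢ i → Sat M a Q i′) → ⊥) → ⊥
      K-others p κ = A.satisfy-others p λ a h _ → κ a λ q r ne → h (∩⁺ q r) ne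
      card′ : # (H ─ tch M Q) ≤ # (V′ ─ Q)
      card′ = arith (# (H ─ tch M Q)) (# A.K₂) (# H) (# V′) (# (V′ ∩ Q)) (# Q) (# (V′ ─ Q)) (#-split H (tch M Q)) H-card (Critical.card A.crit)
                (#-split V′ Q) (#-mono λ p → proj₂ (∩⁻ {A = V′} p))
        where
        arith : ∀ r k h v w q z → k + r ≡ h → h ≡ 2 + v → k ≡ 2 + q → w + z ≡ v → w ≤ q → r ≤ z
        arith r _ _ _ w q z p refl refl refl s = lin 0 (eq≤ p ⊕ s) (solve (r ∷ w ∷ q ∷ z ∷ []))
      -- `Q ∪ Y` is proper as it misses `v`. Of its 7 + |Q| + |Y| clauses at most 5 are on the
      -- 5-side and 2 + |Q| in `K₂`.
      hall₀ : ∀ {Y} → Y ⊆ V′ ─ Q → Nonempty Y → # Y ≤ # ((H ─ tch M Q) ∩ tch M Y)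
      hall₀ {Y} f ne = arith (# Y) (# Q) (# (Q ∪ Y)) (# (I ∩ tch M (Q ∪ Y))) (# (H ∩ tch M (Q ∪ Y))) (# A.K₂) (# ((H ─ tch M Q) ∩ tch M Y))
          (#-disj ∪⁺ˡ (∪⁺ʳ {A = Q}) (λ p q → ∈∉ p (proj₂ (─⁻ {A = V′} (f q)))))
          (proper sub (proj₁ (Critical.ne A.crit) , ∪⁺ˡ (proj₂ (Critical.ne A.crit))) (v , ─⁺ A.v∈V (¬∈ λ p → v∉ (∪⁻ {A = Q} p)))) H-tch (#-cover cover) (Critical.card A.crit)
        where
        arith : ∀ y q u t h k x → q + y ≤ u → 7 + u ≤ t → t ≤ 5 + h → h ≤ k + x → k ≡ 2 + q → y ≤ x
        arith y q u t h _ x p o r s refl = lin 0 (p ⊕ o ⊕ r ⊕ s) (solve (y ∷ q ∷ u ∷ t ∷ h ∷ x ∷ []))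
        sub : Q ∪ Y ⊆ V
        sub p with ∪⁻ {A = Q} p
        ... | inj₁ q = A.Q⊆V q
        ... | inj₂ q = proj₁ (─⁻ {A = V} (proj₁ (─⁻ {A = V′} (f q))))
        v∉ : v ∈ Q ⊎ v ∈ Y → ⊥
        v∉ (inj₁ q) = ∈∉ q A.v∉Q
        v∉ (inj₂ q) = ∉⁅⁆⁻ (proj₂ (─⁻ {A = V} (proj₁ (─⁻ {A = V′} (f q))))) refl
        cover : ∀ {i} → i ∈ H ∩ tch M (Q ∪ Y) → i ∈ A.K₂ ⊎ i ∈ (H ─ tch M Q) ∩ tch M Y
        cover {i} p with ∩⁻ {A = H} p | ∈? (tch M Q) i
        ... | h , t | inj₁ q = inj₁ (∩⁺ h q)
        ... | h , t | inj₂ q with tch⁻ t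
        ...   | j , r , o with ∪⁻ {A = Q} r
        ...     | inj₁ s = ⊥-elim (∈∉ (tch⁺ s o) q)
        ...     | inj₂ s = inj₂ (∩⁺ (─⁺ h q) (tch⁺ s o))
      hall₁ : ∀ {Y} → Y ⊆ V′ ─ Q → Nonempty Y → (∀ {i} → i ∈ A.K₂ → i ∉ tch M Y) → 1 + # Y ≤ # ((H ─ tch M Q) ∩ tch M Y)
      hall₁ {Y} f ne h = arith (# Y) (# (I ∩ tch M Y)) _ _
          (proper (λ p → proj₁ (─⁻ {A = V} (proj₁ (─⁻ {A = V′} (f p))))) ne
             (v , ─⁺ A.v∈V (¬∈ λ p → ∉⁅⁆⁻ (proj₂ (─⁻ {A = V} (proj₁ (─⁻ {A = V′} (f p))))) refl)))
          H-tch (#-mono λ p → let q , r = ∩⁻ {A = H} p in ∩⁺ (─⁺ q (¬∈ λ s → ∈∉ r (h (∩⁺ q s)))) r)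
        where
        arith : ∀ y t h x → 7 + y ≤ t → t ≤ 5 + h → h ≤ x → 1 + y ≤ x
        arith y t h x p q r = lin 1 (p ⊕ q ⊕ r) (solve (y ∷ t ∷ h ∷ x ∷ []))
      contraction : ∀ {i₀} → i₀ ∈ A.K₂ → (Contraction M H V′ Q A.K₂ i₀ → ⊥) → ⊥
      contraction i₀∈K = Contract.contract A.K₂
        (lean⇒unsat A.rest-lean (others A.v∈V)) (λ p → Split.rest-touched G A.v∈V (others A.v∈V) (proj₁ (─⁻ {A = I} p))) A.Q⊆rest
        (λ p → proj₂ (∩⁻ {A = H} p)) K-others (proj₁ (Critical.ne B.crit) , P⊆Z (proj₂ (Critical.ne B.crit))) card′ hall₀ hall₁ i₀∈K

      five-side : ∀ {i₀} (con : Contraction M H V′ Q A.K₂ i₀) → i₀ ∈ A.K₂ → ∀ {p} → p ∈ P →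
        Clash-free (Contraction.M′ con) (Contraction.T con) P p → ∀ s →
        (∀ {X} → X ∈ I ∩ has M v A.b → X ∉ has M u B.b → X ∈ has M p s → ⊥) → ⊥
      five-side {i₀} con i₀∈K {p} p∈P free s κ = B.clashing-pair s p∈P λ {C₁} {C₂} {y} C₁∈ C₁∋p C₂∈ C₂∋p y∈P _ C₁∋y C₂∌y →
          go C₁∈ C₁∋p C₂∈ C₂∋p y∈P C₁∋y C₂∌y (∈? (has M v A.b) C₁) (∈? (has M v A.b) C₂)
        where
        open Contraction con
        image : ∀ {i} → i ∈ B.K₂ → i ∉ has M v A.b → ∃[ i′ ] i′ ∈ T × (∀ {j t} → j ∈ P → i ∈ has M j t → i′ ∈ has M′ j t)
        image {i} q r with ∈? (tch M Q) i | B.K₂⁻ q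
        ... | inj₁ t | i∈I , _ = i₀ , ∪⁺ʳ {A = R} (self∈ i₀) , λ x y → α⁺ (A.K₂⁺ i∈I r t) (P⊆Z x) y
        ... | inj₂ t | i∈I , _ = i , ∪⁺ˡ (─⁺ (─⁺ i∈I r) t) , λ {j} x y → has⁺ (trans (row (─⁺ (─⁺ i∈I r) t) j) (has⁻ y))
        go : ∀ {C₁ C₂ y} → C₁ ∈ B.K₂ → C₁ ∈ has M p s → C₂ ∈ B.K₂ → C₂ ∈ has M p s → y ∈ P → C₁ ∈ has M y true → C₂ ∈ has M y false →
             C₁ ∈ has M v A.b ⊎ C₁ ∉ has M v A.b → C₂ ∈ has M v A.b ⊎ C₂ ∉ has M v A.b → ⊥
        go a b c d e f g (inj₁ h) _ = let x , y , _ = B.K₂⁻ a in κ (∩⁺ x h) y b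
        go a b c d e f g (inj₂ _) (inj₁ h) = let x , y , _ = B.K₂⁻ c in κ (∩⁺ x h) y d
        go a b c d e f g (inj₂ h) (inj₂ k) =
          let _ , x , m = image a h ; _ , x′ , m′ = image c k in free x x′ (m p∈P b) (m′ p∈P d) e (m e f) (m′ e g)

      -- Now P touches the whole 5-side of v, so P is critical of deficiency 2 in H, as is Q, and
      -- the two share the clauses of the 5-side of u outside that of v.

      shared : ∀ {p X X′} → p ∈ P → X ∈ I ∩ has M v A.b → X ∉ has M u B.b → X ∈ has M p true →
               X′ ∈ I ∩ has M v A.b → X′ ∉ has M u B.b → X′ ∈ has M p false → ⊥
      shared {p} {X} {X′} p∈P X∈ X∉u X∋p X′∈ X′∉u X′∌p = go (pick2 (A.K₂ ∩ has M u B.b) (eq≥ (A.literal≡2 B.b u∈Q)))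
        where
        -- Just two of the five clauses on the side of `u` lie in `K₂`, so at least three lie on the
        -- 5-side of `v`.
        outside≤2 : # ((I ∩ has M v A.b) ─ has M u B.b) ≤ 2
        outside≤2 = arith (# ((I ∩ has M v A.b) ∩ has M u B.b)) (# ((I ∩ has M v A.b) ─ has M u B.b)) _ (# (I ∩ has M u B.b)) (# (A.K₂ ∩ has M u B.b))
            (#-split (I ∩ has M v A.b) (has M u B.b)) A.five B.five (A.literal≡2 B.b u∈Q) (#-cover cover)
          where
          arith : ∀ x y t f k → x + y ≡ t → t ≡ 5 → f ≡ 5 → k ≡ 2 → f ≤ x + k → y ≤ 2
          arith x y _ _ _ p refl refl refl q = lin 0 (eq≤ p ⊕ q) (solve (x ∷ y ∷ []))
          cover : ∀ {i} → i ∈ I ∩ has M u B.b → i ∈ (I ∩ has M v A.b) ∩ has M u B.b ⊎ i ∈ A.K₂ ∩ has M u B.b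
          cover {i} q with ∩⁻ {A = I} q | ∈? (has M v A.b) i
          ... | x , y | inj₁ z = inj₁ (∩⁺ (∩⁺ x z) y)
          ... | x , y | inj₂ z = inj₂ (∩⁺ (A.K₂⁺ x z (tch⁺ u∈Q (has⇒occ y))) y)
        five-P : ∀ {i} → i ∈ I → i ∈ has M v A.b → i ∈ tch M P
        five-P {i} i∈I i∋v with ∈? (has M u B.b) i | i ≟ X | i ≟ X′
        ... | inj₁ q | _ | _ = B.five-tch (λ x → x) (p , p∈P) i∈I q
        ... | inj₂ q | yes refl | _ = tch⁺ p∈P (has⇒occ X∋p)
        ... | inj₂ q | no _ | yes refl = tch⁺ p∈P (has⇒occ X′∌p)
        ... | inj₂ q | no i≢X | no i≢X′ = ⊥-elim (absurd≤ (≤-trans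
                (#≥3 {A = (I ∩ has M v A.b) ─ has M u B.b} (─⁺ (∩⁺ i∈I i∋v) q) (─⁺ X∈ X∉u) (─⁺ X′∈ X′∉u) i≢X i≢X′ (λ { refl → has-clash X∋p X′∌p })) outside≤2))
        u-outside : Nonempty (V ─ P)
        u-outside = u , ─⁺ B.v∈V B.v∉Q
        split≥ : 5 + # (H ∩ tch M P) ≤ # (I ∩ tch M P)
        split≥ = subst (λ f → f + # (H ∩ tch M P) ≤ # (I ∩ tch M P)) A.five (#-disj
            (λ q → let x , y = ∩⁻ {A = I} q in ∩⁺ x (five-P x y))
            (λ q → let x , y = ∩⁻ {A = H} q in ∩⁺ (proj₁ (─⁻ {A = I} x)) y)
            (λ q r → ∈∉ (proj₂ (∩⁻ {A = I} q)) (proj₂ (─⁻ {A = I} (proj₁ (∩⁻ {A = H} r))))))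
        P-critical : Critical M 2 (H ∩ tch M P) P
        P-critical = record
          { ne = p , p∈P
          ; lean = Lean-mono P⊆V′ ∩⁺ A.rest-lean
          ; touched = λ q → proj₂ (∩⁻ {A = H} q)
          ; card = ≤-antisym (upper _ _ (# P) split≥ B.top) (lower (# P) (# (I ∩ tch M P)) _ (proper B.Q⊆V (p , p∈P) u-outside) H-tch)
          ; proper = λ {S} f ne ne′ → middle (# S) (# (I ∩ tch M S)) (# (H ∩ tch M S)) _ (B.near f ne ne′) H-tch
                       (#-mono λ q → let x , y = ∩⁻ {A = H} q in ∩⁺ (∩⁺ x (tch-mono f y)) y)
          }
          where
          upper : ∀ h t p → 5 + h ≤ t → t ≤ 7 + p → h ≤ 2 + p
          upper h t p q r = lin 0 (q ⊕ r) (solve (h ∷ t ∷ p ∷ []))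
          lower : ∀ p t h → 7 + p ≤ t → t ≤ 5 + h → 2 + p ≤ h
          lower p t h q r = lin 0 (q ⊕ r) (solve (h ∷ t ∷ p ∷ []))
          middle : ∀ s t h x → 8 + s ≤ t → t ≤ 5 + h → h ≤ x → 3 + s ≤ x
          middle s t h x p q r = lin 0 (p ⊕ q ⊕ r) (solve (s ∷ t ∷ h ∷ x ∷ []))
        degP : ∀ {w} → w ∈ P → 4 ≤ # ((H ∩ tch M P) ∩ occ M w)
        degP {w} q = arith (# (I ∩ occ M w)) (# (I ∩ has M v A.b)) _ _ (deg≥9 (B.Q⊆V q)) (degree-cover {I = I} {v} {A.b} {w}) A.five (degree-tch {I = H} q)
          where
          arith : ∀ x l y z → 9 ≤ x → x ≤ l + y → l ≡ 5 → y ≤ z → 4 ≤ z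
          arith x _ y z p q refl r = lin 0 (p ⊕ q ⊕ r) (solve (x ∷ y ∷ z ∷ []))
        union : ∀ {j} → j ∈ Q ⊎ j ∈ P → j ∈ V′
        union (inj₁ q) = A.Q⊆rest q
        union (inj₂ q) = P⊆V′ q
        go : (∃[ A₁ ] ∃[ A₂ ] A₁ ∈ A.K₂ ∩ has M u B.b × A₂ ∈ A.K₂ ∩ has M u B.b × A₁ ≢ A₂) → ⊥
        -- Both clauses touch `Q` as well as `P`: `A₁` is left to the model on `P`, and `A₂` to the
        -- model on `Q`.
        go (A₁ , A₂ , A₁∈ , A₂∈ , A₁≢A₂) = A.satisfy-others (proj₁ (∩⁻ {A = A.K₂} A₁∈)) λ ψ ψ-sat _ →
            Critical₂.satisfy-others P-critical degP (∩⁺ A₂∈H (B.five-tch (λ x → x) (p , p∈P) (proj₁ (─⁻ {A = I} A₂∈H)) (proj₂ (∩⁻ {A = A.K₂} A₂∈)))) λ χ χ-sat _ →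
            A.rest-lean (glue Q ψ χ) (λ x → union (∪⁻ {A = Q} x)) (p , ∪⁺ʳ {A = Q} p∈P) (sat ψ ψ-sat χ χ-sat)
          where
          A₂∈H : A₂ ∈ H
          A₂∈H = proj₁ (∩⁻ {A = H} (proj₁ (∩⁻ {A = A.K₂} A₂∈)))
          sat : ∀ ψ → (∀ {i} → i ∈ A.K₂ → i ≢ A₁ → Sat M ψ Q i) → ∀ χ → (∀ {i} → i ∈ H ∩ tch M P → i ≢ A₂ → Sat M χ P i) →
                ∀ {i} → i ∈ H → i ∈ tch M (Q ∪ P) → Sat M (glue Q ψ χ) (Q ∪ P) i
          sat ψ ψ-sat χ χ-sat {i} i∈H t with i ≟ A₁ | i ≟ A₂ | tch⁻ t
          ... | yes refl | _ | _ = Sat-mono (∪⁺ʳ {A = Q}) (Sat-glueʳ (λ x → ¬∈ λ y → disj y x)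
                  (χ-sat (∩⁺ i∈H (B.five-tch (λ x → x) (p , p∈P) (proj₁ (─⁻ {A = I} i∈H)) (proj₂ (∩⁻ {A = A.K₂} A₁∈)))) A₁≢A₂))
          ... | no i≢A₁ | yes refl | _ = Sat-mono ∪⁺ˡ (Sat-glueˡ (ψ-sat (proj₁ (∩⁻ {A = A.K₂} A₂∈)) i≢A₁))
          ... | no i≢A₁ | no i≢A₂ | j , x , o with ∪⁻ {A = Q} x
          ...   | inj₁ y = Sat-mono ∪⁺ˡ (Sat-glueˡ (ψ-sat (∩⁺ i∈H (tch⁺ y o)) i≢A₁))
          ...   | inj₂ y = Sat-mono (∪⁺ʳ {A = Q}) (Sat-glueʳ (λ x → ¬∈ λ z → disj z x) (χ-sat (∩⁺ i∈H (tch⁺ y o)) i≢A₂))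

      start : ∃[ i₀ ] i₀ ∈ A.K₂ → ⊥
      start (i₀ , i₀∈K) = contraction i₀∈K λ con →
          lowest (# (V′ ─ Q)) ≤-refl (Contraction.lean con) (Contraction.#T con) P⊆Z (Critical.ne B.crit) λ {p} p∈P free →
            five-side con i₀∈K p∈P free true λ X∈ X∉u X∋p →
            five-side con i₀∈K p∈P free false λ X′∈ X′∉u X′∌p →
            shared p∈P X∈ X∉u X∋p X′∈ X′∉u X′∌p

    -- If `P ⊆ Q`, then `near` and `top` contradict each other at `P`. Otherwise the union, proper
    -- because of `x`, has surplus at least 7 and the intersection at least 8, too much for two sets
    -- of surplus at most 7.
    intersecting : ∀ {j x} → j ∈ Q → j ∈ P → x ∈ V → x ∉ Q → x ∉ P → ⊥
    intersecting {j} {x} j∈Q j∈P x∈V x∉Q x∉P with nonempty? (P ─ Q)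
    ... | inj₁ e = arith (# P) _ (A.near (λ p → ¬∉ λ q → #≤0 e (─⁺ p q)) (j , j∈P) (u , ─⁺ u∈Q B.v∉Q)) B.top
      where
      arith : ∀ p t → 8 + p ≤ t → t ≤ 7 + p → ⊥
      arith p t q r with lin {_} {_} 0 {1} {0} (q ⊕ r) (solve (p ∷ t ∷ []))
      ... | ()
    ... | inj₂ (y , y∈) = arith (# P) (# Q) (# (P ∪ Q)) (# (P ∩ Q)) (# (I ∩ tch M P)) (# (I ∩ tch M Q)) (# (I ∩ tch M (P ∪ Q))) (# (I ∩ tch M (P ∩ Q)))
          B.top A.top (proper sub (j , ∪⁺ˡ j∈P) (x , ─⁺ x∈V (¬∈ λ p → x∉ (∪⁻ {A = P} p))))
          (B.near (λ p → proj₁ (∩⁻ {A = P} p)) (j , ∩⁺ j∈P j∈Q)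
             (y , ─⁺ (proj₁ (─⁻ {A = P} y∈)) (¬∈ λ p → ∈∉ (proj₂ (∩⁻ {A = P} p)) (proj₂ (─⁻ {A = P} y∈)))))
          (#-submod (I ∩ tch M (P ∪ Q)) (I ∩ tch M (P ∩ Q)) (I ∩ tch M P) (I ∩ tch M Q) either both′ (λ _ → both))
          (#-submod P Q (P ∪ Q) (P ∩ Q) (λ p → inj₁ (∪⁺ˡ p)) (λ p → inj₁ (∪⁺ʳ {A = P} p)) (λ p q → ∪⁺ˡ p , ∩⁺ p q))
      where
      arith : ∀ p q u i tp tq tu ti → tp ≤ 7 + p → tq ≤ 7 + q → 7 + u ≤ tu → 8 + i ≤ ti → tu + ti ≤ tp + tq → p + q ≤ u + i → ⊥
      arith p q u i tp tq tu ti a b c d e f with lin {_} {_} 0 {1} {0} (a ⊕ b ⊕ c ⊕ d ⊕ e ⊕ f) (solve (p ∷ q ∷ u ∷ i ∷ tp ∷ tq ∷ tu ∷ ti ∷ []))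
      ... | ()
      sub : P ∪ Q ⊆ V
      sub p with ∪⁻ {A = P} p
      ... | inj₁ q = B.Q⊆V q
      ... | inj₂ q = A.Q⊆V q
      x∉ : x ∈ P ⊎ x ∈ Q → ⊥
      x∉ (inj₁ p) = ∈∉ p x∉P
      x∉ (inj₂ p) = ∈∉ p x∉Q
      either : ∀ {i} → i ∈ I ∩ tch M (P ∪ Q) → i ∈ I ∩ tch M P ⊎ i ∈ I ∩ tch M Q
      either p with ∩⁻ {A = I} p
      ... | q , t with tch⁻ t
      ...   | k , r , o with ∪⁻ {A = P} r
      ...     | inj₁ s = inj₁ (∩⁺ q (tch⁺ s o))
      ...     | inj₂ s = inj₂ (∩⁺ q (tch⁺ s o))
      both : ∀ {i} → i ∈ I ∩ tch M (P ∩ Q) → i ∈ I ∩ tch M P × i ∈ I ∩ tch M Q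
      both p = let q , t = ∩⁻ {A = I} p in ∩⁺ q (tch-mono (λ r → proj₁ (∩⁻ {A = P} r)) t) , ∩⁺ q (tch-mono (λ r → proj₂ (∩⁻ {A = P} r)) t)
      both′ : ∀ {i} → i ∈ I ∩ tch M (P ∩ Q) → i ∈ I ∩ tch M P ⊎ i ∈ I ∩ tch M Q
      both′ p = inj₁ (proj₁ (both p))

    union-all : ∀ {x} → x ∈ V → x ∉ Q → x ∈ P
    union-all {x} x∈V x∉Q = ¬∉ λ x∉P → absurd x∉P (nonempty? (Q ∩ P)) (∈? P v)
      where
      absurd : x ∉ P → # (Q ∩ P) ≤ 0 ⊎ Nonempty (Q ∩ P) → v ∈ P ⊎ v ∉ P → ⊥
      absurd x∉P (inj₂ (j , p)) _ = let q , r = ∩⁻ {A = Q} p in intersecting q r x∈V x∉Q x∉P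
      absurd x∉P (inj₁ e) (inj₁ q) = disjoint-mutual (λ r s → #≤0 e (∩⁺ r s)) q
      absurd x∉P (inj₁ e) (inj₂ q) = disjoint-apart (λ r s → #≤0 e (∩⁺ r s)) q

    symmetric : v ∈ P
    symmetric = union-all A.v∈V A.v∉Q

-- Cores omit only their own variable, and three variables remain

among-four : ∀ {n} {A : Sub n} {a b c d i} → # A ≤ 4 → a ∈ A → b ∈ A → c ∈ A → d ∈ A →
  a ≢ b → a ≢ c → a ≢ d → b ≢ c → b ≢ d → c ≢ d → i ∈ A → i ∈ ⁅ a ⁆ ∪ ⁅ b ⁆ ∪ (⁅ c ⁆ ∪ ⁅ d ⁆)
among-four {A = A} {a} {b} {c} {d} {i} h a∈ b∈ c∈ d∈ ab ac ad bc bd cd i∈ = ¬∉ λ i∉ →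
  #≤0 (arith (# A) _ _ _ _ h (#-remove A a∈) (#-remove (A ─ ⁅ a ⁆) b∈′) (#-remove (A ─ ⁅ a ⁆ ─ ⁅ b ⁆) c∈′) (#-remove (A ─ ⁅ a ⁆ ─ ⁅ b ⁆ ─ ⁅ c ⁆) d∈′))
      (─⁺ (─⁺ (─⁺ (─⁺ i∈ (¬∈ λ p → ∈∉ (∪⁺ˡ (∪⁺ˡ p)) i∉)) (¬∈ λ p → ∈∉ (∪⁺ˡ (∪⁺ʳ {A = ⁅ a ⁆} p)) i∉))
          (¬∈ λ p → ∈∉ (∪⁺ʳ {A = ⁅ a ⁆ ∪ ⁅ b ⁆} (∪⁺ˡ p)) i∉)) (¬∈ λ p → ∈∉ (∪⁺ʳ {A = ⁅ a ⁆ ∪ ⁅ b ⁆} (∪⁺ʳ {A = ⁅ c ⁆} p)) i∉))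
  where
  b∈′ : b ∈ A ─ ⁅ a ⁆
  b∈′ = ─⁺ b∈ (∉⁅⁆⁺ ab)
  c∈′ : c ∈ A ─ ⁅ a ⁆ ─ ⁅ b ⁆
  c∈′ = ─⁺ (─⁺ c∈ (∉⁅⁆⁺ ac)) (∉⁅⁆⁺ bc)
  d∈′ : d ∈ A ─ ⁅ a ⁆ ─ ⁅ b ⁆ ─ ⁅ c ⁆
  d∈′ = ─⁺ (─⁺ (─⁺ d∈ (∉⁅⁆⁺ ad)) (∉⁅⁆⁺ bd)) (∉⁅⁆⁺ cd)
  arith : ∀ x x₁ x₂ x₃ x₄ → x ≤ 4 → x ≡ suc x₁ → x₁ ≡ suc x₂ → x₂ ≡ suc x₃ → x₃ ≡ suc x₄ → x₄ ≤ 0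
  arith _ _ _ _ _ (s≤s (s≤s (s≤s (s≤s p)))) refl refl refl refl = p

#-four : ∀ {n} (a b c d : Fin n) → # (⁅ a ⁆ ∪ ⁅ b ⁆ ∪ (⁅ c ⁆ ∪ ⁅ d ⁆)) ≤ 4
#-four a b c d = ≤-trans (#-cover (∪⁻ {A = ⁅ a ⁆ ∪ ⁅ b ⁆})) (pair a b ⊕ pair c d)
  where
  pair : ∀ a b → # (⁅ a ⁆ ∪ ⁅ b ⁆) ≤ 2
  pair a b = ≤-trans (#-cover (∪⁻ {A = ⁅ a ⁆})) (≤-reflexive (one (#⁅⁆ a) (#⁅⁆ b)))
    where
    one : ∀ {x y} → x ≡ 1 → y ≡ 1 → x + y ≡ 2
    one refl refl = refl

module Final {c n} {M : Matrix c n} {I V} (G : Critical M 6 I V) (deg≥9 : ∀ {w} → w ∈ V → 9 ≤ # (I ∩ occ M w)) where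
  open Six G deg≥9
  open Neighbours G deg≥9 using (union-all; symmetric)

  degree : ∀ {v} → v ∈ V → # (I ∩ occ M v) ≤ 9
  degree {v} p with # (I ∩ occ M v) ≤? 9
  ... | yes q = q
  ... | no ¬q = ⊥-elim (core p λ Kv → let u , u∈Q = Critical.ne (Core.crit Kv) in
                  core (Core.Q⊆V Kv u∈Q) λ Ku → ¬q (OfCore.degree≤9 Ku (symmetric Kv Ku u∈Q)))

  four-side : ∀ {v} (Kv : Core M I V v) → # (I ∩ has M v (not (Core.b Kv))) ≡ 4
  four-side {v} Kv = arith _ _ _ (Core.five Kv) (#-literals I v (Core.b Kv)) (degree (Core.v∈V Kv)) (deg≥9 (Core.v∈V Kv))
    where
    arith : ∀ x y d → x ≡ 5 → x + y ≡ d → d ≤ 9 → 9 ≤ d → y ≡ 4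
    arith _ y _ refl refl (s≤s (s≤s (s≤s (s≤s (s≤s p))))) (s≤s (s≤s (s≤s (s≤s (s≤s q))))) = ≤-antisym p q

  -- For `u` in `Q(v)`, the union of `Q(u)` and `Q(v)` is all of `V` and puts `z` into `Q(u)`;
  -- membership is symmetric.
  core-⊆ : ∀ {v z} (Kv : Core M I V v) (Kz : Core M I V z) → z ∉ Core.Q Kv → Core.Q Kv ⊆ Core.Q Kz
  core-⊆ Kv Kz z∉Q u∈Q = ¬∉ λ u∉ → core (Core.Q⊆V Kv u∈Q) λ Ku →
    ∈∉ (symmetric Ku Kz (union-all Kv Ku u∈Q (Core.v∈V Kz) z∉Q)) u∉

  module Missing {v z} (Kv : Core M I V v) (Kz : Core M I V z) (z∉Q : z ∉ Core.Q Kv) (z≢v : z ≢ v) where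
    private
      module A = OfCore Kv
      module Z = OfCore Kz
    H = I ─ has M v A.b
    q₀ = proj₁ (Critical.ne A.crit)
    q₀∈Q = proj₂ (Critical.ne A.crit)

    v∉Q′ : v ∉ Z.Q
    v∉Q′ = ¬∈ λ p → ∈∉ (symmetric Kz Kv p) z∉Q

    z∈V′ : z ∈ V ─ ⁅ v ⁆
    z∈V′ = ─⁺ Z.v∈V (∉⁅⁆⁺ λ e → z≢v (sym e))

    five-side-tch : ∀ {j i} (Kj : Core M I V j) → j ∉ A.Q → i ∈ I → i ∈ has M j (Core.b Kj) → i ∈ tch M A.Q
    five-side-tch Kj j∉Q i∈I h = tch⁺ q₀∈Q (OfCore.five-full Kj (core-⊆ Kv Kj j∉Q q₀∈Q) i∈I h)

    -- The clauses not touched by Q contain only 4-side literals; giving z its 5-side value and all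
    -- other variables outside Q their 4-side value falsifies nothing but a clause in {z, v}.

    binary : (∀ {i} → i ∈ I → i ∈ occ M v → i ∈ occ M z → (∀ {j} → j ∈ V → j ≢ v → j ≢ z → i ∉ occ M j) → ⊥) → ⊥
    binary κ = start (nonempty? (A.K₂ ∩ has M z Z.b))
      where
      R = H ─ tch M A.Q
      -- Cores exist only under double negation, so the 4-side values cannot be named here; they are
      -- read off from the signs occurring in `R`.
      φ : Fin n → Bool
      φ j = any (R ∩ has M j true)
      one-sided : ∀ {i j s} → i ∈ R → j ∈ V → j ∉ A.Q → i ∈ has M j s → φ j ≡ s
      one-sided {i} {j} {s} i∈R j∈V j∉Q i∋j with same? (φ j) s
      ... | inj₁ e = e
      ... | inj₂ e = ⊥-elim (core j∈V λ Kj → go s (Core.b Kj) (λ p q → ∈∉ (five-side-tch Kj j∉Q (proj₁ (─⁻ {A = I} (proj₁ (─⁻ {A = H} p)))) q) (proj₂ (─⁻ {A = H} p))) i∋j e)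
        where
        go : ∀ s b → (∀ {i} → i ∈ R → i ∈ has M j b → ⊥) → i ∈ has M j s → φ j ≡ not s → ⊥
        go true  b     f p e = absurd (trans (sym (any⁺ (R ∩ has M j true) i (holds (∩⁺ i∈R p)))) e)
          where
          absurd : true ≡ false → ⊥
          absurd ()
        go false false f p e = f i∈R p
        go false true  f p e with any⁻ (R ∩ has M j true) e
        ... | k , q = let r , s = ∩⁻ {A = R} {has M j true} (mem q) in f r s
      start : # (A.K₂ ∩ has M z Z.b) ≤ 0 ⊎ Nonempty (A.K₂ ∩ has M z Z.b) → ⊥
      -- All 5-side clauses of `z` touch `Q`. If none of them is in `H`, the opposite value of `z`
      -- is an autarky by itself.
      start (inj₁ e) = A.rest-lean (λ _ → not Z.b) (⁅⁆⊆ z∈V′) (z , self∈ z) λ {i} p t →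
        via z (self∈ z) (has⁻ (occ⇒has (tch⁅⁆⁻ t) (¬∈ λ q → #≤0 e (∩⁺ (∩⁺ p (five-side-tch Kz z∉Q (proj₁ (─⁻ {A = I} p)) q)) q))))
      start (inj₂ (i , p)) = A.satisfy-others (proj₁ (∩⁻ {A = A.K₂} p)) λ ψ ψ-sat _ →
          lean⇒unsat A.rest-lean (others A.v∈V) (glue A.Q ψ (glue ⁅ z ⁆ (λ _ → Z.b) φ)) (λ q → sat ψ ψ-sat q (∈? (tch M A.Q) _))
        where
        sat : ∀ ψ → (∀ {i′} → i′ ∈ A.K₂ → i′ ≢ i → Sat M ψ A.Q i′) → ∀ {i′} → i′ ∈ H → i′ ∈ tch M A.Q ⊎ i′ ∉ tch M A.Q →
              Sat M (glue A.Q ψ (glue ⁅ z ⁆ (λ _ → Z.b) φ)) (V ─ ⁅ v ⁆) i′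
        sat ψ ψ-sat {i′} q (inj₁ t) with i′ ≟ i
        ... | no ne = Sat-mono A.Q⊆rest (Sat-glueˡ (ψ-sat (∩⁺ q t) ne))
        ... | yes refl = via z z∈V′ (trans (has⁻ (proj₂ (∩⁻ {A = A.K₂} p))) (cong just (sym (trans
                           (glue∉ {A = A.Q} {ψ} {glue ⁅ z ⁆ (λ _ → Z.b) φ} z∉Q) (glue∈ {A = ⁅ z ⁆} {λ _ → Z.b} {φ} (self∈ z))))))
        sat ψ ψ-sat {i′} q (inj₂ t) with ∈? (tch M (V ─ ⁅ v ⁆ ─ ⁅ z ⁆)) i′
        ... | inj₁ t′ with tch⁻ t′
        ...   | j , j∈ , o with ─⁻ {A = V ─ ⁅ v ⁆} j∈ | occ⁻ o
        ...     | j∈V′ , j∉z | s , e = via j j∈V′ (trans e (cong just (sym (trans (glue∉ {A = A.Q} {ψ} {glue ⁅ z ⁆ (λ _ → Z.b) φ} j∉Q)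
                    (trans (glue∉ {A = ⁅ z ⁆} {λ _ → Z.b} {φ} j∉z) (one-sided (─⁺ q t) (proj₁ (─⁻ {A = V} j∈V′)) j∉Q (has⁺ e)))))))
          where
          j∉Q : j ∉ A.Q
          j∉Q = ¬∈ λ x → ∈∉ (tch⁺ x o) t
        -- Such a clause has no variable besides `v` and `z`; since it still meets `V` without `z`
        -- and `V` without `v`, it contains both.
        sat ψ ψ-sat {i′} q (inj₂ t) | inj₂ t′ = ⊥-elim (κ i∈I (at-v (tch⁻ (Split.rest-touched G Z.v∈V (others Z.v∈V) i∈I)))
                                                              (at-z (tch⁻ (Split.rest-touched G A.v∈V (others A.v∈V) i∈I))) off)
          where
          i∈I = proj₁ (─⁻ {A = I} q)
          off : ∀ {j} → j ∈ V → j ≢ v → j ≢ z → i′ ∉ occ M j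
          off j∈V j≢v j≢z = ∉tch⁻ t′ (─⁺ (─⁺ j∈V (∉⁅⁆⁺ λ e → j≢v (sym e))) (∉⁅⁆⁺ λ e → j≢z (sym e)))
          at-z : ∃[ j ] j ∈ V ─ ⁅ v ⁆ × i′ ∈ occ M j → i′ ∈ occ M z
          at-z (j , x , o) with z ≟ j
          ... | yes refl = o
          ... | no ne = ⊥-elim (∈∉ o (∉tch⁻ t′ (─⁺ x (∉⁅⁆⁺ ne))))
          at-v : ∃[ j ] j ∈ V ─ ⁅ z ⁆ × i′ ∈ occ M j → i′ ∈ occ M v
          at-v (j , x , o) with v ≟ j
          ... | yes refl = o
          ... | no ne = ⊥-elim (∈∉ o (off (proj₁ (─⁻ {A = V} x)) (λ e → ne (sym e)) (λ e → ∉⁅⁆⁻ (proj₂ (─⁻ {A = V} x)) (sym e))))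

  -- Two missing variables would give three clauses on {v, z, z′}.

  missing-unique : ∀ {v z z′} (Kv : Core M I V v) → z ∈ V → z ∉ Core.Q Kv → z ≢ v → z′ ∈ V → z′ ∉ Core.Q Kv → z′ ≢ v → z ≢ z′ → ⊥
  missing-unique {v} {z} {z′} Kv z∈V z∉Q z≢v z′∈V z′∉Q z′≢v z≢z′ =
    core z∈V λ Kz → core z′∈V λ Kz′ →
    let v∉Qz = Missing.v∉Q′ Kv Kz z∉Q z≢v
        v∉Qz′ = Missing.v∉Q′ Kv Kz′ z′∉Q z′≢v
        z′∉Qz = ¬∈ λ p → ∈∉ (union-all Kz Kz′ p (Core.v∈V Kv) v∉Qz) v∉Qz′
    in Missing.binary Kv Kz z∉Q z≢v λ {C₁} C₁∈I C₁∋v C₁∋z C₁-off →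
       Missing.binary Kv Kz′ z′∉Q z′≢v λ {C₂} C₂∈I C₂∋v C₂∋z′ C₂-off →
       Missing.binary Kz Kz′ z′∉Qz (λ e → z≢z′ (sym e)) λ {C₃} C₃∈I C₃∋z C₃∋z′ C₃-off →
       contra (#≥3 (outside C₁∈I λ x y _ w → C₁-off w x y) (outside C₂∈I λ x _ y w → C₂-off w x y) (outside C₃∈I λ _ x y w → C₃-off w x y)
         (λ { refl → ∈∉ C₁∋z (C₂-off z∈V z≢v z≢z′) }) (λ { refl → ∈∉ C₁∋v (C₃-off v∈V (λ e → z≢v (sym e)) (λ e → z′≢v (sym e))) })
         (λ { refl → ∈∉ C₂∋v (C₃-off v∈V (λ e → z≢v (sym e)) (λ e → z′≢v (sym e))) }))
    where
    v∈V = Core.v∈V Kv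
    S = V ─ ⁅ v ⁆ ─ ⁅ z ⁆ ─ ⁅ z′ ⁆
    S⁻ : ∀ {j} → j ∈ S → j ∈ V × j ≢ v × j ≢ z × j ≢ z′
    S⁻ p with ─⁻ {A = V ─ ⁅ v ⁆ ─ ⁅ z ⁆} p
    ... | q , r with ─⁻ {A = V ─ ⁅ v ⁆} q
    ...   | s , t with ─⁻ {A = V} s
    ...     | x , y = x , (λ e → ∉⁅⁆⁻ y (sym e)) , (λ e → ∉⁅⁆⁻ t (sym e)) , (λ e → ∉⁅⁆⁻ r (sym e))
    S⁺ : ∀ {j} → j ∈ V → j ≢ v → j ≢ z → j ≢ z′ → j ∈ S
    S⁺ p a b c = ─⁺ (─⁺ (─⁺ p (∉⁅⁆⁺ λ e → a (sym e))) (∉⁅⁆⁺ λ e → b (sym e))) (∉⁅⁆⁺ λ e → c (sym e))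
    outside : ∀ {i} → i ∈ I → (∀ {j} → j ≢ v → j ≢ z → j ≢ z′ → j ∈ V → i ∉ occ M j) → i ∈ I ─ tch M S
    outside p f = ─⁺ p (¬∈ λ t → let j , q , o = tch⁻ t ; x , a , b , c = S⁻ q in ∈∉ o (f a b c x))
    -- The |V| - 3 variables of `S` meet at least |V| + 4 of the |V| + 6 clauses, so at most two
    -- clauses miss `S`.
    contra : 3 ≤ # (I ─ tch M S) → ⊥
    contra h = arith (# I) (# V) _ _ (# S) (# (I ∩ tch M S)) (# (I ─ tch M S)) card (#-remove V v∈V)
        (#-remove (V ─ ⁅ v ⁆) (─⁺ z∈V (∉⁅⁆⁺ λ e → z≢v (sym e))))
        (#-remove (V ─ ⁅ v ⁆ ─ ⁅ z ⁆) (─⁺ (─⁺ z′∈V (∉⁅⁆⁺ λ e → z′≢v (sym e))) (∉⁅⁆⁺ z≢z′)))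
        (proper (λ p → proj₁ (S⁻ p)) (q₀ , S⁺ (Core.Q⊆V Kv q₀∈Q) (OfCore.∈Q⇒≢ Kv q₀∈Q) (λ { refl → ∈∉ q₀∈Q z∉Q }) (λ { refl → ∈∉ q₀∈Q z′∉Q }))
           (v , ─⁺ v∈V (¬∈ λ p → proj₁ (proj₂ (S⁻ p)) refl)))
        (#-split I (tch M S)) h
      where
      q₀ = proj₁ (Critical.ne (Core.crit Kv))
      q₀∈Q = proj₂ (Critical.ne (Core.crit Kv))
      arith : ∀ i v v₁ v₂ s t o → i ≡ 6 + v → v ≡ suc v₁ → v₁ ≡ suc v₂ → v₂ ≡ suc s → 7 + s ≤ t → t + o ≡ i → 3 ≤ o → ⊥
      arith _ _ _ _ s t o refl refl refl refl p q r with lin {_} {_} 0 {1} {0} (p ⊕ eq≤ q ⊕ r) (solve (s ∷ t ∷ o ∷ []))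
      ... | ()

  -- With one missing variable z, the 4-side values of v and z leave deficiency 1 on Q, but degrees ≥ 3.

  none-missing : ∀ {v z} (Kv : Core M I V v) → z ∈ V → z ≢ v → z ∈ Core.Q Kv
  none-missing {v} {z} Kv z∈V z≢v = ¬∉ λ z∉Q → core z∈V λ Kz → Missing.binary Kv Kz z∉Q z≢v λ C₀∈I C₀∋v C₀∋z off → contra z∉Q Kz C₀∈I C₀∋v C₀∋z off
    where
    contra : z ∉ Core.Q Kv → (Kz : Core M I V z) → ∀ {C₀} → C₀ ∈ I → C₀ ∈ occ M v → C₀ ∈ occ M z → (∀ {j} → j ∈ V → j ≢ v → j ≢ z → C₀ ∉ occ M j) → ⊥
    contra z∉Q Kz {C₀} C₀∈I C₀∋v C₀∋z off =
        lean-1 {I = I″} (leanFrom {I = I″} unsat″ touched″ (λ p → p) counts) (q₀ , q₀∈Q) (≤-trans (#-mono λ p → proj₁ (∩⁻ {A = I″} p)) #I″) deg≥3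
      where
      module A = OfCore Kv
      module Z = OfCore Kz
      Q = A.Q
      q₀ = proj₁ (Critical.ne A.crit)
      q₀∈Q = proj₂ (Critical.ne A.crit)
      Jv = I ∩ has M v (not A.b)
      Jz = I ∩ has M z (not Z.b)
      I″ = I ─ has M v (not A.b) ─ has M z (not Z.b)
      C₀-off : ∀ {j} → j ∈ Q → C₀ ∉ occ M j
      C₀-off p = off (A.Q⊆V p) (A.∈Q⇒≢ p) λ { refl → ∈∉ p z∉Q }
      C₀∈Jv : C₀ ∈ Jv
      C₀∈Jv = ∩⁺ C₀∈I (occ⇒has C₀∋v (¬∈ λ p → ∈∉ (A.five-full q₀∈Q C₀∈I p) (C₀-off q₀∈Q)))
      C₀∈Jz : C₀ ∈ Jz
      C₀∈Jz = ∩⁺ C₀∈I (occ⇒has C₀∋z (¬∈ λ p → ∈∉ (Z.five-full (core-⊆ Kv Kz z∉Q q₀∈Q) C₀∈I p) (C₀-off q₀∈Q)))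
      #V≤ : # V ≤ # Q + 2
      #V≤ = arith (# V) (# Q) (# (⁅ v ⁆ ∪ ⁅ z ⁆)) _ _ (#-cover cover) (#-cover (∪⁻ {A = ⁅ v ⁆})) (#⁅⁆ v) (#⁅⁆ z)
        where
        cover : ∀ {j} → j ∈ V → j ∈ Q ⊎ j ∈ ⁅ v ⁆ ∪ ⁅ z ⁆
        cover {j} p with ∈? Q j | v ≟ j | z ≟ j
        ... | inj₁ q | _ | _ = inj₁ q
        ... | inj₂ q | yes refl | _ = inj₂ (∪⁺ˡ (self∈ v))
        ... | inj₂ q | no _ | yes refl = inj₂ (∪⁺ʳ {A = ⁅ v ⁆} (self∈ z))
        ... | inj₂ q | no v≢j | no z≢j = ⊥-elim (missing-unique Kv z∈V z∉Q z≢v p q (λ e → v≢j (sym e)) z≢j)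
        arith : ∀ x q w a b → x ≤ q + w → w ≤ a + b → a ≡ 1 → b ≡ 1 → x ≤ q + 2
        arith x q w _ _ p r refl refl = lin 0 (p ⊕ r) (solve (x ∷ q ∷ w ∷ []))
      -- `Q` meets at least 7 + |Q| of at most 8 + |Q| clauses, and `C₀` is one that it misses.
      untouched≡ : ∀ {i} → i ∈ I → i ∉ tch M Q → i ≡ C₀
      untouched≡ p t = #≤1 (arith (# I) (# V) (# Q) (# (I ∩ tch M Q)) (# (I ─ tch M Q)) card #V≤
                               (proper A.Q⊆V (q₀ , q₀∈Q) (v , ─⁺ A.v∈V A.v∉Q)) (#-split I (tch M Q)))
                         (─⁺ p t) (─⁺ C₀∈I (¬∈ λ t → let j , q , o = tch⁻ t in ∈∉ o (C₀-off q)))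
        where
        arith : ∀ i v q t o → i ≡ 6 + v → v ≤ q + 2 → 7 + q ≤ t → t + o ≡ i → o ≤ 1
        arith _ v q t o refl p r s = lin 0 (p ⊕ r ⊕ eq≤ s) (solve (v ∷ q ∷ t ∷ o ∷ []))
      -- Another common clause could be omitted on `Q`: the 4-side value of `z` satisfies it
      -- together with `C₀`, and a model of the rest of `K₂` completes a model of `H`.
      v-z-only : ∀ {i} → i ∈ Jv ∩ Jz → i ∈ ⁅ C₀ ⁆
      v-z-only {i} p with ∩⁻ {A = Jv} p
      ... | q , r with ∩⁻ {A = I} q | ∩⁻ {A = I} r | i ≟ C₀
      ...   | _ | _ | yes refl = self∈ C₀
      ...   | i∈I , v̄ | _ , z̄ | no ne = ⊥-elim (A.satisfy-others (∩⁺ i∈H (¬∉ λ t → ne (untouched≡ i∈I t))) λ ψ ψ-sat _ →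
                lean⇒unsat A.rest-lean (others A.v∈V) (glue Q ψ (λ _ → not Z.b)) λ s → sat ψ ψ-sat s (∈? (tch M Q) _))
        where
        i∈H : i ∈ I ─ has M v A.b
        i∈H = ─⁺ i∈I (¬∈ λ x → has-clash x v̄)
        by-z : ∀ {i′} ψ → i′ ∈ has M z (not Z.b) → Sat M (glue Q ψ (λ _ → not Z.b)) (V ─ ⁅ v ⁆) i′
        by-z ψ x = via z (─⁺ z∈V (∉⁅⁆⁺ λ e → z≢v (sym e))) (trans (has⁻ x) (cong just (sym (glue∉ {A = Q} {ψ} {λ _ → not Z.b} z∉Q))))
        sat : ∀ ψ → (∀ {i′} → i′ ∈ A.K₂ → i′ ≢ i → Sat M ψ Q i′) → ∀ {i′} → i′ ∈ I ─ has M v A.b → i′ ∈ tch M Q ⊎ i′ ∉ tch M Q → Sat M (glue Q ψ (λ _ → not Z.b)) (V ─ ⁅ v ⁆) i′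
        sat ψ ψ-sat {i′} s (inj₁ t) with i′ ≟ i
        ... | yes refl = by-z ψ z̄
        ... | no ne′ = Sat-mono A.Q⊆rest (Sat-glueˡ (ψ-sat (∩⁺ s t) ne′))
        sat ψ ψ-sat {i′} s (inj₂ t) = by-z ψ (subst (_∈ has M z (not Z.b)) (sym (untouched≡ (proj₁ (─⁻ {A = I} s)) t)) (proj₂ (∩⁻ {A = I} C₀∈Jz)))
      #I″ : # I″ ≤ 1 + # Q
      #I″ = arith (# I″) (# Jv) (# Jz) (# (Jv ∪ Jz)) (# (Jv ∩ Jz)) (# ⁅ C₀ ⁆) (# I) (# V) (# Q)
              (#-disj {A = I″} {Jv ∪ Jz} {I} (λ p → proj₁ (─⁻ {A = I} (proj₁ (─⁻ {A = I ─ has M v (not A.b)} p)))) J⊆ (λ p q → disj p (∪⁻ {A = Jv} q)))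
              (#-submod Jv Jz (Jv ∪ Jz) (Jv ∩ Jz) (λ p → inj₁ (∪⁺ˡ p)) (λ p → inj₁ (∪⁺ʳ {A = Jv} p)) (λ p q → ∪⁺ˡ p , ∩⁺ p q))
              (#-mono v-z-only) (#⁅⁆ C₀) (four-side Kv) (four-side Kz) card #V≤
        where
        arith : ∀ x a b u k o i v q → x + u ≤ i → a + b ≤ u + k → k ≤ o → o ≡ 1 → a ≡ 4 → b ≡ 4 → i ≡ 6 + v → v ≤ q + 2 → x ≤ 1 + q
        arith x _ _ u k _ _ v q p r s refl refl refl refl t = lin 0 (p ⊕ r ⊕ s ⊕ t) (solve (x ∷ u ∷ k ∷ v ∷ q ∷ []))
        J⊆ : Jv ∪ Jz ⊆ I
        J⊆ p with ∪⁻ {A = Jv} p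
        ... | inj₁ q = proj₁ (∩⁻ {A = I} q)
        ... | inj₂ q = proj₁ (∩⁻ {A = I} q)
        disj : ∀ {i} → i ∈ I″ → i ∈ Jv ⊎ i ∈ Jz → ⊥
        disj p (inj₁ q) = ∈∉ (proj₂ (∩⁻ {A = I} q)) (proj₂ (─⁻ {A = I} (proj₁ (─⁻ {A = I ─ has M v (not A.b)} p))))
        disj p (inj₂ q) = ∈∉ (proj₂ (∩⁻ {A = I} q)) (proj₂ (─⁻ {A = I ─ has M v (not A.b)} p))
      -- Each 4-side contains `C₀`, which is not in `D`, so at most 3 + 3 clauses of `D` are lost.
      six : ∀ {D : Sub c} → C₀ ∉ D → # (I ∩ D) ≤ # (I″ ∩ D) + 6
      six {D} C₀∉D = arith (# (I ∩ D)) _ _ _ _ (# Jv) (# Jz) (#-cover cover) (#-cover (∪⁻ {A = Jv ─ ⁅ C₀ ⁆}))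
                       (#-remove Jv C₀∈Jv) (#-remove Jz C₀∈Jz) (four-side Kv) (four-side Kz)
        where
        arith : ∀ x y u a b a′ b′ → x ≤ y + u → u ≤ a + b → a′ ≡ suc a → b′ ≡ suc b → a′ ≡ 4 → b′ ≡ 4 → x ≤ y + 6
        arith x y u _ _ _ _ p q refl refl refl refl = lin 0 (p ⊕ q) (solve (x ∷ y ∷ u ∷ []))
        cover : ∀ {i} → i ∈ I ∩ D → i ∈ I″ ∩ D ⊎ i ∈ (Jv ─ ⁅ C₀ ⁆) ∪ (Jz ─ ⁅ C₀ ⁆)
        cover {i} p with ∩⁻ {A = I} p | ∈? (has M v (not A.b)) i | ∈? (has M z (not Z.b)) i
        ... | x , y | inj₁ q | _ = inj₂ (∪⁺ˡ (─⁺ (∩⁺ x q) (∉⁅⁆⁺ λ { refl → ∈∉ y C₀∉D })))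
        ... | x , y | inj₂ q | inj₁ r = inj₂ (∪⁺ʳ {A = Jv ─ ⁅ C₀ ⁆} (─⁺ (∩⁺ x r) (∉⁅⁆⁺ λ { refl → ∈∉ y C₀∉D })))
        ... | x , y | inj₂ q | inj₂ r = inj₁ (∩⁺ (─⁺ (─⁺ x q) r) y)
      unsat″ : Unsat M I″ Q
      unsat″ a s = lean⇒unsat lean ne (glue Q a a₄) λ {i} p → sat p (∈? (has M v (not A.b)) i) (∈? (has M z (not Z.b)) i)
        where
        a₄ : Fin n → Bool
        a₄ = glue ⁅ v ⁆ (λ _ → not A.b) (λ _ → not Z.b)
        sat : ∀ {i} → i ∈ I → i ∈ has M v (not A.b) ⊎ i ∉ has M v (not A.b) → i ∈ has M z (not Z.b) ⊎ i ∉ has M z (not Z.b) → Sat M (glue Q a a₄) V i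
        sat p (inj₁ q) _ = via v A.v∈V (trans (has⁻ q) (cong just (sym (trans (glue∉ {A = Q} {a} {a₄} A.v∉Q) (glue∈ {A = ⁅ v ⁆} {λ _ → not A.b} {λ _ → not Z.b} (self∈ v))))))
        sat p (inj₂ q) (inj₁ r) = via z z∈V (trans (has⁻ r) (cong just (sym (trans (glue∉ {A = Q} {a} {a₄} z∉Q)
                                    (glue∉ {A = ⁅ v ⁆} {λ _ → not A.b} {λ _ → not Z.b} (∉⁅⁆⁺ λ e → z≢v (sym e)))))))
        sat p (inj₂ q) (inj₂ r) = Sat-mono A.Q⊆V (Sat-glueˡ (s (─⁺ (─⁺ p q) r)))
      touched″ : ∀ {i} → i ∈ I″ → i ∈ tch M Q
      touched″ p = ¬∉ λ t → let x , y = ─⁻ {A = I ─ has M v (not A.b)} p ; x′ , y′ = ─⁻ {A = I} x in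
                     ∈∉ (subst (_∈ has M v (not A.b)) (sym (untouched≡ x′ t)) (proj₂ (∩⁻ {A = I} C₀∈Jv))) y′
      counts : ∀ {S} → S ⊆ Q → Nonempty S → Nonempty (Q ─ S) → # I″ ≤ # (I″ ∩ tch M S) + # (Q ─ S)
      counts {S} f ne₁ ne₂ = arith (# I″) (# Q) (# (Q ∩ S)) (# S) (# (Q ─ S)) (# (I ∩ tch M S)) (# (I″ ∩ tch M S)) #I″ (#-split Q S) (#-mono λ p → proj₂ (∩⁻ {A = Q} p))
                                (A.near f ne₁ ne₂) (six (¬∈ λ t → let j , q , o = tch⁻ t in ∈∉ o (C₀-off (f q))))
        where
        arith : ∀ x q w s d t y → x ≤ 1 + q → w + d ≡ q → w ≤ s → 8 + s ≤ t → t ≤ y + 6 → x ≤ y + d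
        arith x _ w s d t y p refl r u o = lin 1 (p ⊕ r ⊕ u ⊕ o) (solve (x ∷ w ∷ s ∷ d ∷ t ∷ y ∷ []))
      deg≥3 : ∀ {w} → w ∈ Q → 3 ≤ # (I″ ∩ occ M w)
      deg≥3 {w} p = arith (# (I ∩ occ M w)) _ (deg≥9 (A.Q⊆V p)) (six (C₀-off p))
        where
        arith : ∀ x y → 9 ≤ x → x ≤ y + 6 → 3 ≤ y
        arith x y p q = lin 0 (p ⊕ q) (solve (x ∷ y ∷ []))

  full : ∀ {v i j} (Kv : Core M I V v) → i ∈ I → i ∈ has M v (Core.b Kv) → j ∈ V → i ∈ occ M j
  full {v} {i} {j} Kv p q r with j ≟ v
  ... | yes refl = has⇒occ q
  ... | no ne    = OfCore.five-full Kv (none-missing Kv r ne) p q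

  -- Three clauses of K₂ are full; by criticality the others leave room only for two variables.

  three-full : ∀ {v A₁ A₂ E} (Kv : Core M I V v) → let open OfCore Kv in
    A₁ ∈ K₂ → A₂ ∈ K₂ → E ∈ K₂ → A₁ ≢ A₂ → A₁ ≢ E → A₂ ≢ E →
    (∀ {j} → j ∈ V → A₁ ∈ occ M j) → (∀ {j} → j ∈ V → A₂ ∈ occ M j) → (∀ {j} → j ∈ V → E ∈ occ M j) → # Q ≤ 2
  three-full {v} {A₁} {A₂} {E} Kv A₁∈ A₂∈ E∈ A₁≢A₂ A₁≢E A₂≢E f₁ f₂ f₃ = go (nonempty? K₃)
    where
    open OfCore Kv
    K₃ = K₂ ─ ⁅ A₁ ⁆ ─ ⁅ A₂ ⁆ ─ ⁅ E ⁆
    go : # K₃ ≤ 0 ⊎ Nonempty K₃ → # Q ≤ 2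
    go (inj₁ e) = arith (# K₂) _ _ (# K₃) (# Q) (Critical.card crit) (#-remove K₂ A₁∈) (#-remove (K₂ ─ ⁅ A₁ ⁆) (─⁺ A₂∈ (∉⁅⁆⁺ A₁≢A₂)))
                    (#-remove (K₂ ─ ⁅ A₁ ⁆ ─ ⁅ A₂ ⁆) (─⁺ (─⁺ E∈ (∉⁅⁆⁺ A₁≢E)) (∉⁅⁆⁺ A₂≢E))) e
      where
      arith : ∀ k k₁ k₂ k₃ q → k ≡ 2 + q → k ≡ suc k₁ → k₁ ≡ suc k₂ → k₂ ≡ suc k₃ → k₃ ≤ 0 → q ≤ 2
      arith _ _ _ k₃ q p refl refl refl r = lin 1 (eq≥ p ⊕ r) (solve (k₃ ∷ q ∷ []))
    go (inj₂ (C , C∈)) with ─⁻ {A = K₂ ─ ⁅ A₁ ⁆ ─ ⁅ A₂ ⁆} C∈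
    ... | x , C∉E with ─⁻ {A = K₂ ─ ⁅ A₁ ⁆} x
    ...   | y , C∉A₂ with ─⁻ {A = K₂} y
    ...     | C∈K₂ , C∉A₁ = by-S (nonempty? (Q ─ S))
      where
      S = Q ∩ (λ j → occ M j C)
      S⁻ : ∀ {j} → j ∈ S → j ∈ Q × C ∈ occ M j
      S⁻ p with ∩⁻ {A = Q} p
      ... | q , mem r = q , mem r
      neS : Nonempty S
      neS with tch⁻ (Critical.touched crit C∈K₂)
      ... | j , q , mem r = j , ∩⁺ q (mem r)
      -- A variable of `S` has degree 4 in `K₂`, already reached by the three full clauses and `C`.
      touched-S : # (K₂ ∩ tch M S) ≤ 4
      touched-S = ≤-trans (#-mono incl) (#-four A₁ A₂ E C)
        where
        incl : K₂ ∩ tch M S ⊆ ⁅ A₁ ⁆ ∪ ⁅ A₂ ⁆ ∪ (⁅ E ⁆ ∪ ⁅ C ⁆)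
        incl p with ∩⁻ {A = K₂} p
        ... | i∈ , t with tch⁻ t
        ...   | j , j∈S , o with S⁻ j∈S
        ...     | j∈Q , C∋j = among-four {A = K₂ ∩ occ M j} (≤-reflexive (degree≡4 j∈Q)) (∩⁺ A₁∈ (f₁ (Q⊆V j∈Q))) (∩⁺ A₂∈ (f₂ (Q⊆V j∈Q))) (∩⁺ E∈ (f₃ (Q⊆V j∈Q))) (∩⁺ C∈K₂ C∋j)
                    A₁≢A₂ A₁≢E (∉⁅⁆⁻ C∉A₁) A₂≢E (∉⁅⁆⁻ C∉A₂) (∉⁅⁆⁻ C∉E) (∩⁺ i∈ o)
      by-S : # (Q ─ S) ≤ 0 ⊎ Nonempty (Q ─ S) → # Q ≤ 2
      by-S (inj₁ e) = arith (# K₂) (# Q) (Critical.card crit) (≤-trans (#-mono λ p → ∩⁺ p (tch-mono Q⊆S (Critical.touched crit p))) touched-S)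
        where
        Q⊆S : Q ⊆ S
        Q⊆S p = ¬∉ λ q → #≤0 e (─⁺ p q)
        arith : ∀ k q → k ≡ 2 + q → k ≤ 4 → q ≤ 2
        arith _ q refl (s≤s (s≤s p)) = p
      -- Now `S` has a single element `s`. As `C` misses `Q ─ ⁅ s ⁆`, that set meets fewer clauses
      -- than `proper` demands.
      by-S (inj₂ ne₂) = ⊥-elim (arith (# K₂) (# Q) _ _ (Critical.card crit) (#-remove Q s∈Q)
          (Critical.proper crit {Q ─ ⁅ s ⁆} (λ p → proj₁ (─⁻ {A = Q} p)) (others-Q s∈Q) (s , ─⁺ s∈Q (¬∈ λ p → ∉⁅⁆⁻ (proj₂ (─⁻ {A = Q} p)) refl)))
          (≤-trans (s≤s (#-mono incl)) (eq≥ (#-remove K₂ C∈K₂))))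
        where
        s = proj₁ neS
        s∈Q = proj₁ (S⁻ (proj₂ neS))
        #S≤1 : # S ≤ 1
        #S≤1 = count (# S) (≤-trans (Critical.proper crit (λ p → proj₁ (S⁻ p)) neS ne₂) touched-S)
          where
          count : ∀ s → 3 + s ≤ 4 → s ≤ 1
          count s (s≤s (s≤s (s≤s p))) = p
        incl : K₂ ∩ tch M (Q ─ ⁅ s ⁆) ⊆ K₂ ─ ⁅ C ⁆
        incl {i} p with ∩⁻ {A = K₂} p | C ≟ i
        ... | q , t | no ne = ─⁺ q (∉⁅⁆⁺ ne)
        ... | q , t | yes refl with tch⁻ t
        ...   | j , r , o with ─⁻ {A = Q} r
        ...     | j∈Q , j∉s = ⊥-elim (∉⁅⁆⁻ j∉s (#≤1 #S≤1 (proj₂ neS) (∩⁺ j∈Q (mem (holds o)))))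
        arith : ∀ k q q′ t → k ≡ 2 + q → q ≡ suc q′ → 3 + q′ ≤ t → suc t ≤ k → ⊥
        arith _ _ q′ t refl refl p r = absurd≤ (≤-trans (s≤s p) r)

  -- `A₁` and `A₂` are on the 5-side of `u`, hence full. One of them carries the 5-side literal of
  -- `w`, whose second occurrence in `K₂` is a third full clause.
  three-variables : # V ≤ 3
  three-variables with # V ≤? 3
  ... | yes p = p
  ... | no ¬p = ⊥-elim (core (proj₂ ne) λ Kv → start Kv (Critical.ne (Core.crit Kv)))
    where
    start : ∀ {v} (Kv : Core M I V v) → Nonempty (Core.Q Kv) → ⊥
    start {v} Kv (u , u∈Q) = core (A.Q⊆V u∈Q) λ Ku → A.clashing-pair (Core.b Ku) u∈Q λ A₁∈ A₁∋u A₂∈ A₂∋u w∈Q w≢u A₁∋w A₂∌w →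
        core (A.Q⊆V w∈Q) λ Kw → by (Core.b Kw) (full Ku (proj₁ (A.K₂⁻ A₁∈)) A₁∋u) (full Ku (proj₁ (A.K₂⁻ A₂∈)) A₂∋u) w∈Q A₁∈ A₂∈ A₁∋w A₂∌w (λ p → full Kw p)
      where
      module A = OfCore Kv
      finish : # A.Q ≤ 2 → ⊥
      finish h = ¬p (arith (# V) (# A.Q) (# ⁅ v ⁆) (#-cover cover) (#⁅⁆ v) h)
        where
        cover : ∀ {j} → j ∈ V → j ∈ A.Q ⊎ j ∈ ⁅ v ⁆
        cover {j} p with j ≟ v
        ... | yes refl = inj₂ (self∈ v)
        ... | no ne = inj₁ (none-missing Kv p ne)
        arith : ∀ x q o → x ≤ q + o → o ≡ 1 → q ≤ 2 → x ≤ 3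
        arith x q _ p refl r = lin 0 (p ⊕ r) (solve (x ∷ q ∷ []))
      third : ∀ {w s A₁ A₂} → w ∈ A.Q → A₁ ∈ A.K₂ → A₂ ∈ A.K₂ → A₁ ∈ has M w s → A₂ ∈ has M w (not s) →
        (∀ {j} → j ∈ V → A₁ ∈ occ M j) → (∀ {j} → j ∈ V → A₂ ∈ occ M j) → (∀ {i j} → i ∈ I → i ∈ has M w s → j ∈ V → i ∈ occ M j) →
        ∃[ E ] E ∈ (A.K₂ ∩ has M w s) ─ ⁅ A₁ ⁆ → ⊥
      third {w} {s} {A₁} {A₂} w∈Q A₁∈ A₂∈ A₁∋w A₂∌w f₁ f₂ f₃ (E , E∈) with ─⁻ {A = A.K₂ ∩ has M w s} E∈
      ... | x , E∉A₁ with ∩⁻ {A = A.K₂} x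
      ...   | E∈K₂ , E∋w = finish (three-full Kv A₁∈ A₂∈ E∈K₂ (λ { refl → has-clash A₁∋w A₂∌w }) (∉⁅⁆⁻ E∉A₁) (λ { refl → has-clash E∋w A₂∌w }) f₁ f₂
                               λ j∈V → f₃ (proj₁ (A.K₂⁻ E∈K₂)) E∋w j∈V)
      another : ∀ {w s A₁} → w ∈ A.Q → A₁ ∈ A.K₂ → A₁ ∈ has M w s → ∃[ E ] E ∈ (A.K₂ ∩ has M w s) ─ ⁅ A₁ ⁆
      another {w} {s} p q r = pick _ (pred (trans (sym (#-remove (A.K₂ ∩ has M w s) (∩⁺ q r))) (A.literal≡2 s p)))
        where
        pred : ∀ {m} → suc m ≡ 2 → 1 ≤ m
        pred refl = ≤-refl
      by : ∀ s {w A₁ A₂} → (∀ {j} → j ∈ V → A₁ ∈ occ M j) → (∀ {j} → j ∈ V → A₂ ∈ occ M j) → w ∈ A.Q → A₁ ∈ A.K₂ → A₂ ∈ A.K₂ → A₁ ∈ has M w true → A₂ ∈ has M w false →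
        (∀ {i j} → i ∈ I → i ∈ has M w s → j ∈ V → i ∈ occ M j) → ⊥
      by true  {w} {A₁} {A₂} f₁ f₂ w∈Q A₁∈ A₂∈ A₁∋w A₂∌w f₃ = third w∈Q A₁∈ A₂∈ A₁∋w A₂∌w f₁ f₂ f₃ (another w∈Q A₁∈ A₁∋w)
      by false {w} {A₁} {A₂} f₁ f₂ w∈Q A₁∈ A₂∈ A₁∋w A₂∌w f₃ = third w∈Q A₂∈ A₁∈ A₂∌w A₁∋w f₂ f₁ f₃ (another w∈Q A₂∈ A₂∌w)

-- Minimally unsatisfiable matrices of deficiency 6

opaque
  unfolding #

  ⊤ˢ : ∀ {n} → Sub n
  ⊤ˢ i = true

  #⊤ : ∀ n → # (⊤ˢ {n}) ≡ n
  #⊤ zero    = refl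
  #⊤ (suc n) = cong suc (#⊤ n)

  ∈⊤ : ∀ {n} {i : Fin n} → i ∈ ⊤ˢ
  ∈⊤ = mem refl

module _ {c n} {M : Matrix c n} where

  -- Clauses with the same sign at `v` must clash elsewhere, so each half is bounded on one variable
  -- fewer.
  clashing-full : ∀ m {J V} → # V ≤ m →
    (∀ {i i′} → i ∈ J → i′ ∈ J → i ≢ i′ → (∀ {j s} → j ∈ V → i ∈ has M j s → i′ ∈ has M j (not s) → ⊥) → ⊥) →
    (∀ {i j} → i ∈ J → j ∈ V → i ∈ occ M j) → # J ≤ 2 ^ m
  clashing-full m {J} {V} h clash full with nonempty? V
  ... | inj₁ e = ≤-trans (one (# J ≤? 1)) (pow m)
    where
    one : Dec (# J ≤ 1) → # J ≤ 1
    one (yes p) = p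
    one (no ¬p) = let i , i′ , p , q , ne = pick2 J (≰⇒> ¬p) in ⊥-elim (clash p q ne λ r → ⊥-elim (#≤0 e r))
    pow : ∀ m → 1 ≤ 2 ^ m
    pow zero    = ≤-refl
    pow (suc m) = ≤-trans (pow m) (m≤m+n (2 ^ m) _)
  clashing-full zero {J} {V} h clash full | inj₂ (v , p) = ⊥-elim (#≤0 h p)
  clashing-full (suc m) {J} {V} h clash full | inj₂ (v , p) =
      arith (# J) (# (J ∩ has M v true)) (# (J ∩ has M v false)) (2 ^ m) (#-cover cover) (half true) (half false)
    where
    arith : ∀ j t f x → j ≤ t + f → t ≤ x → f ≤ x → j ≤ 2 * x
    arith j t f x p q r = lin 0 (p ⊕ q ⊕ r) (solve (j ∷ t ∷ f ∷ x ∷ []))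
    cover : ∀ {i} → i ∈ J → i ∈ J ∩ has M v true ⊎ i ∈ J ∩ has M v false
    cover {i} q with ∈? (has M v true) i
    ... | inj₁ r = inj₁ (∩⁺ q r)
    ... | inj₂ r = inj₂ (∩⁺ q (occ⇒has (full q p) r))
    half : ∀ s → # (J ∩ has M v s) ≤ 2 ^ m
    half s = clashing-full m {J ∩ has M v s} {V ─ ⁅ v ⁆} (size (# V) (# (V ─ ⁅ v ⁆)) h (#-remove V p)) clash′
               λ q r → full (proj₁ (∩⁻ {A = J} q)) (proj₁ (─⁻ {A = V} r))
      where
      size : ∀ x y → x ≤ suc m → x ≡ suc y → y ≤ m
      size _ y (s≤s q) refl = q
      clash′ : ∀ {i i′} → i ∈ J ∩ has M v s → i′ ∈ J ∩ has M v s → i ≢ i′ →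
        (∀ {j s} → j ∈ V ─ ⁅ v ⁆ → i ∈ has M j s → i′ ∈ has M j (not s) → ⊥) → ⊥
      clash′ {i} {i′} q q′ ne f with ∩⁻ {A = J} q | ∩⁻ {A = J} q′
      ... | i∈ , i∋ | i′∈ , i′∋ = clash i∈ i′∈ ne λ {j} {t} r x y → at r x y (v ≟ j)
        where
        at : ∀ {j t} → j ∈ V → i ∈ has M j t → i′ ∈ has M j (not t) → Dec (v ≡ j) → ⊥
        at r x y (no ne)    = f (─⁺ r (∉⁅⁆⁺ ne)) x y
        at r x y (yes refl) with just-injective (trans (sym (has⁻ x)) (has⁻ i∋))
        ... | refl = has-clash i′∋ y

  -- Either value of `v` satisfies one half of the clauses and leaves the other half unsatisfiable.
  unsat-full : ∀ m {J V} → m ≤ # V → Unsat M J V → (∀ {i j} → i ∈ J → j ∈ V → i ∈ occ M j) → 2 ^ m ≤ # J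
  unsat-full zero {J} {V} h u full with nonempty? J
  ... | inj₁ e = ⊥-elim (u (λ _ → true) λ p → ⊥-elim (#≤0 e p))
  ... | inj₂ (i , p) = #⁺ p
  unsat-full (suc m) {J} {V} h u full with pick V (≤-trans (s≤s z≤n) h)
  ... | v , p = arith (# J) (# (J ∩ has M v true)) (# (J ∩ has M v false)) (2 ^ m)
                  (#-disj (λ q → proj₁ (∩⁻ {A = J} q)) (λ q → proj₁ (∩⁻ {A = J} q)) λ q r → has-clash (proj₂ (∩⁻ {A = J} q)) (proj₂ (∩⁻ {A = J} r)))
                  (half true) (half false)
    where
    arith : ∀ j t f x → t + f ≤ j → x ≤ t → x ≤ f → 2 * x ≤ j
    arith j t f x p q r = lin 0 (p ⊕ q ⊕ r) (solve (j ∷ t ∷ f ∷ x ∷ []))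
    half : ∀ s → 2 ^ m ≤ # (J ∩ has M v s)
    half s = unsat-full m {J ∩ has M v s} {V ─ ⁅ v ⁆} (size (# V) (# (V ─ ⁅ v ⁆)) h (#-remove V p)) unsat
               λ q r → full (proj₁ (∩⁻ {A = J} q)) (proj₁ (─⁻ {A = V} r))
      where
      size : ∀ x y → suc m ≤ x → x ≡ suc y → m ≤ y
      size _ y (s≤s q) refl = q
      unsat : Unsat M (J ∩ has M v s) (V ─ ⁅ v ⁆)
      unsat a h′ = u (glue ⁅ v ⁆ (λ _ → not s) a) sat
        where
        sat : ∀ {i} → i ∈ J → Sat M (glue ⁅ v ⁆ (λ _ → not s) a) V i
        sat {i} q with ∈? (has M v s) i
        ... | inj₁ r = Sat-mono (λ y → proj₁ (─⁻ {A = V} y)) (Sat-glueʳ (λ y → proj₂ (─⁻ {A = V} y)) (h′ (∩⁺ q r)))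
        ... | inj₂ r = via v p (trans (has⁻ (occ⇒has (full q p) r)) (cong just (sym (glue∈ {A = ⁅ v ⁆} {λ _ → not s} {a} (self∈ v)))))

  module Minimal (unsat : Unsat M ⊤ˢ ⊤ˢ) (minimal : ∀ i → ∃[ a ] (∀ {i′} → i′ ≢ i → Sat M a ⊤ˢ i′))
                 (deficiency : c ≡ 6 + n) (deg≥9 : ∀ j → 9 ≤ # (⊤ˢ ∩ occ M j)) where

    -- An autarky, extended by a model of all clauses but one that it touches, would satisfy
    -- everything.
    lean : Lean M ⊤ˢ ⊤ˢ
    lean {S} a _ (j , j∈S) s = go (pick _ (≤-trans (s≤s z≤n) (deg≥9 j)))
      where
      go : Nonempty (⊤ˢ ∩ occ M j) → ⊥
      go (i , p) = unsat (glue S a (proj₁ (minimal i))) sat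
        where
        i∈S : i ∈ tch M S
        i∈S = tch⁺ j∈S (proj₂ (∩⁻ {A = ⊤ˢ} p))
        sat : ∀ {i′} → i′ ∈ ⊤ˢ → Sat M (glue S a (proj₁ (minimal i))) ⊤ˢ i′
        sat {i′} q with ∈? (tch M S) i′
        ... | inj₁ t = Sat-mono (λ _ → ∈⊤) (Sat-glueˡ (s q t))
        ... | inj₂ t with proj₂ (minimal i) {i′} (λ { refl → ∈∉ i∈S t })
        ...   | via k k∈ e = via k k∈ (trans e (cong just (sym (glue∉ {A = S} {a} {proj₁ (minimal i)} (¬∈ λ k∈S → ∈∉ (tch⁺ k∈S (occ⁺ e)) t)))))

    surplus : ∀ {Y} → Nonempty Y → 6 + # Y ≤ # (⊤ˢ ∩ tch M Y)
    surplus {Y} ne with 6 + # Y ≤? # (⊤ˢ ∩ tch M Y)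
    ... | yes p = p
    ... | no ¬p = ⊥-elim (critical (5 + # Y) {⊤ˢ} {Y} {5} ≤-refl (Lean-mono (λ _ → ∈⊤) (λ p _ → p) lean) ne (pred (≰⇒> ¬p))
                    λ _ k≤5 _ C → critical-5 C k≤5 λ p → ≤-trans (deg≥9 _) (degree-tch {I = ⊤ˢ} p))
      where
      pred : ∀ {x y} → suc x ≤ suc y → x ≤ y
      pred (s≤s p) = p

    module Kernel {V} (G : Critical M 6 (⊤ˢ ∩ tch M V) V) where
      I = ⊤ˢ ∩ tch M V
      Z = ⊤ˢ ─ V
      R = ⊤ˢ ─ tch M V

      degI : ∀ {w} → w ∈ V → 9 ≤ # (I ∩ occ M w)
      degI p = ≤-trans (deg≥9 _) (degree-tch {I = ⊤ˢ} p)

      #V≤3 : # V ≤ 3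
      #V≤3 = Final.three-variables G degI

      #I≤9 : # I ≤ 9
      #I≤9 = ≤-trans (eq≤ (Critical.card G)) (≤-refl {6} ⊕ #V≤3)

      full : ∀ {i j} → i ∈ I → j ∈ V → i ∈ occ M j
      full p q = proj₂ (∩⁻ {A = I} (#-full {A = I ∩ occ M _} {I} (λ r → proj₁ (∩⁻ {A = I} r)) (≤-trans #I≤9 (degI q)) p))

      9≤#I : 9 ≤ # I
      9≤#I = ≤-trans (degI (proj₂ (Critical.ne G))) (#-mono λ r → proj₁ (∩⁻ {A = I} r))

      3≤#V : 3 ≤ # V
      3≤#V = arith (# I) (# V) (Critical.card G) 9≤#I
        where
        arith : ∀ i v → i ≡ 6 + v → 9 ≤ i → 3 ≤ v
        arith _ v refl p = lin 0 p (solve (v ∷ []))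

      -- i₁ and i₂ coincide on V; the models of the remaining clauses with respect to i₁ and i₂ differ.

      module Twins {i₁ i₂} (i₁∈ : i₁ ∈ I) (i₂∈ : i₂ ∈ I) (i₁≢i₂ : i₁ ≢ i₂)
                   (agree : ∀ {j s} → j ∈ V → i₁ ∈ has M j s → i₂ ∈ has M j (not s) → ⊥) where
        φ₁ = proj₁ (minimal i₁)
        φ₂ = proj₁ (minimal i₂)
        K = I ─ ⁅ i₁ ⁆ ─ ⁅ i₂ ⁆

        K⁻ : ∀ {i} → i ∈ K → i ∈ I × i ≢ i₁ × i ≢ i₂
        K⁻ p with ─⁻ {A = I ─ ⁅ i₁ ⁆} p
        ... | q , r with ─⁻ {A = I} q
        ...   | s , t = s , (λ e → ∉⁅⁆⁻ t (sym e)) , (λ e → ∉⁅⁆⁻ r (sym e))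

        fals : ∀ i {j s} → i ∈ has M j s → proj₁ (minimal i) j ≡ not s
        fals i p = falsified {I = ⊤ˢ} unsat (λ _ ne → proj₂ (minimal i) ne) ∈⊤ p

        same-sign : ∀ {j s} → j ∈ V → i₂ ∈ has M j s → i₁ ∈ has M j s
        same-sign {j} {s} j∈V p with ∈? (has M j s) i₁
        ... | inj₁ q = q
        ... | inj₂ q = ⊥-elim (agree j∈V (occ⇒has (full i₁∈ j∈V) q) (subst (λ t → i₂ ∈ has M j t) (sym (not-involutive s)) p))

        model : ∀ i {i′} → i′ ∈ R → i′ ≢ i → Sat M (proj₁ (minimal i)) Z i′
        model i p ne with proj₂ (minimal i) ne
        ... | via k _ e = via k (─⁺ ∈⊤ (¬∈ λ q → ∈∉ (tch⁺ q (occ⁺ e)) (proj₂ (─⁻ {A = ⊤ˢ} p)))) e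

        I-outside : ∀ {i i′} → i ∈ I → i′ ∈ R → i′ ≢ i
        I-outside p q refl = ∈∉ (proj₂ (∩⁻ {A = ⊤ˢ} p)) (proj₂ (─⁻ {A = ⊤ˢ} q))

        -- `φ₁` satisfies `i₂` but falsifies `i₁`, so it does so outside `V`, where the twins may
        -- differ; `φ₂` falsifies `i₂` at that place.
        differ : ∃[ j ] j ∈ Z × φ₁ j ≢ φ₂ j
        differ with proj₂ (minimal i₁) {i₂} (λ e → i₁≢i₂ (sym e))
        ... | via j _ e = j , ─⁺ ∈⊤ (¬∈ λ q → self-not (trans (fals i₁ (same-sign q (has⁺ e))) refl))
                            , λ f → self-not (trans f (fals i₂ (has⁺ e)))
          where
          self-not : ∀ {b} → b ≡ not b → ⊥
          self-not {true}  ()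
          self-not {false} ()

        tch-all : ∀ {i} → i ∈ tch M ⊤ˢ
        tch-all {i} with i ≟ i₁
        ... | no ne    = Sat⇒tch (proj₂ (minimal i₁) ne)
        ... | yes refl = Sat⇒tch (proj₂ (minimal i₂) i₁≢i₂)

        -- Without `i` and the duplicate `i₁` at most seven full clauses remain, too few to be
        -- unsatisfiable on three variables.
        others : ∀ {i} → i ∈ K → (∀ a → (∀ {i′} → i′ ∈ ⊤ˢ → i′ ∈ tch M V → i′ ≢ i → Sat M a V i′) → ⊥) → ⊥
        others {i} p κ = arith (# I) _ _ #I≤9 (#-remove I i₁∈) (#-remove (I ─ ⁅ i₁ ⁆) (─⁺ i∈I (∉⁅⁆⁺ λ e → i≢i₁ (sym e))))
            (unsat-full 3 {I ─ ⁅ i₁ ⁆ ─ ⁅ i ⁆} 3≤#V unsat′ λ q → full (proj₁ (─⁻ {A = I} (proj₁ (─⁻ {A = I ─ ⁅ i₁ ⁆} q)))))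
          where
          i∈I = proj₁ (K⁻ p)
          i≢i₁ = proj₁ (proj₂ (K⁻ p))
          i≢i₂ = proj₂ (proj₂ (K⁻ p))
          arith : ∀ x y z → x ≤ 9 → x ≡ suc y → y ≡ suc z → 8 ≤ z → ⊥
          arith _ _ z (s≤s (s≤s p)) refl refl q = absurd≤ (≤-trans q p)
          unsat′ : Unsat M (I ─ ⁅ i₁ ⁆ ─ ⁅ i ⁆) V
          unsat′ a s = κ a λ {i′} q t ne → sat q t ne (i′ ≟ i₁)
            where
            sat : ∀ {i′} → i′ ∈ ⊤ˢ → i′ ∈ tch M V → i′ ≢ i → Dec (i′ ≡ i₁) → Sat M a V i′
            sat q t ne (no ne′) = s (─⁺ (─⁺ (∩⁺ q t) (∉⁅⁆⁺ λ e → ne′ (sym e))) (∉⁅⁆⁺ λ e → ne (sym e)))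
            sat q t ne (yes refl) with s {i₂} (─⁺ (─⁺ i₂∈ (∉⁅⁆⁺ i₁≢i₂)) (∉⁅⁆⁺ i≢i₂))
            ... | via j j∈V e = via j j∈V (has⁻ (same-sign j∈V (has⁺ e)))

        card : # R ≤ # Z
        card = arith (# R) (# I) (# (⊤ˢ {c})) (# (⊤ˢ {n})) (# (⊤ˢ ∩ V)) (# V) (# Z) (#-split ⊤ˢ (tch M V)) (Critical.card G) (#⊤ c) (#⊤ n) deficiency
                 (#-split ⊤ˢ V) (#-mono λ p → proj₂ (∩⁻ {A = ⊤ˢ} p))
          where
          arith : ∀ r i x y w v z → i + r ≡ x → i ≡ 6 + v → x ≡ c → y ≡ n → c ≡ 6 + n → w + z ≡ y → w ≤ v → r ≤ z
          arith r _ x y w v z p refl q s t o h = lin 0 (eq≤ (trans p (trans q t)) ⊕ eq≥ (trans o s) ⊕ h) (solve (r ∷ w ∷ v ∷ z ∷ n ∷ []))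

        hall₀ : ∀ {Y} → Y ⊆ Z → Nonempty Y → # Y ≤ # (R ∩ tch M Y)
        hall₀ {Y} f (y , y∈Y) = arith (# Y) (# V) (# (V ∪ Y)) (# (⊤ˢ ∩ tch M (V ∪ Y))) (# I) _
            (#-disj ∪⁺ˡ (∪⁺ʳ {A = V}) (λ p q → ∈∉ p (proj₂ (─⁻ {A = ⊤ˢ} (f q))))) (surplus (y , ∪⁺ʳ {A = V} y∈Y)) (Critical.card G) (#-cover cover)
          where
          arith : ∀ y v u t i x → v + y ≤ u → 6 + u ≤ t → i ≡ 6 + v → t ≤ i + x → y ≤ x
          arith y v u t _ x p q refl r = lin 0 (p ⊕ q ⊕ r) (solve (y ∷ v ∷ u ∷ t ∷ x ∷ []))
          cover : ∀ {i} → i ∈ ⊤ˢ ∩ tch M (V ∪ Y) → i ∈ I ⊎ i ∈ R ∩ tch M Y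
          cover {i} p with ∩⁻ {A = ⊤ˢ} p | ∈? (tch M V) i
          ... | h , t | inj₁ q = inj₁ (∩⁺ h q)
          ... | h , t | inj₂ q with tch⁻ t
          ...   | j , r , o with ∪⁻ {A = V} r
          ...     | inj₁ s = ⊥-elim (∈∉ (tch⁺ s o) q)
          ...     | inj₂ s = inj₂ (∩⁺ (─⁺ h q) (tch⁺ s o))

        -- Apart from `R`, only the twins can contribute to the surplus 6 of `Y`. The remaining 4
        -- contradicts the bound 1 from `two-models`.
        avoiding-K : ∀ {Y} → Nonempty Y → (∀ {i} → i ∈ K → i ∉ tch M Y) → 4 + # Y ≤ # (R ∩ tch M Y)
        avoiding-K {Y} ne h = arith (# Y) (# (⊤ˢ ∩ tch M Y)) (# (R ∩ tch M Y)) (# (⁅ i₁ ⁆ ∪ ⁅ i₂ ⁆)) _ _ (surplus ne) (#-cover cover) (#-cover (∪⁻ {A = ⁅ i₁ ⁆})) (#⁅⁆ i₁) (#⁅⁆ i₂)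
          where
          arith : ∀ y t x o a b → 6 + y ≤ t → t ≤ x + o → o ≤ a + b → a ≡ 1 → b ≡ 1 → 4 + y ≤ x
          arith y t x o _ _ p q r refl refl = lin 0 (p ⊕ q ⊕ r) (solve (y ∷ t ∷ x ∷ o ∷ []))
          cover : ∀ {i} → i ∈ ⊤ˢ ∩ tch M Y → i ∈ R ∩ tch M Y ⊎ i ∈ ⁅ i₁ ⁆ ∪ ⁅ i₂ ⁆
          cover {i} p with ∩⁻ {A = ⊤ˢ} p | ∈? (tch M V) i | ∈? (⁅ i₁ ⁆ ∪ ⁅ i₂ ⁆) i
          ... | q , t | inj₂ r | _ = inj₁ (∩⁺ (─⁺ q r) t)
          ... | q , t | inj₁ r | inj₁ s = inj₂ s
          ... | q , t | inj₁ r | inj₂ s = ⊥-elim (∈∉ t (h (─⁺ (─⁺ (∩⁺ q r) (¬∈ λ x → ∈∉ (∪⁺ˡ x) s)) (¬∈ λ x → ∈∉ (∪⁺ʳ {A = ⁅ i₁ ⁆} x) s))))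

        contradiction : ⊥
        contradiction = start (pick K (arith (# I) _ (# K) 9≤#I (#-remove I i₁∈) (#-remove (I ─ ⁅ i₁ ⁆) (─⁺ i₂∈ (∉⁅⁆⁺ i₁≢i₂))))) differ
          where
          arith : ∀ x y z → 9 ≤ x → x ≡ suc y → y ≡ suc z → 1 ≤ z
          arith _ _ z (s≤s (s≤s p)) refl refl = ≤-trans (s≤s z≤n) p
          start : Nonempty K → ∃[ j ] j ∈ Z × φ₁ j ≢ φ₂ j → ⊥
          start (i₀ , i₀∈K) (j , j∈Z , φ₁≢φ₂) =
            Contract.contract {M = M} {⊤ˢ} {⊤ˢ} {V} K unsat (λ _ → tch-all) (λ _ → ∈⊤) (λ p → proj₂ (∩⁻ {A = ⊤ˢ} (proj₁ (K⁻ p)))) others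
              (j , j∈Z) card hall₀ (λ f ne h → ≤-trans (m≤n+m _ 3) (avoiding-K ne h)) i₀∈K use
            where
            use : Contraction M ⊤ˢ ⊤ˢ V K i₀ → ⊥
            use con = two-models (# Z) {M = M′} {T} {Z} {i₀} {φ₁} {φ₂} {j} ≤-refl lean′ #T (∪⁺ʳ {A = R} (self∈ i₀)) (sat i₁∈) (sat i₂∈) j∈Z φ₁≢φ₂ found
              where
              open Contraction con using (M′; T; row; α⁻; #T) renaming (lean to lean′)
              sat : ∀ {i} → i ∈ I → ∀ {i′} → i′ ∈ T → i′ ≢ i₀ → Sat M′ (proj₁ (minimal i)) Z i′
              sat {i} i∈ {i′} p ne with ∪⁻ {A = R} p
              ... | inj₂ q = ⊥-elim (ne (sym (∈⁅⁆⁻ q)))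
              ... | inj₁ q with model i q (I-outside i∈ q)
              ...   | via k k∈ e = via k k∈ (trans (row q k) e)
              found : ∀ {Y} → Y ⊆ Z → Nonempty Y → i₀ ∉ tch M′ Y → # (T ∩ tch M′ Y) ≤ 1 + # Y → ⊥
              found {Y} f ne i₀∉ h = count (# Y) _ _ (avoiding-K ne (α⁻ i₀∉ f)) (#-mono incl) h
                where
                incl : R ∩ tch M Y ⊆ T ∩ tch M′ Y
                incl p with ∩⁻ {A = R} p
                ... | q , t with tch⁻ t
                ...   | k , r , o = ∩⁺ (∪⁺ˡ q) (tch⁺ r (occ⁺ (trans (row q k) (proj₂ (occ⁻ o)))))
                count : ∀ y x t → 4 + y ≤ x → x ≤ t → t ≤ 1 + y → ⊥
                count y x t p q r with lin {_} {_} 2 {1} {0} (p ⊕ q ⊕ r) (solve (y ∷ x ∷ t ∷ []))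
                ... | ()

      twins : ⊥
      twins = absurd≤ (≤-trans 9≤#I (clashing-full 3 {I} {V} #V≤3 (λ p q ne agree → Twins.contradiction p q ne agree) full))

    impossible : 1 ≤ n → ⊥
    impossible h = go (pick (⊤ˢ {n}) (≤-trans h (eq≥ (#⊤ n))))
      where
      go : Nonempty (⊤ˢ {n}) → ⊥
      go ne = critical (6 + # (⊤ˢ {n})) {⊤ˢ} {⊤ˢ} {6} ≤-refl lean ne
                (arith (# (⊤ˢ ∩ tch M ⊤ˢ)) (# (⊤ˢ {c})) (# (⊤ˢ {n})) (#-mono λ p → proj₁ (∩⁻ {A = ⊤ˢ} p)) (#⊤ c) (#⊤ n) deficiency) found
        where
        arith : ∀ x y z → x ≤ y → y ≡ c → z ≡ n → c ≡ 6 + n → x ≤ 6 + z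
        arith x y z p refl refl refl = p
        found : ∀ {k′ Q} → 1 ≤ k′ → k′ ≤ 6 → Q ⊆ ⊤ˢ → Critical M k′ (⊤ˢ ∩ tch M Q) Q → ⊥
        found {k′} {Q} _ q _ C = by (k′ ≤? 5)
          where
          by : Dec (k′ ≤ 5) → ⊥
          by (yes r) = critical-5 C r λ p → ≤-trans (deg≥9 _) (degree-tch {I = ⊤ˢ} p)
          by (no ¬r) = Kernel.twins (subst (λ k → Critical M k (⊤ˢ ∩ tch M Q) Q) (≤-antisym q (≰⇒> ¬r)) C)

-- The matrix of a clause-set

open import Data.Integer.Base as ℤ using (+_; _⊖_)
open import Data.Integer.Properties using (⊖-≥; ⊖-<; +-injective)
open import Data.List.Base using (List; length; filter; lookup; foldr; map; concatMap)
open import Data.List.Membership.Propositional using (find) renaming (_∈_ to _∈ˡ_)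
open import Data.List.Membership.Propositional.Properties
  using (∈-map⁺; ∈-concatMap⁺; ∈-deduplicate⁺; ∈-filter⁺; ∈-filter⁻; ∈-lookup)
import Data.List.Membership.DecPropositional as DecMembership
open import Data.List.Properties using (length-filter)
open import Data.List.Relation.Unary.All as All using (All; []; _∷_)
open import Data.List.Relation.Unary.AllPairs using (AllPairs; []; _∷_; allPairs?)
open import Data.List.Relation.Unary.Any as Any using (Any; here; there)
open import Data.List.Relation.Unary.Any.Properties using (lookup-index)
open import Data.List.Relation.Unary.Unique.DecPropositional.Properties using (deduplicate-!)
open import Relation.Unary using (Decidable)

open DecMembership _≟ˡ_ using () renaming (_∈?_ to _∈ˡ?_)
open DecMembership ℕ._≟_ using () renaming (_∈?_ to _∈ᵛ?_)

⊖-positive : ∀ m n {k} → m ⊖ n ≡ + suc k → m ≡ suc k + n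
⊖-positive m n {k} e with m <? n
... | no m≮n = trans (sym (m∸n+n≡m (≮⇒≥ m≮n))) (cong (_+ n) (+-injective (trans (sym (⊖-≥ (≮⇒≥ m≮n))) e)))
... | yes m<n = ⊥-elim (nonpos (n ∸ m) (trans (sym (⊖-< m<n)) e))
  where
  nonpos : ∀ d → ℤ.- (+ d) ≡ + suc k → ⊥
  nonpos zero ()
  nonpos (suc d) ()

allPairs-lookup : ∀ {A : Set} {_∼_ : A → A → Set} → (∀ {x y} → x ∼ y → y ∼ x) → ∀ {xs} → AllPairs _∼_ xs →
  ∀ {i j} → i ≢ j → lookup xs i ∼ lookup xs j
allPairs-lookup s (p ∷ ps) {zero}  {zero}  ne = ⊥-elim (ne refl)
allPairs-lookup s (p ∷ ps) {zero}  {suc j} ne = All.lookup p (∈-lookup j)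
allPairs-lookup s (p ∷ ps) {suc i} {zero}  ne = s (All.lookup p (∈-lookup i))
allPairs-lookup s (p ∷ ps) {suc i} {suc j} ne = allPairs-lookup s ps λ e → ne (cong suc e)

opaque
  unfolding #

  filter≤# : ∀ {A : Set} {P : A → Set} (P? : Decidable P) xs {S : Sub (length xs)} →
    (∀ i → P (lookup xs i) → S i ≡ true) → length (filter P? xs) ≤ # S
  filter≤# P? []       h = z≤n
  filter≤# P? (x ∷ xs) {S} h with P? x
  ... | yes p rewrite h zero p = s≤s (filter≤# P? xs {λ i → S (suc i)} λ i → h (suc i))
  ... | no _ = ≤-trans (filter≤# P? xs {λ i → S (suc i)} λ i → h (suc i)) (m≤n+m _ (nat (S zero)))

filter-cover : ∀ {A : Set} {P Q R : A → Set} (P? : Decidable P) (Q? : Decidable Q) (R? : Decidable R) xs →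
  (∀ {x} → P x → Q x ⊎ R x) → length (filter P? xs) ≤ length (filter Q? xs) + length (filter R? xs)
filter-cover P? Q? R? []       h = z≤n
filter-cover P? Q? R? (x ∷ xs) h with filter-cover P? Q? R? xs h | P? x | Q? x | R? x
... | ih | yes p | no ¬q | no ¬r = ⊥-elim (neither (h p))
  where
  neither : _ ⊎ _ → ⊥
  neither (inj₁ q) = ¬q q
  neither (inj₂ r) = ¬r r
... | ih | yes p | yes q | no  _ = s≤s ih
... | ih | yes p | no  _ | yes r = ≤-trans (s≤s ih) (eq≥ (+-suc (length (filter Q? xs)) (length (filter R? xs))))
... | ih | yes p | yes q | yes r = s≤s (≤-trans ih (≤-refl {length (filter Q? xs)} ⊕ n≤1+n (length (filter R? xs))))
... | ih | no ¬p | yes q | yes r = ≤-trans ih (n≤1+n (length (filter Q? xs)) ⊕ n≤1+n (length (filter R? xs)))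
... | ih | no ¬p | yes q | no  _ = ≤-trans ih (n≤1+n (length (filter Q? xs)) ⊕ ≤-refl {length (filter R? xs)})
... | ih | no ¬p | no  _ | yes r = ≤-trans ih (≤-refl {length (filter Q? xs)} ⊕ n≤1+n (length (filter R? xs)))
... | ih | no ¬p | no  _ | no  _ = ih

minimum≤ : ∀ {m ms} → m ∈ˡ ms → minimum ms ≤ m
minimum≤ {m} {m₀ ∷ ms} p = foldr≤ ms p
  where
  foldr≤ : ∀ ms → m ∈ˡ m₀ ∷ ms → foldr _⊓_ m₀ ms ≤ m
  foldr≤ []       (here refl) = ≤-refl
  foldr≤ (x ∷ ms) (here refl) = ≤-trans (m⊓n≤n x _) (foldr≤ ms (here refl))
  foldr≤ (x ∷ ms) (there (here refl)) = m⊓n≤m x _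
  foldr≤ (x ∷ ms) (there (there p)) = ≤-trans (m⊓n≤n x _) (foldr≤ ms (there p))

literal : Bool → Variable → Literal
literal true  = pos
literal false = neg

literal-var : ∀ x → ∃[ b ] x ≡ literal b (var x)
literal-var (pos v) = true , refl
literal-var (neg v) = false , refl

eval-literal : ∀ φ b v → eval φ (literal b v) ≡ true → φ v ≡ b
eval-literal φ true  v e = e
eval-literal φ false v e with φ v
... | false = refl

literal-eval : ∀ φ b v → φ v ≡ b → eval φ (literal b v) ≡ true
literal-eval φ true  v e = e
literal-eval φ false v e = cong not e

sign : List Literal → Variable → Maybe Bool
sign xs v with pos v ∈ˡ? xs | neg v ∈ˡ? xs
... | yes _ | _     = just true
... | no _  | yes _ = just false
... | no _  | no _  = nothing

sign⁻ : ∀ xs v {b} → sign xs v ≡ just b → literal b v ∈ˡ xs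
sign⁻ xs v e with pos v ∈ˡ? xs | neg v ∈ˡ? xs
sign⁻ xs v refl | yes p | _     = p
sign⁻ xs v refl | no _  | yes q = q

sign⁺ : ∀ (C : Clause) v b → literal b v ∈ˡ literals C → sign (literals C) v ≡ just b
sign⁺ C v b h with pos v ∈ˡ? literals C | neg v ∈ˡ? literals C
sign⁺ C v true  h | yes p | _     = refl
sign⁺ C v false h | yes p | _     = ⊥-elim (clashFree C p h)
sign⁺ C v true  h | no ¬p | _     = ⊥-elim (¬p h)
sign⁺ C v false h | no ¬p | yes q = refl
sign⁺ C v false h | no ¬p | no ¬q = ⊥-elim (¬q h)

var∈varˢ : ∀ F {C x} → C ∈ˡ clauses F → x ∈ˡ literals C → var x ∈ˡ varˢ F
var∈varˢ F C∈F x∈C = ∈-deduplicate⁺ ℕ._≟_ (∈-concatMap⁺ varᶜ (Any.map (λ { refl → ∈-map⁺ var x∈C }) C∈F))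

module Encoding (F : ClauseSet) where

  clause : Fin (c F) → Clause
  clause = lookup (clauses F)

  variable-of : Fin (n F) → Variable
  variable-of = lookup (varˢ F)

  M : Matrix (c F) (n F)
  M i j = sign (literals (clause i)) (variable-of j)

  index : ∀ {v} → v ∈ˡ varˢ F → Fin (n F)
  index = Any.index

  index-variable : ∀ {v} (p : v ∈ˡ varˢ F) → variable-of (index p) ≡ v
  index-variable p = sym (lookup-index p)

  variable-injective : ∀ {i j} → variable-of i ≡ variable-of j → i ≡ j
  variable-injective {i} {j} e with i ≟ j
  ... | yes f = f
  ... | no ne = ⊥-elim (allPairs-lookup (λ f g → f (sym g)) (deduplicate-! ℕ._≟_ (concatMap varᶜ (clauses F))) ne e)

  row : ∀ {C} (p : C ∈ˡ clauses F) → clause (Any.index p) ≡ C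
  row p = sym (lookup-index p)

  unsat : ¬ Satisfiable F → Unsat M ⊤ˢ ⊤ˢ
  unsat u a s = u (φ , All.tabulate λ {C} p → sat (row p) (s ∈⊤))
    where
    value : ∀ {v} → Dec (v ∈ˡ varˢ F) → Bool
    value (yes p) = a (index p)
    -- An arbitrary value: these variables do not occur in `F`.
    value (no _)  = true
    φ : Assignment
    φ v = value (v ∈ᵛ? varˢ F)
    φ-value : ∀ j → φ (variable-of j) ≡ a j
    φ-value j with variable-of j ∈ᵛ? varˢ F
    ... | yes p = cong a (variable-injective (index-variable p))
    ... | no ¬p = ⊥-elim (¬p (∈-lookup j))
    sat : ∀ {i C} → clause i ≡ C → Sat M a ⊤ˢ i → Any (λ x → eval φ x ≡ true) (literals C)
    sat {i} refl (via j _ e) = Any.map (λ { refl → literal-eval φ (a j) (variable-of j) (φ-value j) }) (sign⁻ (literals (clause i)) (variable-of j) e)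

  minimal : (∀ {C} → C ∈ˡ clauses F → Satisfiable (F ∖ C)) → ∀ i → ∃[ a ] (∀ {i′} → i′ ≢ i → Sat M a ⊤ˢ i′)
  minimal h i with h (∈-lookup i)
  ... | φ , all = (λ j → φ (variable-of j)) , λ {i′} ne →
      sat i′ (find (All.lookup all (∈-filter⁺ (λ D → ¬? (clause i ≈? D)) (∈-lookup {xs = clauses F} i′)
        (allPairs-lookup {_∼_ = λ C D → ¬ C ≈ D} (λ f (p , q) → f (q , p)) (distinct F) (λ e → ne (sym e))))))
    where
    sat : ∀ i′ → ∃[ x ] x ∈ˡ literals (clause i′) × eval φ x ≡ true → Sat M (λ j → φ (variable-of j)) ⊤ˢ i′
    sat i′ (x , x∈ , e) with literal-var x
    ... | b , f = via (index v∈) ∈⊤ (trans (sign⁺ (clause i′) (variable-of (index v∈)) b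
                    (subst (_∈ˡ literals (clause i′)) (trans f (cong (literal b) (sym (index-variable v∈)))) x∈))
                    (cong just (sym (trans (cong φ (index-variable v∈)) (eval-literal φ b (var x) (trans (cong (eval φ) (sym f)) e))))))
      where
      v∈ = var∈varˢ F (∈-lookup i′) x∈

  degree≤ : ∀ j → vdeg F (variable-of j) ≤ # (⊤ˢ ∩ occ M j)
  degree≤ j = ≤-trans (ld≤ true ⊕ ld≤ false) (eq≤ (#-literals ⊤ˢ j true))
    where
    ld≤ : ∀ b → ld F (literal b (variable-of j)) ≤ # (⊤ˢ ∩ has M j b)
    ld≤ b = filter≤# (λ C → literal b (variable-of j) ∈ˡ? literals C) (clauses F) λ i p →
              holds (∩⁺ {A = ⊤ˢ} {has M j b} ∈⊤ (has⁺ (sign⁺ (clause i) (variable-of j) b p)))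

-- The upper bounds for clause-sets

no-high-degrees : ∀ F → MU F → δ F ≡ + 6 → 0 < n F → (∀ {v} → v ∈ˡ varˢ F → 9 ≤ vdeg F v) → ⊥
no-high-degrees F (u , h) d 0<n deg = Minimal.impossible (unsat u) (minimal h) (⊖-positive (c F) (n F) d)
    (λ j → ≤-trans (deg (∈-lookup j)) (degree≤ j)) 0<n
  where open Encoding F

nfc≤vdeg : ∀ F {v} → v ∈ˡ varˢ F → nfc F ≤ vdeg F v
nfc≤vdeg F {v} v∈ = filter-cover (full? F) (λ C → pos v ∈ˡ? literals C) (λ C → neg v ∈ˡ? literals C) (clauses F) λ {C} (_ , f) → occurs C (f v∈)
  where
  occurs : ∀ C → v ∈ˡ varᶜ C → pos v ∈ˡ literals C ⊎ neg v ∈ˡ literals C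
  occurs C p = go (literals C) p
    where
    go : ∀ xs → v ∈ˡ map var xs → pos v ∈ˡ xs ⊎ neg v ∈ˡ xs
    go (pos w ∷ xs) (here refl) = inj₁ (here refl)
    go (neg w ∷ xs) (here refl) = inj₂ (here refl)
    go (x ∷ xs) (there p) with go xs p
    ... | inj₁ q = inj₁ (there q)
    ... | inj₂ q = inj₂ (there q)

minvdeg-MU : IsUpperBound minvdeg (WithVariables (MU [δ= + 6 ])) 8
minvdeg-MU F ((mu , d) , 0<n) with minvdeg F ≤? 8
... | yes p = p
... | no ¬p = ⊥-elim (no-high-degrees F mu d 0<n λ {v} v∈ → ≤-trans (≰⇒> ¬p) (minimum≤ (∈-map⁺ (vdeg F) v∈)))

nfc-MU : IsUpperBound nfc (MU [δ= + 6 ]) 8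
nfc-MU F (mu , d) with nfc F ≤? 8
... | yes p = p
... | no ¬p = ⊥-elim (by (0 <? n F))
  where
  by : Dec (0 < n F) → ⊥
  by (yes q) = no-high-degrees F mu d q λ v∈ → ≤-trans (≰⇒> ¬p) (nfc≤vdeg F v∈)
  -- Without variables, deficiency 6 leaves only six clauses.
  by (no ¬q) = arith (n F) (⊖-positive (c F) (n F) d) (≮⇒≥ ¬q) (≤-trans (≰⇒> ¬p) (length-filter (full? F) (clauses F)))
    where
    arith : ∀ n {c} → c ≡ 6 + n → n ≤ 0 → 9 ≤ c → ⊥
    arith zero refl z≤n (s≤s (s≤s (s≤s (s≤s (s≤s (s≤s ()))))))

-- The assignment falsifying `C` satisfies every other clause at a literal that clashes with `C`.
UHIT⇒MU : ∀ {F} → UHIT F → MU F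
UHIT⇒MU {F} (u , h) = u , λ {C} C∈ → falsify C , All.tabulate λ {D} D∈ →
    let D∈F , C≉D = ∈-filter⁻ (λ D → ¬? (C ≈? D)) {xs = clauses F} D∈
        x , x∈C , x̄∈D = h C∈ D∈F C≉D
    in Any.map (λ { refl → complement C x x∈C }) x̄∈D
  where
  falsify : Clause → Assignment
  falsify C v = does (neg v ∈ˡ? literals C)
  complement : ∀ C x → x ∈ˡ literals C → eval (falsify C) (comp x) ≡ true
  complement C (pos v) p = cong not (dec-false (neg v ∈ˡ? literals C) (clashFree C p))
  complement C (neg v) p = dec-true (neg v ∈ˡ? literals C) p

-- The extremal hitting clause-set

mkClause : ∀ xs → True (All.all? (λ x → ¬? (comp x ∈ˡ? xs)) xs) → Clause
mkClause xs t = record { literals = xs ; clashFree = All.lookup (toWitness t) }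

-- The two binary clauses clash and are falsified by four assignments each; the full clauses exclude
-- the other eight of the 16. Deficiency is 10 - 4, and the minimal degree 8 is attained at variable
-- 3, which occurs in no binary clause.
extremal-clauses : List Clause
extremal-clauses =
    mkClause (pos 0 ∷ pos 1 ∷ []) _
  ∷ mkClause (neg 0 ∷ pos 2 ∷ []) _
  ∷ mkClause (pos 0 ∷ neg 1 ∷ pos 2 ∷ pos 3 ∷ []) _
  ∷ mkClause (pos 0 ∷ neg 1 ∷ pos 2 ∷ neg 3 ∷ []) _
  ∷ mkClause (pos 0 ∷ neg 1 ∷ neg 2 ∷ pos 3 ∷ []) _
  ∷ mkClause (pos 0 ∷ neg 1 ∷ neg 2 ∷ neg 3 ∷ []) _
  ∷ mkClause (neg 0 ∷ pos 1 ∷ neg 2 ∷ pos 3 ∷ []) _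
  ∷ mkClause (neg 0 ∷ pos 1 ∷ neg 2 ∷ neg 3 ∷ []) _
  ∷ mkClause (neg 0 ∷ neg 1 ∷ neg 2 ∷ pos 3 ∷ []) _
  ∷ mkClause (neg 0 ∷ neg 1 ∷ neg 2 ∷ neg 3 ∷ []) _
  ∷ []

extremal : ClauseSet
extremal = record
  { clauses  = extremal-clauses
  ; distinct = toWitness {a? = allPairs? (λ C D → ¬? (C ≈? D)) extremal-clauses} _
  }

satisfies : Assignment → List Clause → Bool
satisfies φ []       = true
satisfies φ (C ∷ Cs) = foldr (λ x b → eval φ x ∨ b) false (literals C) ∧ satisfies φ Cs

clause-true : ∀ {φ} xs → Any (λ x → eval φ x ≡ true) xs → foldr (λ x b → eval φ x ∨ b) false xs ≡ true
clause-true (x ∷ xs) (here e) rewrite e = refl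
clause-true {φ} (x ∷ xs) (there q) with eval φ x
... | true  = refl
... | false = clause-true xs q

satisfies-complete : ∀ φ Cs → All (λ C → Any (λ x → eval φ x ≡ true) (literals C)) Cs → satisfies φ Cs ≡ true
satisfies-complete φ []       []       = refl
satisfies-complete φ (C ∷ Cs) (p ∷ ps) rewrite clause-true (literals C) p = satisfies-complete φ Cs ps

extremal-falsified : ∀ φ → satisfies φ extremal-clauses ≡ false
extremal-falsified φ with φ 0 | φ 1 | φ 2 | φ 3
... | true  | true  | true  | true  = refl
... | true  | true  | true  | false = refl
... | true  | true  | false | true  = refl
... | true  | true  | false | false = refl
... | true  | false | true  | true  = refl
... | true  | false | true  | false = refl
... | true  | false | false | true  = refl
... | true  | false | false | false = refl
... | false | true  | true  | true  = refl
... | false | true  | true  | false = refl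
... | false | true  | false | true  = refl
... | false | true  | false | false = refl
... | false | false | true  | true  = refl
... | false | false | true  | false = refl
... | false | false | false | true  = refl
... | false | false | false | false = refl

Clashing : Clause → Clause → Set
Clashing C D = Any (λ x → comp x ∈ˡ literals D) (literals C)

extremal-clashing : All (λ C → All (λ D → C ≈ D ⊎ Clashing C D) extremal-clauses) extremal-clauses
extremal-clashing = toWitness {a? = All.all? (λ C → All.all? (λ D →
  (C ≈? D) ⊎-dec Any.any? (λ x → comp x ∈ˡ? literals D) (literals C)) extremal-clauses) extremal-clauses} _

extremal-hitting : Hitting extremal
extremal-hitting {C} {D} C∈ D∈ C≉D = by (All.lookup (All.lookup extremal-clashing C∈) D∈)
  where
  by : C ≈ D ⊎ Clashing C D → ∃[ x ] x ∈ˡ literals C × comp x ∈ˡ literals D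
  by (inj₁ e) = ⊥-elim (C≉D e)
  by (inj₂ p) = find p

extremal-UHIT : (UHIT [δ= + 6 ]) extremal
extremal-UHIT = ((λ (φ , s) → absurd (trans (sym (satisfies-complete φ extremal-clauses s)) (extremal-falsified φ))) , λ {C} {D} → extremal-hitting {C} {D}) , refl
  where
  absurd : true ≡ false → ⊥
  absurd ()

extremal-MU : (MU [δ= + 6 ]) extremal
extremal-MU = UHIT⇒MU {extremal} (proj₁ extremal-UHIT) , refl

theorem14p4 : (nfc[ UHIT [δ= + 6 ] ]max≡ 8) ×
    (nfc[ MU [δ= + 6 ] ]max≡ 8) ×
    (minvdeg[ UHIT [δ= + 6 ] ]≡ 8) ×
    (minvdeg[ MU [δ= + 6 ] ]≡ 8) ×
    (8 ≡ N 6 ∸ 1)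
theorem14p4 =
    ((λ F (h , d) → nfc-MU F (UHIT⇒MU {F} h , d)) , extremal , extremal-UHIT , refl)
  , (nfc-MU , extremal , extremal-MU , refl)
  , ((λ F ((h , d) , p) → minvdeg-MU F ((UHIT⇒MU {F} h , d) , p)) , λ u b → b extremal (extremal-UHIT , s≤s z≤n))
  , (minvdeg-MU , λ u b → b extremal (extremal-MU , s≤s z≤n))
  , refl
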